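{- For any integers $s,t,k\ge 1$, $\mathrm{ex}(n,K_{s,t}^{k-1})=O(n^{1+\frac{s}{sk+1}})$ as $n\to\infty$ (with implied constant depending on $s,t,k$). In particular, for any bipartite graph $H$ and any integer $k\ge 1$, there exists $\delta>0$ such that $\mathrm{ex}(n,H^{k-1})=O(n^{1+1/k-\delta})$.
   Context: For a graph $H$, $\mathrm{ex}(n,H)$ is the maximum number of edges in an $n$-vertex graph containing no copy of $H$ as a subgraph. For an integer $m\ge 0$, $H^m$ denotes the $m$-subdivision of $H$, i.e. the graph obtained by replacing the edges of $H$ by internally disjoint paths of length $m+1$; in particular $H^0=H$. So $K_{s,t}^{k-1}$ is obtained from the complete bipartite graph $K_{s,t}$ by replacing its edges by internally disjoint paths of length $k$. -}

module Defs where

open import Data.Bool using (Bool)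
open import Data.Empty using (⊥)
open import Data.Fin as Fin using (Fin; zero; suc; inject₁; splitAt; combine; remQuot; finToFun; funToFin; _↑ˡ_; _↑ʳ_)
import Data.Fin.Properties as Fin
open import Data.Integer using (ℤ; +_; -[1+_])
open import Data.List as List using (List; length; filter; cartesianProduct; allFin)
open import Data.List.Extrema.Nat using (max; argmax-sel; xs≤max)
open import Data.List.Membership.Propositional using (_∈_)
import Data.List.Membership.Propositional.Properties as ∈
open import Data.List.Properties using (filter-≐)
import Data.List.Relation.Unary.All as ListAll
open import Data.Nat as ℕ using (ℕ; suc; _+_; _*_; _^_; _≤_; _≥_)
open import Data.Nat.Properties using (n≤0⇒n≡0)
open import Data.Product using (Σ; ∃; ∃₂; _×_; _,_; proj₁; proj₂)
open import Data.Rational.Unnormalised using (ℚᵘ; ↥_; ↧ₙ_)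
open import Data.Sum using (_⊎_; inj₁; inj₂; swap)
open import Data.Unit using (⊤)
open import Data.Vec as Vec using (Vec; []; _∷_; _∷ʳ_; tabulate; lookup)
open import Data.Vec.Relation.Unary.All using (All; []; _∷_)
import Data.Vec.Relation.Unary.All.Properties as All
open import Data.Vec.Relation.Unary.AllPairs using ([]; _∷_)
open import Data.Vec.Relation.Unary.Unique.Propositional using (Unique)
import Data.Vec.Relation.Unary.Unique.Propositional.Properties as Unique
open import Function using (_∘_)
open import Function.Definitions using (Injective)
open import Level using (0ℓ)
open import Relation.Binary using (Rel; Decidable; Symmetric; Irreflexive)
open import Relation.Binary.PropositionalEquality
open import Relation.Nullary using (¬_; Dec; yes; no; contradiction)
open import Relation.Nullary.Decidable using (map′; ¬?; _×-dec_; _⊎-dec_; _→-dec_)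

private
  variable
    n h : ℕ

------------------------------------------------------------------------
-- Finite simple graphs

record Graph (n : ℕ) : Set₁ where
  field
    Adj        : Rel (Fin n) 0ℓ
    adj?       : Decidable Adj
    adj-sym    : Symmetric Adj
    adj-irrefl : Irreflexive _≡_ Adj

open Graph public

-- Each edge {u , v} is represented once, by the pair with u < v.
IsEdge : Graph n → Fin n × Fin n → Set
IsEdge G (u , v) = u Fin.< v × Adj G u v

isEdge? : (G : Graph n) (uv : Fin n × Fin n) → Dec (IsEdge G uv)
isEdge? G (u , v) = u Fin.<? v ×-dec adj? G u v

edges : Graph n → List (Fin n × Fin n)
edges {n} G = filter (isEdge? G) (cartesianProduct (allFin n) (allFin n))

#edges : Graph n → ℕ
#edges G = length (edges G)

Bipartite : Graph n → Set
Bipartite {n} G = Σ (Fin n → Bool) λ c → ∀ u v → Adj G u v → c u ≢ c v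

infix 4 _⊑_ _⊑?_

-- G contains a (not necessarily induced) copy of H.
_⊑_ : Graph h → Graph n → Set
_⊑_ {h} {n} H G = Σ (Fin h → Fin n) λ f →
  Injective _≡_ _≡_ f × (∀ u v → Adj H u v → Adj G (f u) (f v))

-- Search over all maps Fin h → Fin n, coded as elements of Fin (n ^ h).
_⊑?_ : (H : Graph h) (G : Graph n) → Dec (H ⊑ G)
_⊑?_ {h} {n} H G = map′ to from (Fin.any? λ c → isCopy? (finToFun {n} {h} c))
  where
  IsCopy : (Fin h → Fin n) → Set
  IsCopy f = (∀ u v → f u ≡ f v → u ≡ v) × (∀ u v → Adj H u v → Adj G (f u) (f v))

  isCopy? : ∀ f → Dec (IsCopy f)
  isCopy? f =
    Fin.all? (λ u → Fin.all? λ v → f u Fin.≟ f v →-dec u Fin.≟ v) ×-dec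
    Fin.all? (λ u → Fin.all? λ v → adj? H u v →-dec adj? G (f u) (f v))

  to : (∃ λ c → IsCopy (finToFun {n} {h} c)) → H ⊑ G
  to (c , inj , hom) = finToFun c , (λ {u} {v} → inj u v) , hom

  from : H ⊑ G → ∃ λ c → IsCopy (finToFun {n} {h} c)
  from (f , inj , hom) = funToFin f ,
    (λ u v eq → inj (trans (sym (decode u)) (trans eq (decode v)))) ,
    (λ u v uv → subst₂ (Adj G) (sym (decode u)) (sym (decode v)) (hom u v uv))
    where
    decode : ∀ u → finToFun (funToFin f) u ≡ f u
    decode = Fin.finToFun-funToFin f

Free : Graph h → Graph n → Set
Free H G = ¬ H ⊑ G

free? : (H : Graph h) (G : Graph n) → Dec (Free H G)
free? H G = ¬? (H ⊑? G)

------------------------------------------------------------------------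
-- Extremal numbers

-- The symmetric irreflexive part of the n × n Boolean matrix coded by c.
decodeGraph : Fin (2 ^ (n * n)) → Graph n
decodeGraph {n} c = record
  { Adj        = λ u v → u ≢ v × (Entry u v ⊎ Entry v u)
  ; adj?       = λ u v → ¬? (u Fin.≟ v) ×-dec (entry? u v ⊎-dec entry? v u)
  ; adj-sym    = λ (u≢v , uv) → u≢v ∘ sym , swap uv
  ; adj-irrefl = λ u≡v (u≢v , _) → u≢v u≡v
  }
  where
  Entry : Rel (Fin n) 0ℓ
  Entry u v = finToFun {2} {n * n} c (combine u v) ≡ suc Fin.zero

  entry? : Decidable Entry
  entry? u v = finToFun {2} {n * n} c (combine u v) Fin.≟ suc Fin.zero

-- Every graph on Fin n, up to logically equivalent adjacency (see allGraphs-complete).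
allGraphs : ∀ n → List (Graph n)
allGraphs n = List.map decodeGraph (allFin (2 ^ (n * n)))

-- By convention ex n H = 0 if no graph on n vertices is H-free, which
-- happens only if H has no edges and at most n vertices.
ex : ∀ n → Graph h → ℕ
ex n H = max 0 (List.map #edges (filter (free? H) (allGraphs n)))

allGraphs-complete : (G : Graph n) → ∃ λ G′ → G′ ∈ allGraphs n ×
  (∀ {u v} → Adj G u v → Adj G′ u v) × (∀ {u v} → Adj G′ u v → Adj G u v)
allGraphs-complete {n} G =
  decodeGraph (funToFin code) , ∈.∈-map⁺ decodeGraph (∈.∈-allFin _) , to , from
  where
  bit : ∀ {P : Set} → Dec P → Fin 2
  bit (yes _) = suc Fin.zero
  bit (no _)  = Fin.zero

  bit⁺ : ∀ {P : Set} (P? : Dec P) → P → bit P? ≡ suc Fin.zero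
  bit⁺ (yes _) _ = refl
  bit⁺ (no ¬p) p = contradiction p ¬p

  bit⁻ : ∀ {P : Set} (P? : Dec P) → bit P? ≡ suc Fin.zero → P
  bit⁻ (yes p) _ = p

  matrix : Fin n × Fin n → Fin 2
  matrix (u , v) = bit (adj? G u v)

  code : Fin (n * n) → Fin 2
  code i = matrix (remQuot n i)

  entry : ∀ u v → finToFun (funToFin code) (combine u v) ≡ bit (adj? G u v)
  entry u v = trans (Fin.finToFun-funToFin code (combine u v))
                    (cong matrix (Fin.remQuot-combine u v))

  to : ∀ {u v} → Adj G u v → Adj (decodeGraph (funToFin code)) u v
  to {u} {v} uv = (λ u≡v → adj-irrefl G u≡v uv) ,
                  inj₁ (trans (entry u v) (bit⁺ (adj? G u v) uv))

  from : ∀ {u v} → Adj (decodeGraph (funToFin code)) u v → Adj G u v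
  from {u} {v} (_ , inj₁ e) = bit⁻ (adj? G u v) (trans (sym (entry u v)) e)
  from {u} {v} (_ , inj₂ e) =
    adj-sym G (bit⁻ (adj? G v u) (trans (sym (entry v u)) e))

-- The next two lemmas say that ex n H is the maximum it is meant to be.
ex-upper : (H : Graph h) (G : Graph n) → Free H G → #edges G ≤ ex n H
ex-upper H G free with allGraphs-complete G
... | G′ , G′∈ , to , from = subst (_≤ _) (sym same)
    (ListAll.lookup (xs≤max 0 _) (∈.∈-map⁺ #edges (∈.∈-filter⁺ _ G′∈ free′)))
  where
  free′ : Free H G′
  free′ (f , inj , hom) = free (f , inj , λ u v uv → from (hom u v uv))

  same : #edges G ≡ #edges G′
  same = cong length (filter-≐ (isEdge? G) (isEdge? G′)
    ((λ (u<v , uv) → u<v , to uv) , (λ (u<v , uv) → u<v , from uv))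
    (cartesianProduct (allFin _) (allFin _)))

ex-attained : (H : Graph h) (G : Graph n) → Free H G →
              ∃ λ G′ → Free H G′ × #edges {n} G′ ≡ ex n H
ex-attained {n = n} H G free with argmax-sel (λ e → e) 0
  (List.map #edges (filter (free? H) (allGraphs n)))
... | inj₁ ex≡0 = G , free , trans (n≤0⇒n≡0 (subst (#edges G ≤_) ex≡0 (ex-upper H G free))) (sym ex≡0)
... | inj₂ ex∈ with ∈.∈-map⁻ #edges ex∈
...   | G′ , G′∈ , ex≡ = G′ , proj₂ (∈.∈-filter⁻ (free? H) {xs = allGraphs n} G′∈) , sym ex≡

------------------------------------------------------------------------
-- Complete bipartite graphs

Opposite : ∀ {A B : Set} → Rel (A ⊎ B) 0ℓ
Opposite (inj₁ _) (inj₂ _) = ⊤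
Opposite (inj₂ _) (inj₁ _) = ⊤
Opposite (inj₁ _) (inj₁ _) = ⊥
Opposite (inj₂ _) (inj₂ _) = ⊥

K : ∀ s t → Graph (s + t)
K s t = record
  { Adj        = λ u v → Opposite (splitAt s u) (splitAt s v)
  ; adj?       = λ u v → opposite? (splitAt s u) (splitAt s v)
  ; adj-sym    = λ {u} {v} → opposite-sym (splitAt s u) (splitAt s v)
  ; adj-irrefl = λ { {u} refl → opposite-irrefl (splitAt s u) }
  }
  where
  opposite? : ∀ {A B : Set} → Decidable (Opposite {A} {B})
  opposite? (inj₁ _) (inj₂ _) = yes _
  opposite? (inj₂ _) (inj₁ _) = yes _
  opposite? (inj₁ _) (inj₁ _) = no λ ()
  opposite? (inj₂ _) (inj₂ _) = no λ ()

  opposite-sym : ∀ {A B : Set} (x y : A ⊎ B) → Opposite x y → Opposite y x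
  opposite-sym (inj₁ _) (inj₂ _) _ = _
  opposite-sym (inj₂ _) (inj₁ _) _ = _

  opposite-irrefl : ∀ {A B : Set} (x : A ⊎ B) → ¬ Opposite x x
  opposite-irrefl (inj₁ _) ()
  opposite-irrefl (inj₂ _) ()

------------------------------------------------------------------------
-- Subdivisions

-- The first h vertices of the m-subdivision are those of H; then each
-- edge contributes a block of m vertices.
branch : (H : Graph h) (m : ℕ) → Fin h → Fin (h + #edges H * m)
branch H m v = v ↑ˡ (#edges H * m)

internal : (H : Graph h) (m : ℕ) → Fin (#edges H) → Fin m → Fin (h + #edges H * m)
internal {h} H m e i = h ↑ʳ combine e i

-- The path of length m + 1 that replaces the edge e.
path : (H : Graph h) (m : ℕ) → Fin (#edges H) → Vec (Fin (h + #edges H * m)) (suc (suc m))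
path H m e = branch H m u ∷ (tabulate (internal H m e) ∷ʳ branch H m v)
  where
  u = proj₁ (List.lookup (edges H) e)
  v = proj₂ (List.lookup (edges H) e)

Step : (H : Graph h) (m : ℕ) → Rel (Fin (h + #edges H * m)) 0ℓ
Step H m x y = ∃₂ λ e (j : Fin (suc m)) →
  x ≡ lookup (path H m e) (inject₁ j) × y ≡ lookup (path H m e) (suc j)

private
  consecutive-≢ : ∀ {A : Set} {m} (u v : A) (xs : Vec A m) → u ≢ v →
    All (u ≢_) xs → All (_≢ v) xs → Unique xs → (j : Fin (suc m)) →
    lookup (u ∷ (xs ∷ʳ v)) (inject₁ j) ≢ lookup (u ∷ (xs ∷ʳ v)) (suc j)
  consecutive-≢ u v []       u≢v _           _           _          Fin.zero = u≢v
  consecutive-≢ u v (x ∷ xs) _   (u≢x ∷ _)   _           _          Fin.zero = u≢x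
  consecutive-≢ u v (x ∷ xs) _   _           (x≢v ∷ xs≢v) (x∉ ∷ uniq) (suc j) =
    consecutive-≢ x v xs x≢v x∉ xs≢v uniq j

  branch≢internal : (H : Graph h) (m : ℕ) → ∀ v e i → branch H m v ≢ internal H m e i
  branch≢internal {h} H m v e i eq
    with trans (sym (Fin.splitAt-↑ˡ h v _)) (trans (cong (splitAt h) eq) (Fin.splitAt-↑ʳ h _ _))
  ... | ()

  step-≢ : (H : Graph h) (m : ℕ) → ∀ e (j : Fin (suc m)) →
    lookup (path H m e) (inject₁ j) ≢ lookup (path H m e) (suc j)
  step-≢ {h} H m e = consecutive-≢ _ _ (tabulate (internal H m e))
    (λ eq → Fin.<⇒≢ u<v (Fin.↑ˡ-injective _ _ _ eq))
    (All.tabulate⁺ λ i → branch≢internal H m _ e i)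
    (All.tabulate⁺ λ i → branch≢internal H m _ e i ∘ sym)
    (Unique.tabulate⁺ λ eq → Fin.combine-injectiveʳ e _ e _ (Fin.↑ʳ-injective h _ _ eq))
    where
    u<v : proj₁ (List.lookup (edges H) e) Fin.< proj₂ (List.lookup (edges H) e)
    u<v = proj₁ (proj₂ (∈.∈-filter⁻ (isEdge? H)
      {xs = cartesianProduct (allFin h) (allFin h)} (∈.∈-lookup e)))

subdivision : (m : ℕ) (H : Graph h) → Graph (h + #edges H * m)
subdivision m H = record
  { Adj        = λ x y → Step H m x y ⊎ Step H m y x
  ; adj?       = λ x y → step? x y ⊎-dec step? y x
  ; adj-sym    = swap
  ; adj-irrefl = λ { refl (inj₁ (e , j , p , q)) → step-≢ H m e j (trans (sym p) q)
                   ; refl (inj₂ (e , j , p , q)) → step-≢ H m e j (trans (sym p) q) }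
  }
  where
  step? : Decidable (Step H m)
  step? x y = Fin.any? λ e → Fin.any? λ j → (x Fin.≟ _) ×-dec (y Fin.≟ _)

------------------------------------------------------------------------
-- Asymptotics

-- f(n) = O(n^(p/q)) as n → ∞, with the defining inequality raised to the
-- q-th power: f(n) ≤ C · n^(p/q) is equivalent to f(n)^q ≤ C^q · n^p. If p < 0,
-- the power of n moves to the left-hand side. As C is arbitrary, the
-- choice of p and q representing the exponent does not matter.
PowerBound : (ℕ → ℕ) → ℤ → ℕ → Set
PowerBound f (+ p)    q = ∃₂ λ C N → ∀ n → n ≥ N → f n ^ q ≤ C * n ^ p
PowerBound f -[1+ p ] q = ∃₂ λ C N → ∀ n → n ≥ N → f n ^ q * n ^ suc p ≤ C

infix 4 _=O[n^_]

_=O[n^_] : (ℕ → ℕ) → ℚᵘ → Set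
f =O[n^ α ] = PowerBound f (↥ α) (↧ₙ α)

-- A densest subgraph of a counterexample is almost regular: it has m vertices and degrees
-- between d and K d, where d ^ (s k + 1) is a large multiple of m ^ s. Call two vertices blocked
-- (for a given length) if boundedly many vertices meet all paths of that length between them, and a
-- path good if the ends of each of its subpaths are blocked. By induction on the length,
-- boundedly many good paths join two given vertices.
--
-- If most walks of length k are good paths, choose a₁ , … , aₛ one after another by averaging, so
-- that many more than d ^ (k - 1) roots b are joined to all aᵢ by stars of good paths. A vertex meets
-- only O(d ^ (k - 1)) of these stars, so t of them are disjoint.
--
-- Otherwise consider the least length ℓ ≤ k for which a positive proportion of the walks
-- x , z , … , y have unblocked ends. For a suitable fixed z, density yields many x and many y such that
-- all pairs (x , y) are unblocked, that is, joined by paths of length ℓ avoiding any bounded set;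
-- alternating between the two sides gives paths of length q ℓ. To add r = k mod ℓ steps, let b range
-- over the vertices at distance r from y on the paths from x to y: since an unblocked pair has
-- many such b, counting the triples (x , b , y) shows that some b reaches the vertices y by
-- paths of length r avoiding any bounded set.
module Submission where

open import Defs
open import Data.Bool using (Bool; true; false)
open import Data.Empty using (⊥-elim)
open import Data.Fin using (Fin; zero; suc; toℕ; splitAt; combine; remQuot; inject₁; _↑ˡ_; _↑ʳ_)
import Data.Fin.Properties as Fin
import Data.Integer as ℤ
import Data.Integer.Properties as ℤ
open import Data.List as List using (List; []; _∷_; _++_; _∷ʳ_; length; map; filter; concatMap; take; drop; allFin; upTo; cartesianProduct; reverse)
open import Data.List.Properties using (length-++; length-map; length-filter; length-reverse; unfold-reverse; take++drop≡id; filter-notAll; length-take; length-drop; length-tabulate; length-upTo)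
open import Data.List.Extrema.Nat using (argmax-sel)
open import Data.List.Membership.Propositional using (_∈_; _∉_; find; lose)
open import Data.List.Membership.Propositional.Properties using (∈-++⁺ˡ; ∈-++⁺ʳ; ∈-++⁻; ∈-map⁺; ∈-map⁻; ∈-filter⁺; ∈-filter⁻; ∈-concat⁺′; ∈-concat⁻′; ∈-lookup; ∈-upTo⁺; ∈-upTo⁻; ∈-∃++)
import Data.List.Membership.DecPropositional as DecMembership
open import Data.List.Relation.Unary.All as All using (All; []; _∷_)
import Data.List.Relation.Unary.All.Properties as All
open import Data.List.Relation.Unary.Any as Any using (Any; here; there)
import Data.List.Relation.Unary.Any.Properties as Any
open import Data.List.Relation.Unary.AllPairs using ([]; _∷_)
open import Data.List.Relation.Unary.Unique.Propositional using (Unique)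
import Data.List.Relation.Unary.Unique.Propositional.Properties as Unique
import Data.List.Relation.Unary.Unique.DecPropositional as DecUnique
open import Data.Nat hiding (_/_; _%_)
open import Data.Nat.Properties
open import Data.Nat.DivMod using (_/_; _%_; m≡m%n+[m/n]*n; m%n<n; m/n*n≤m)
open import Data.Nat.Tactic.RingSolver using (solve-∀)
open import Data.Product using (Σ; ∃; ∃₂; _×_; _,_; proj₁; proj₂; uncurry)
open import Data.Rational.Unnormalised as ℚ using (ℚᵘ; 0ℚᵘ; 1ℚᵘ)
open import Data.Sum using (_⊎_; inj₁; inj₂; [_,_]′)
open import Data.Sum.Properties using (inj₁-injective; inj₂-injective)
open import Data.Unit using (⊤; tt)
open import Data.Vec as Vec using (Vec; []; _∷_)
import Data.Vec.Properties as Vec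
open import Function using (_∘_; id; case_of_)
open import Function.Definitions using (Injective)
open import Relation.Binary.PropositionalEquality
open import Relation.Nullary using (¬_; Dec; yes; no; contradiction)
open import Relation.Nullary.Decidable using (map′; ¬?; _×-dec_; _⊎-dec_; _→-dec_; decidable-stable)
open import Relation.Unary using (Decidable)

-- Finite sums and counting

-- The exponent comes from the case of good paths. Each of the `s` averagings keeps a fraction of
-- order `d ^ k / m` of about `m` roots, so roughly `m * (d ^ k / m) ^ s` of them survive, and this
-- number must exceed `d ^ (k - 1)`. The density of `W` makes it a large multiple of `m / d`, and
-- `m` is at least of order `d ^ k` because boundedly many good paths share both ends. Bounded
-- multiplicity is thus what turns counts of walks into counts of vertices, here and at the centre
-- `z` of the other case, where minimality of the length keeps most tails of walks good. The
-- multiplicity bound for one length involves the sizes of the blocking sets for all lengths up to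
-- it, while a blocking set must be large compared with the multiplicity for shorter lengths. The
-- constants are therefore defined by recursion on the length, and none of them depends on `n`, `m`
-- or `d`. Indices count interior vertices: a walk of index `i` has length `i + 1`, and `κ` stands
-- for `k - 1`.

private
  variable
    Item Item′ : Set

∑ : List Item → (Item → ℕ) → ℕ
∑ []       f = 0
∑ (x ∷ xs) f = f x + ∑ xs f

∑-mono : ∀ (xs : List Item) {f g : Item → ℕ} → (∀ {x} → x ∈ xs → f x ≤ g x) → ∑ xs f ≤ ∑ xs g
∑-mono []       f≤g = z≤n
∑-mono (x ∷ xs) f≤g = +-mono-≤ (f≤g (here refl)) (∑-mono xs (f≤g ∘ there))

∑-cong : ∀ (xs : List Item) {f g : Item → ℕ} → (∀ {x} → x ∈ xs → f x ≡ g x) → ∑ xs f ≡ ∑ xs g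
∑-cong []       f≡g = refl
∑-cong (x ∷ xs) f≡g = cong₂ _+_ (f≡g (here refl)) (∑-cong xs (f≡g ∘ there))

∑-++ : ∀ (xs ys : List Item) (f : Item → ℕ) → ∑ (xs ++ ys) f ≡ ∑ xs f + ∑ ys f
∑-++ []       ys f = refl
∑-++ (x ∷ xs) ys f = trans (cong (f x +_) (∑-++ xs ys f)) (sym (+-assoc (f x) _ _))

∑-map : ∀ (h : Item → Item′) (xs : List Item) (f : Item′ → ℕ) → ∑ (map h xs) f ≡ ∑ xs (f ∘ h)
∑-map h []       f = refl
∑-map h (x ∷ xs) f = cong (f (h x) +_) (∑-map h xs f)

∑-concatMap : ∀ (h : Item → List Item′) (xs : List Item) (f : Item′ → ℕ) →
              ∑ (concatMap h xs) f ≡ ∑ xs λ x → ∑ (h x) f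
∑-concatMap h []       f = refl
∑-concatMap h (x ∷ xs) f = trans (∑-++ (h x) _ f) (cong (_ +_) (∑-concatMap h xs f))

∑-+ : ∀ (xs : List Item) (f g : Item → ℕ) → ∑ xs (λ x → f x + g x) ≡ ∑ xs f + ∑ xs g
∑-+ []       f g = refl
∑-+ (x ∷ xs) f g = trans (cong (f x + g x +_) (∑-+ xs f g)) (shuffle (f x) (g x) _ _)
  where
  shuffle : ∀ a b c d → a + b + (c + d) ≡ a + c + (b + d)
  shuffle = solve-∀

∑-*ˡ : ∀ (xs : List Item) c (f : Item → ℕ) → ∑ xs (λ x → c * f x) ≡ c * ∑ xs f
∑-*ˡ []       c f = sym (*-zeroʳ c)
∑-*ˡ (x ∷ xs) c f = trans (cong (c * f x +_) (∑-*ˡ xs c f)) (sym (*-distribˡ-+ c (f x) _))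

∑-const : ∀ (xs : List Item) c → ∑ xs (λ _ → c) ≡ length xs * c
∑-const []       c = refl
∑-const (x ∷ xs) c = cong (c +_) (∑-const xs c)

∑-≤-const : ∀ (xs : List Item) {f : Item → ℕ} c → (∀ {x} → x ∈ xs → f x ≤ c) → ∑ xs f ≤ length xs * c
∑-≤-const xs c f≤c = ≤-trans (∑-mono xs f≤c) (≤-reflexive (∑-const xs c))

∑-≥-const : ∀ (xs : List Item) {f : Item → ℕ} c → (∀ {x} → x ∈ xs → c ≤ f x) → length xs * c ≤ ∑ xs f
∑-≥-const xs c c≤f = ≤-trans (≤-reflexive (sym (∑-const xs c))) (∑-mono xs c≤f)

∑-zero : ∀ (xs : List Item) {f : Item → ℕ} → (∀ {x} → x ∈ xs → f x ≡ 0) → ∑ xs f ≡ 0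
∑-zero xs f≡0 = trans (∑-cong xs f≡0) (trans (∑-const xs 0) (*-zeroʳ (length xs)))

∑-swap : ∀ (xs : List Item) (ys : List Item′) (f : Item → Item′ → ℕ) →
         ∑ xs (λ x → ∑ ys (f x)) ≡ ∑ ys (λ y → ∑ xs (λ x → f x y))
∑-swap []       ys f = sym (∑-zero ys λ _ → refl)
∑-swap (x ∷ xs) ys f = trans (cong (∑ ys (f x) +_) (∑-swap xs ys f)) (sym (∑-+ ys (f x) _))

∑-member : ∀ {xs : List Item} {x} (f : Item → ℕ) → x ∈ xs → f x ≤ ∑ xs f
∑-member f (here refl) = m≤m+n _ _
∑-member f (there x∈)  = ≤-trans (∑-member f x∈) (m≤n+m _ _)

length-concatMap : ∀ (h : Item → List Item′) (xs : List Item) → length (concatMap h xs) ≡ ∑ xs λ x → length (h x)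
length-concatMap h []       = refl
length-concatMap h (x ∷ xs) = trans (length-++ (h x)) (cong (length (h x) +_) (length-concatMap h xs))

∑-average : ∀ (xs : List Item) (f : Item → ℕ) c → 0 < length xs → length xs * c ≤ ∑ xs f →
            ∃ λ x → x ∈ xs × c ≤ f x
∑-average (x ∷ xs)     f c _ le with c ≤? f x
... | yes c≤   = x , here refl , c≤
∑-average (x ∷ [])     f c _ le | no c≰ =
  contradiction (≤-trans (m≤m+n c 0) (≤-trans le (≤-reflexive (+-identityʳ (f x))))) c≰
∑-average (x ∷ y ∷ xs) f c _ le | no c≰
  with y′ , y′∈ , c≤ ← ∑-average (y ∷ xs) f c z<s
         (+-cancelˡ-≤ c _ _ (≤-trans le (+-monoˡ-≤ _ (<⇒≤ (≰⇒> c≰)))))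
  = y′ , there y′∈ , c≤

𝟙 : {P : Set} → Dec P → ℕ
𝟙 (yes _) = 1
𝟙 (no _)  = 0

𝟙≤1 : {P : Set} (P? : Dec P) → 𝟙 P? ≤ 1
𝟙≤1 (yes _) = ≤-refl
𝟙≤1 (no _)  = z≤n

𝟙-yes : {P : Set} (P? : Dec P) → P → 𝟙 P? ≡ 1
𝟙-yes (yes _) p = refl
𝟙-yes (no ¬p) p = contradiction p ¬p

𝟙-no : {P : Set} (P? : Dec P) → ¬ P → 𝟙 P? ≡ 0
𝟙-no (yes p) ¬p = contradiction p ¬p
𝟙-no (no _)  ¬p = refl

𝟙-≤ : {P : Set} {k : ℕ} (P? : Dec P) → (P → 1 ≤ k) → 𝟙 P? ≤ k
𝟙-≤ (yes p) 1≤ = 1≤ p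
𝟙-≤ (no _)  _  = z≤n

𝟙-mono : {P Q : Set} (P? : Dec P) (Q? : Dec Q) → (P → Q) → 𝟙 P? ≤ 𝟙 Q?
𝟙-mono P? Q? f = 𝟙-≤ P? λ p → ≤-reflexive (sym (𝟙-yes Q? (f p)))

𝟙-cong : {P Q : Set} (P? : Dec P) (Q? : Dec Q) → (P → Q) → (Q → P) → 𝟙 P? ≡ 𝟙 Q?
𝟙-cong P? Q? f g = ≤-antisym (𝟙-mono P? Q? f) (𝟙-mono Q? P? g)

𝟙-⊎ : {P Q R : Set} (P? : Dec P) (Q? : Dec Q) (R? : Dec R) → (P → Q ⊎ R) → 𝟙 P? ≤ 𝟙 Q? + 𝟙 R?
𝟙-⊎ P? Q? R? f = 𝟙-≤ P? λ p → case f p of λ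
  { (inj₁ q) → ≤-trans (≤-reflexive (sym (𝟙-yes Q? q))) (m≤m+n _ _)
  ; (inj₂ r) → ≤-trans (≤-reflexive (sym (𝟙-yes R? r))) (m≤n+m _ _) }

𝟙-¬ : {P : Set} (P? : Dec P) → 𝟙 P? + 𝟙 (¬? P?) ≡ 1
𝟙-¬ (yes _) = refl
𝟙-¬ (no _)  = refl

module _ {P : Item → Set} (P? : Decidable P) where

  count : List Item → ℕ
  count xs = ∑ xs λ x → 𝟙 (P? x)

  count-filter : ∀ xs → length (filter P? xs) ≡ count xs
  count-filter []       = refl
  count-filter (x ∷ xs) with P? x
  ... | yes _ = cong suc (count-filter xs)
  ... | no _  = count-filter xs

  count≤length : ∀ xs → count xs ≤ length xs
  count≤length xs = ≤-trans (∑-≤-const xs 1 λ _ → 𝟙≤1 (P? _)) (≤-reflexive (*-identityʳ _))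

  ∑-filter : ∀ xs (f : Item → ℕ) → ∑ (filter P? xs) f ≡ ∑ xs λ x → 𝟙 (P? x) * f x
  ∑-filter []       f = refl
  ∑-filter (x ∷ xs) f with P? x
  ... | yes _ = cong₂ _+_ (sym (+-identityʳ (f x))) (∑-filter xs f)
  ... | no _  = ∑-filter xs f

  ∑-filter-≤ : ∀ xs (f : Item → ℕ) → ∑ (filter P? xs) f ≤ ∑ xs f
  ∑-filter-≤ []       f = z≤n
  ∑-filter-≤ (x ∷ xs) f with P? x
  ... | yes _ = +-monoʳ-≤ (f x) (∑-filter-≤ xs f)
  ... | no _  = ≤-trans (∑-filter-≤ xs f) (m≤n+m _ _)

  count-none : ∀ xs → (∀ {x} → x ∈ xs → ¬ P x) → count xs ≡ 0
  count-none xs none = ∑-zero xs λ x∈ → 𝟙-no (P? _) (none x∈)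

  count-complement : ∀ xs → count xs + ∑ xs (λ x → 𝟙 (¬? (P? x))) ≡ length xs
  count-complement xs = trans (sym (∑-+ xs _ _))
    (trans (∑-cong xs λ _ → 𝟙-¬ (P? _)) (trans (∑-const xs 1) (*-identityʳ _)))

𝟙-any : {P : Item → Set} (P? : Decidable P) (xs : List Item) → 𝟙 (Any.any? P? xs) ≤ count P? xs
𝟙-any P? xs = 𝟙-≤ (Any.any? P? xs) λ any → let x , x∈ , p = find any in
  ≤-trans (≤-reflexive (sym (𝟙-yes (P? x) p))) (∑-member (λ x → 𝟙 (P? x)) x∈)

-- Entries below the threshold contribute at most `length xs * τ` altogether and the others at most
-- `a * u` each, so a large sum forces many entries above it. The factor `a` keeps fractional
-- thresholds within the natural numbers.
popular : ∀ (xs : List Item) (f : Item → ℕ) a u τ → (∀ {x} → x ∈ xs → f x ≤ u) →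
          a * ∑ xs f ≤ length (filter (λ x → τ ≤? a * f x) xs) * (a * u) + length xs * τ
popular xs f a u τ f≤u = begin
  a * ∑ xs f
    ≡⟨ ∑-*ˡ xs a f ⟨
  ∑ xs (λ x → a * f x)
    ≤⟨ ∑-mono xs split ⟩
  ∑ xs (λ x → a * u * 𝟙 (τ ≤? a * f x) + τ)
    ≡⟨ ∑-+ xs _ _ ⟩
  ∑ xs (λ x → a * u * 𝟙 (τ ≤? a * f x)) + ∑ xs (λ _ → τ)
    ≡⟨ cong₂ _+_ (trans (∑-*ˡ xs (a * u) _) (*-comm (a * u) _)) (∑-const xs τ) ⟩
  count (λ x → τ ≤? a * f x) xs * (a * u) + length xs * τ
    ≡⟨ cong (λ l → l * (a * u) + length xs * τ) (count-filter (λ x → τ ≤? a * f x) xs) ⟨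
  length (filter (λ x → τ ≤? a * f x) xs) * (a * u) + length xs * τ ∎
  where
  open ≤-Reasoning
  split : ∀ {x} → x ∈ xs → a * f x ≤ a * u * 𝟙 (τ ≤? a * f x) + τ
  split {x} x∈ with τ ≤? a * f x
  ... | yes _ = ≤-trans (*-monoʳ-≤ a (f≤u x∈)) (≤-trans (≤-reflexive (sym (*-identityʳ _))) (m≤m+n _ _))
  ... | no τ≰ = ≤-trans (<⇒≤ (≰⇒> τ≰)) (m≤n+m _ _)

-- Count related pairs from the side of `ys`, then average over `xs`. Both the choice of a common
-- leaf and the choice of a row of a rectangle rest on this.
pick : {R : Item → Item′ → Set} (R? : ∀ x y → Dec (R x y)) (xs : List Item) (ys : List Item′) (c g : ℕ) →
       0 < length xs → (∀ {y} → y ∈ ys → g ≤ c * count (λ x → R? x y) xs) →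
       ∃ λ x → x ∈ xs × length ys * g ≤ c * length xs * count (R? x) ys
pick R? xs ys c g pos many = ∑-average xs (λ x → c * length xs * count (R? x) ys) (length ys * g) pos (begin
  length xs * (length ys * g)
    ≤⟨ *-monoʳ-≤ (length xs) (∑-≥-const ys g many) ⟩
  length xs * ∑ ys (λ y → c * count (λ x → R? x y) xs)
    ≡⟨ cong (length xs *_) (trans (∑-*ˡ ys c _) (cong (c *_) (sym (∑-swap xs ys _)))) ⟩
  length xs * (c * ∑ xs (λ x → count (R? x) ys))
    ≡⟨ trans (shuffle (length xs) c _) (sym (∑-*ˡ xs (c * length xs) _)) ⟩
  ∑ xs (λ x → c * length xs * count (R? x) ys) ∎)
  where
  open ≤-Reasoning
  shuffle : ∀ l c s → l * (c * s) ≡ c * l * s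
  shuffle = solve-∀

-- Walks

module _ {n : ℕ} where

  abstract
    infix 4 _∈?_
    _∈?_ : ∀ (v : Fin n) vs → Dec (v ∈ vs)
    _∈?_ = DecMembership._∈?_ Fin._≟_

    unique? : ∀ (vs : List (Fin n)) → Dec (Unique vs)
    unique? = DecUnique.unique? Fin._≟_

  anyVec? : ∀ N {P : Vec (Fin n) N → Set} → Decidable P → Dec (∃ P)
  anyVec? zero    P? = map′ ([] ,_) (λ { ([] , p) → p }) (P? [])
  anyVec? (suc N) P? = map′ (λ (v , vs , p) → v ∷ vs , p) (λ { (v ∷ vs , p) → v , vs , p })
    (Fin.any? λ v → anyVec? N λ vs → P? (v ∷ vs))

  -- Blocking sets are vectors of exactly `N` vertices, so that finite search decides their
  -- existence; repeating `x` fills up a shorter list.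
  pad : ∀ N → Fin n → List (Fin n) → Vec (Fin n) N
  pad zero    x F       = []
  pad (suc N) x []      = x ∷ pad N x []
  pad (suc N) x (v ∷ F) = v ∷ pad N x F

  pad-⊇ : ∀ {N x v F} → length F ≤ N → v ∈ F → v ∈ Vec.toList (pad N x F)
  pad-⊇ {suc N} (s≤s F≤) (here refl) = here refl
  pad-⊇ {suc N} (s≤s F≤) (there v∈)  = there (pad-⊇ F≤ v∈)

  count-≡≤1 : ∀ {xs : List (Fin n)} → Unique xs → ∀ v → count (λ x → x Fin.≟ v) xs ≤ 1
  count-≡≤1 {[]}     _          v = z≤n
  count-≡≤1 {x ∷ xs} (x∉ ∷ xs!) v with x Fin.≟ v
  ... | no _     = count-≡≤1 xs! v
  ... | yes refl = ≤-reflexive (cong suc (count-none (λ y → y Fin.≟ x) xs λ y∈ y≡x →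
                     All.lookup x∉ y∈ (sym y≡x)))

-- A walk x , p₁ , … , pᵢ , y is recorded, relative to its start x, as the
-- pair of the list of its i interior vertices and its end y.
module Walks {n : ℕ} (G : Graph n) (W : List (Fin n)) (W! : Unique W) where

  V : Set
  V = Fin n

  nbr : V → List V
  nbr x = filter (adj? G x) W

  nbr! : ∀ x → Unique (nbr x)
  nbr! x = Unique.filter⁺ (adj? G x) W!

  ∈-nbr⁻ : ∀ {x y} → y ∈ nbr x → y ∈ W × Adj G x y
  ∈-nbr⁻ {x} = ∈-filter⁻ (adj? G x)

  ∈-nbr-sym : ∀ {x y} → x ∈ W → y ∈ nbr x → x ∈ nbr y
  ∈-nbr-sym x∈ y∈ = ∈-filter⁺ (adj? G _) x∈ (adj-sym G (proj₂ (∈-nbr⁻ y∈)))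

  data Walk : V → List V → V → Set where
    edge : ∀ {x y} → y ∈ nbr x → Walk x [] y
    _∷_  : ∀ {x z ps y} → z ∈ nbr x → Walk z ps y → Walk x (z ∷ ps) y

  End : Set
  End = List V × V

  cons : V → End → End
  cons z (ps , y) = z ∷ ps , y

  verts : End → List V
  verts (ps , y) = y ∷ ps

  walks : ℕ → V → List End
  walks zero    x = map ([] ,_) (nbr x)
  walks (suc i) x = concatMap (λ z → map (cons z) (walks i z)) (nbr x)

  ∈-walks⁻ : ∀ i {x w} → w ∈ walks i x → Walk x (proj₁ w) (proj₂ w) × length (proj₁ w) ≡ i
  ∈-walks⁻ zero    w∈ with y , y∈ , refl ← ∈-map⁻ ([] ,_) w∈ = edge y∈ , refl
  ∈-walks⁻ (suc i) {x} w∈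
    with ws , w∈ws , ws∈ ← ∈-concat⁻′ (map (λ z → map (cons z) (walks i z)) (nbr x)) w∈
    with z , z∈ , refl ← ∈-map⁻ (λ z → map (cons z) (walks i z)) ws∈
    with w′ , w′∈ , refl ← ∈-map⁻ (cons z) w∈ws
    with walk , len ← ∈-walks⁻ i w′∈ = z∈ ∷ walk , cong suc len

  ∈-walks⁺ : ∀ {x ps y} → Walk x ps y → (ps , y) ∈ walks (length ps) x
  ∈-walks⁺ (edge y∈)   = ∈-map⁺ ([] ,_) y∈
  ∈-walks⁺ {ps = _ ∷ ps} (z∈ ∷ walk) = ∈-concat⁺′ (∈-map⁺ (cons _) (∈-walks⁺ walk))
    (∈-map⁺ (λ z → map (cons z) (walks (length ps) z)) z∈)

  Walk-end : ∀ {x ps y} → Walk x ps y → y ∈ W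
  Walk-end (edge y∈)  = proj₁ (∈-nbr⁻ y∈)
  Walk-end (_ ∷ walk) = Walk-end walk

  Walk-split : ∀ ps {x v qs y} → Walk x (ps ++ v ∷ qs) y → Walk x ps v × Walk v qs y
  Walk-split []       (v∈ ∷ walk) = edge v∈ , walk
  Walk-split (_ ∷ ps) (p∈ ∷ walk) with walk₁ , walk₂ ← Walk-split ps walk = p∈ ∷ walk₁ , walk₂

  Walk-++ : ∀ {x ps v qs y} → Walk x ps v → Walk v qs y → Walk x (ps ++ v ∷ qs) y
  Walk-++ (edge v∈)    walk₂ = v∈ ∷ walk₂
  Walk-++ (p∈ ∷ walk₁) walk₂ = p∈ ∷ Walk-++ walk₁ walk₂

  Walk-reverse : ∀ {x ps y} → x ∈ W → Walk x ps y → Walk y (reverse ps) x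
  Walk-reverse x∈ (edge y∈) = edge (∈-nbr-sym x∈ y∈)
  Walk-reverse {ps = z ∷ ps} x∈ (z∈ ∷ walk) = subst (λ qs → Walk _ qs _) (sym (unfold-reverse z ps))
    (Walk-++ (Walk-reverse (proj₁ (∈-nbr⁻ z∈)) walk) (edge (∈-nbr-sym x∈ z∈)))

  ∑-walks-zero : ∀ x (φ : End → ℕ) → ∑ (walks 0 x) φ ≡ ∑ (nbr x) λ y → φ ([] , y)
  ∑-walks-zero x φ = ∑-map ([] ,_) (nbr x) φ

  ∑-walks-suc : ∀ i x (φ : End → ℕ) →
    ∑ (walks (suc i) x) φ ≡ ∑ (nbr x) λ z → ∑ (walks i z) λ w → φ (cons z w)
  ∑-walks-suc i x φ = trans (∑-concatMap (λ z → map (cons z) (walks i z)) (nbr x) φ)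
    (∑-cong (nbr x) λ {z} _ → ∑-map (cons z) (walks i z) φ)

  snoc : End → V → End
  snoc (ps , v) y = ps ∷ʳ v , y

  -- Walks are generated from the start, but lightness with respect to a start grows at the far end;
  -- `nonLight-suc` needs this form of the recursion.
  ∑-walks-snoc : ∀ i x (φ : End → ℕ) →
    ∑ (walks (suc i) x) φ ≡ ∑ (walks i x) λ w → ∑ (nbr (proj₂ w)) λ y → φ (snoc w y)
  ∑-walks-snoc zero    x φ = trans (∑-walks-suc 0 x φ) (trans
    (∑-cong (nbr x) λ {z} _ → ∑-walks-zero z _) (sym (∑-walks-zero x _)))
  ∑-walks-snoc (suc i) x φ = trans (∑-walks-suc (suc i) x φ) (trans
    (∑-cong (nbr x) λ {z} _ → ∑-walks-snoc i z _) (sym (∑-walks-suc i x _)))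

  ∑-nbr-swap : ∀ (g : V → V → ℕ) →
    ∑ W (λ x → ∑ (nbr x) (g x)) ≡ ∑ W (λ z → ∑ (nbr z) λ x → g x z)
  ∑-nbr-swap g = begin
    ∑ W (λ x → ∑ (nbr x) (g x))
      ≡⟨ ∑-cong W (λ {x} _ → ∑-filter (adj? G x) W (g x)) ⟩
    ∑ W (λ x → ∑ W λ z → 𝟙 (adj? G x z) * g x z)
      ≡⟨ ∑-swap W W _ ⟩
    ∑ W (λ z → ∑ W λ x → 𝟙 (adj? G x z) * g x z)
      ≡⟨ ∑-cong W (λ {z} _ → ∑-cong W λ {x} _ →
           cong (_* g x z) (𝟙-cong (adj? G x z) (adj? G z x) (adj-sym G) (adj-sym G))) ⟩
    ∑ W (λ z → ∑ W λ x → 𝟙 (adj? G z x) * g x z)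
      ≡⟨ ∑-cong W (λ {z} _ → ∑-filter (adj? G z) W _) ⟨
    ∑ W (λ z → ∑ (nbr z) λ x → g x z) ∎
    where open ≡-Reasoning


  module Degrees (d D : ℕ) (deg≥ : ∀ {x} → x ∈ W → d ≤ length (nbr x))
                 (deg≤ : ∀ {x} → x ∈ W → length (nbr x) ≤ D) where

    length-walks-suc : ∀ i x → length (walks (suc i) x) ≡ ∑ (nbr x) λ z → length (walks i z)
    length-walks-suc i x = begin
      length (walks (suc i) x)                       ≡⟨ *-identityʳ _ ⟨
      length (walks (suc i) x) * 1                   ≡⟨ ∑-const (walks (suc i) x) 1 ⟨
      ∑ (walks (suc i) x) (λ _ → 1)                  ≡⟨ ∑-walks-suc i x _ ⟩
      ∑ (nbr x) (λ z → ∑ (walks i z) (λ _ → 1))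
        ≡⟨ ∑-cong (nbr x) (λ {z} _ → trans (∑-const (walks i z) 1) (*-identityʳ _)) ⟩
      ∑ (nbr x) (λ z → length (walks i z))           ∎
      where open ≡-Reasoning

    length-walks≤ : ∀ i {x} → x ∈ W → length (walks i x) ≤ D ^ suc i
    length-walks≤ zero    {x} x∈ = begin
      length (walks 0 x) ≡⟨ length-map ([] ,_) (nbr x) ⟩
      length (nbr x)     ≤⟨ deg≤ x∈ ⟩
      D                  ≡⟨ *-identityʳ D ⟨
      D ^ 1              ∎
      where open ≤-Reasoning
    length-walks≤ (suc i) {x} x∈ = begin
      length (walks (suc i) x)             ≡⟨ length-walks-suc i x ⟩
      ∑ (nbr x) (λ z → length (walks i z)) ≤⟨ ∑-≤-const (nbr x) _ (λ z∈ → length-walks≤ i (proj₁ (∈-nbr⁻ z∈))) ⟩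
      length (nbr x) * D ^ suc i           ≤⟨ *-monoˡ-≤ _ (deg≤ x∈) ⟩
      D ^ suc (suc i)                      ∎
      where open ≤-Reasoning

    length-walks≥ : ∀ i {x} → x ∈ W → d ^ suc i ≤ length (walks i x)
    length-walks≥ zero    {x} x∈ = begin
      d ^ 1              ≡⟨ *-identityʳ d ⟩
      d                  ≤⟨ deg≥ x∈ ⟩
      length (nbr x)     ≡⟨ length-map ([] ,_) (nbr x) ⟨
      length (walks 0 x) ∎
      where open ≤-Reasoning
    length-walks≥ (suc i) {x} x∈ = begin
      d ^ suc (suc i)                      ≤⟨ *-monoˡ-≤ _ (deg≥ x∈) ⟩
      length (nbr x) * d ^ suc i           ≤⟨ ∑-≥-const (nbr x) _ (λ z∈ → length-walks≥ i (proj₁ (∈-nbr⁻ z∈))) ⟩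
      ∑ (nbr x) (λ z → length (walks i z)) ≡⟨ length-walks-suc i x ⟨
      length (walks (suc i) x)             ∎
      where open ≤-Reasoning

    -- Any of the `suc i` vertices after the start may be `v`, and prescribing one of them costs a
    -- factor `D` among the walks.
    hit : ∀ i {x} v → x ∈ W → count (λ w → v ∈? verts w) (walks i x) ≤ suc i * D ^ i
    hit zero    {x} v x∈ = begin
      count (λ w → v ∈? verts w) (walks 0 x)     ≡⟨ ∑-walks-zero x _ ⟩
      ∑ (nbr x) (λ y → 𝟙 (v ∈? (y ∷ [])))         ≤⟨ ∑-mono (nbr x) (λ {y} _ →
                                                     𝟙-mono (v ∈? (y ∷ [])) (y Fin.≟ v) λ { (here eq) → sym eq }) ⟩
      count (λ y → y Fin.≟ v) (nbr x)            ≤⟨ count-≡≤1 (nbr! x) v ⟩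
      1                                          ∎
      where open ≤-Reasoning
    hit (suc i) {x} v x∈ = begin
      count (λ w → v ∈? verts w) (walks (suc i) x)
        ≡⟨ ∑-walks-suc i x _ ⟩
      ∑ (nbr x) (λ z → ∑ (walks i z) λ w → 𝟙 (v ∈? verts (cons z w)))
        ≤⟨ ∑-mono (nbr x) (λ {z} z∈ → bound z (proj₁ (∈-nbr⁻ z∈))) ⟩
      ∑ (nbr x) (λ z → D ^ suc i * 𝟙 (z Fin.≟ v) + suc i * D ^ i)
        ≡⟨ trans (∑-+ (nbr x) _ _) (cong₂ _+_ (∑-*ˡ (nbr x) (D ^ suc i) _) (∑-const (nbr x) _)) ⟩
      D ^ suc i * count (λ z → z Fin.≟ v) (nbr x) + length (nbr x) * (suc i * D ^ i)
        ≤⟨ +-mono-≤ (*-monoʳ-≤ (D ^ suc i) (count-≡≤1 (nbr! x) v)) (*-monoˡ-≤ _ (deg≤ x∈)) ⟩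
      D ^ suc i * 1 + D * (suc i * D ^ i)
        ≡⟨ rearrange D (D ^ i) i ⟩
      suc (suc i) * D ^ suc i ∎
      where
      open ≤-Reasoning
      rearrange : ∀ D p i → D * p * 1 + D * (suc i * p) ≡ suc (suc i) * (D * p)
      rearrange = solve-∀
      split : ∀ {z y} ps → v ∈ (y ∷ z ∷ ps) → z ≡ v ⊎ v ∈ (y ∷ ps)
      split ps (here eq)          = inj₂ (here eq)
      split ps (there (here eq))  = inj₁ (sym eq)
      split ps (there (there v∈)) = inj₂ (there v∈)
      bound : ∀ z → z ∈ W → ∑ (walks i z) (λ w → 𝟙 (v ∈? verts (cons z w))) ≤
                            D ^ suc i * 𝟙 (z Fin.≟ v) + suc i * D ^ i
      bound z z∈ = begin
        ∑ (walks i z) (λ w → 𝟙 (v ∈? verts (cons z w)))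
          ≤⟨ ∑-mono (walks i z) (λ {w} _ → 𝟙-⊎ (v ∈? verts (cons z w)) (z Fin.≟ v) (v ∈? verts w) (split (proj₁ w))) ⟩
        ∑ (walks i z) (λ w → 𝟙 (z Fin.≟ v) + 𝟙 (v ∈? verts w))
          ≡⟨ trans (∑-+ (walks i z) _ _) (cong (_+ count (λ w → v ∈? verts w) (walks i z)) (∑-const (walks i z) _)) ⟩
        length (walks i z) * 𝟙 (z Fin.≟ v) + count (λ w → v ∈? verts w) (walks i z)
          ≤⟨ +-mono-≤ (*-monoˡ-≤ (𝟙 (z Fin.≟ v)) (length-walks≤ i z∈)) (hit i v z∈) ⟩
        D ^ suc i * 𝟙 (z Fin.≟ v) + suc i * D ^ i ∎

    meets? : ∀ (F : List V) → Decidable (λ w → Any (_∈ F) (verts w))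
    meets? F w = Any.any? (_∈? F) (verts w)

    hits : ∀ i {x} F → x ∈ W → count (meets? F) (walks i x) ≤ length F * (suc i * D ^ i)
    hits i {x} F x∈ = begin
      count (meets? F) (walks i x)
        ≤⟨ ∑-mono (walks i x) (λ {w} _ → ≤-trans
             (𝟙-mono (meets? F w) (Any.any? (_∈? verts w) F) (λ m → let v , v∈ , v∈F = find m in lose v∈F v∈)) (𝟙-any (_∈? verts w) F)) ⟩
      ∑ (walks i x) (λ w → ∑ F λ v → 𝟙 (v ∈? verts w))
        ≡⟨ ∑-swap (walks i x) F _ ⟩
      ∑ F (λ v → count (λ w → v ∈? verts w) (walks i x))
        ≤⟨ ∑-≤-const F _ (λ {v} _ → hit i v x∈) ⟩
      length F * (suc i * D ^ i) ∎
      where open ≤-Reasoning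

    ∑-column : ∀ (g : V → ℕ) → ∑ W (λ x → ∑ (nbr x) g) ≤ D * ∑ W g
    ∑-column g = begin
      ∑ W (λ x → ∑ (nbr x) g)           ≡⟨ ∑-nbr-swap (λ _ → g) ⟩
      ∑ W (λ z → ∑ (nbr z) (λ _ → g z)) ≤⟨ ∑-mono W (λ {z} z∈ → ≤-trans (≤-reflexive (∑-const (nbr z) (g z)))
                                                                        (*-monoˡ-≤ (g z) (deg≤ z∈))) ⟩
      ∑ W (λ z → D * g z)               ≡⟨ ∑-*ˡ W D g ⟩
      D * ∑ W g                         ∎
      where open ≤-Reasoning

-- Good paths

-- The interior counts of the two pieces when a walk with `i` interior vertices is cut at one of
-- them.
splits : ℕ → List (ℕ × ℕ)
splits zero    = []
splits (suc i) = (0 , i) ∷ map (λ (e , e′) → suc e , e′) (splits i)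

length-splits : ∀ i → length (splits i) ≡ i
length-splits zero    = refl
length-splits (suc i) = cong suc (trans (length-map _ (splits i)) (length-splits i))

∈-splits : ∀ i {e e′} → (e , e′) ∈ splits i → e + suc e′ ≡ i
∈-splits (suc i) (here refl) = refl
∈-splits (suc i) (there s∈)  with _ , s′∈ , refl ← ∈-map⁻ _ s∈ = cong suc (∈-splits i s′∈)

-- The recursion behind `mult≤`: a good walk passes one of `N (suc i)` blocking vertices at one of
-- `suc i` positions, and both pieces have bounded multiplicity by induction. The last summand makes
-- the bound monotone in `i`.
multBound : (ℕ → ℕ) → ℕ → ℕ
multBound N zero    = 1
multBound N (suc i) = N (suc i) * (suc i * (multBound N i * multBound N i)) + multBound N i

multBound>0 : ∀ N i → 0 < multBound N i
multBound>0 N zero    = z<s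
multBound>0 N (suc i) = ≤-trans (multBound>0 N i) (m≤n+m _ _)

module Lightness {n : ℕ} (G : Graph n) (W : List (Fin n)) (W! : Unique W) (N : ℕ → ℕ) where

  open Walks G W W! public

  -- N i vertices meet the interiors of all paths from x to y with i interior vertices.
  Blocked : ℕ → V → V → Set
  Blocked i x y = ∃ λ (F : Vec V (N i)) →
    All (λ w → proj₂ w ≡ y → Unique (x ∷ verts w) → Any (_∈ Vec.toList F) (proj₁ w)) (walks i x)

  Blocked-cong : ∀ {x y i j} → i ≡ j → Blocked i x y → Blocked j x y
  Blocked-cong refl b = b

  abstract
    blocked? : ∀ i x y → Dec (Blocked i x y)
    blocked? i x y = anyVec? (N i) λ F → All.all? (λ w →
      (proj₂ w Fin.≟ y) →-dec (unique? (x ∷ verts w) →-dec Any.any? (_∈? Vec.toList F) (proj₁ w))) (walks i x)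

  unblocked : ∀ {i x y} → ¬ Blocked i x y → ∀ F → length F ≤ N i →
    ∃ λ ps → Walk x ps y × length ps ≡ i × Unique (x ∷ y ∷ ps) × (∀ {v} → v ∈ ps → v ∉ F)
  unblocked {i} {x} {y} ¬blocked F F≤
    with Any.any? (λ w → (proj₂ w Fin.≟ y) ×-dec (unique? (x ∷ verts w) ×-dec
                         ¬? (Any.any? (_∈? Vec.toList (pad (N i) x F)) (proj₁ w)))) (walks i x)
  ... | no none = contradiction (pad (N i) x F , All.tabulate λ {w} w∈ eq uniq →
          decidable-stable (Any.any? (_∈? _) (proj₁ w)) λ avoids → none (lose w∈ (eq , uniq , avoids))) ¬blocked
  ... | yes some with (ps , _) , w∈ , refl , uniq , avoids ← find some
                 with walk , len ← ∈-walks⁻ i w∈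
    = ps , walk , len , uniq , λ v∈ps v∈F → avoids (lose v∈ps (pad-⊇ F≤ v∈F))

  -- LightFrom x i ps y: the pairs of x with each vertex of ps ∷ʳ y are
  -- blocked, where the first of these vertices is i + 1 steps from x.
  LightFrom : V → ℕ → List V → V → Set
  LightFrom x i []       y = Blocked i x y
  LightFrom x i (p ∷ ps) y = Blocked i x p × LightFrom x (suc i) ps y

  abstract
    lightFrom? : ∀ x i ps y → Dec (LightFrom x i ps y)
    lightFrom? x i []       y = blocked? i x y
    lightFrom? x i (p ∷ ps) y = blocked? i x p ×-dec lightFrom? x (suc i) ps y

  -- The first vertex after `x` is exempt: an edge has no interior vertex at which it could be
  -- blocked.
  Light : V → End → Set
  Light x ([]     , y) = ⊤
  Light x (_ ∷ ps , y) = LightFrom x 1 ps y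

  light? : ∀ x w → Dec (Light x w)
  light? x ([]     , y) = yes tt
  light? x (_ ∷ ps , y) = lightFrom? x 1 ps y

  -- A good walk is a path all of whose subpaths have blocked ends.
  Good : V → List V → V → Set
  Good x []       y = x ≢ y
  Good x (z ∷ ps) y = Good z ps y × x ∉ verts (z ∷ ps , y) × LightFrom x 1 ps y

  abstract
    good? : ∀ x ps y → Dec (Good x ps y)
    good? x []       y = ¬? (x Fin.≟ y)
    good? x (z ∷ ps) y = good? z ps y ×-dec (¬? (x ∈? verts (z ∷ ps , y)) ×-dec lightFrom? x 1 ps y)

  good-unique : ∀ {x} ps {y} → Good x ps y → Unique (x ∷ y ∷ ps)
  good-unique []       x≢y = (x≢y ∷ []) ∷ [] ∷ []
  good-unique (z ∷ ps) (good , x∉ , _) with (z≢y ∷ z∉) ∷ (y∉ ∷ ps!) ← good-unique ps good =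
    All.¬Any⇒All¬ _ x∉ ∷ ((z≢y ∘ sym) ∷ y∉) ∷ z∉ ∷ ps!

  lightFrom-end : ∀ {x} i ps {y} → LightFrom x i ps y → Blocked (i + length ps) x y
  lightFrom-end {x} i []       {y} b       = Blocked-cong {x} {y} (sym (+-identityʳ i)) b
  lightFrom-end {x} i (p ∷ ps) {y} (_ , l) =
    Blocked-cong {x} {y} (sym (+-suc i (length ps))) (lightFrom-end (suc i) ps l)

  lightFrom-prefix : ∀ {x} i ps {v qs y} → LightFrom x i (ps ++ v ∷ qs) y → LightFrom x i ps v
  lightFrom-prefix i []       (b , _) = b
  lightFrom-prefix i (p ∷ ps) (b , l) = b , lightFrom-prefix (suc i) ps l

  lightFrom-snoc : ∀ {x} i ps {v y} → LightFrom x i ps v → Blocked (suc (i + length ps)) x y →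
                   LightFrom x i (ps ∷ʳ v) y
  lightFrom-snoc {x} i []       {v} {y} l       b = l , Blocked-cong {x} {y} (cong suc (+-identityʳ i)) b
  lightFrom-snoc {x} i (p ∷ ps) {v} {y} (c , l) b = c , lightFrom-snoc (suc i) ps l
    (Blocked-cong {x} {y} (cong suc (+-suc i (length ps))) b)

  good-split : ∀ {x} ps {v qs y} → Good x (ps ++ v ∷ qs) y → Good x ps v × Good v qs y
  good-split []       {v} (good , x∉ , _) = (λ { refl → x∉ (there (here refl)) }) , good
  good-split (z ∷ ps) {v} {qs} (good , x∉ , light) with good₁ , good₂ ← good-split ps good =
    (good₁ , (λ x∈ → x∉ (weaken x∈)) , lightFrom-prefix 1 ps light) , good₂
    where
    weaken : ∀ {x y} → x ∈ (v ∷ z ∷ ps) → x ∈ (y ∷ z ∷ (ps ++ v ∷ qs))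
    weaken (here refl) = there (there (∈-++⁺ʳ ps (here refl)))
    weaken (there x∈)  = there (∈-++⁺ˡ x∈)

  goodTo? : ∀ x y → Decidable (λ w → proj₂ w ≡ y × Good x (proj₁ w) (proj₂ w))
  goodTo? x y w = (proj₂ w Fin.≟ y) ×-dec good? x (proj₁ w) (proj₂ w)

  mult : ℕ → V → V → ℕ
  mult i x y = count (goodTo? x y) (walks i x)

  _⊕_ : End → End → End
  (ps , v) ⊕ (qs , y) = ps ++ v ∷ qs , y

  -- Cut the walk at `v`. This is only an inequality because a walk may visit `v` repeatedly, and
  -- then every visit contributes on the right.
  ∑-through : ∀ i x v (ψ : End → ℕ) →
    ∑ (walks i x) (λ w → 𝟙 (v ∈? proj₁ w) * ψ w) ≤
    ∑ (splits i) λ (e , e′) → ∑ (walks e x) λ w₁ → 𝟙 (proj₂ w₁ Fin.≟ v) * ∑ (walks e′ (proj₂ w₁)) λ w₂ → ψ (w₁ ⊕ w₂)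
  ∑-through zero    x v ψ = ≤-reflexive (trans (∑-walks-zero x _)
    (∑-zero (nbr x) λ _ → cong (_* ψ _) (𝟙-no (v ∈? []) λ ())))
  ∑-through (suc i) x v ψ = begin
    ∑ (walks (suc i) x) (λ w → 𝟙 (v ∈? proj₁ w) * ψ w)
      ≡⟨ ∑-walks-suc i x _ ⟩
    ∑ (nbr x) (λ z → ∑ (walks i z) λ w → 𝟙 (v ∈? (z ∷ proj₁ w)) * ψ (cons z w))
      ≤⟨ ∑-mono (nbr x) (λ {z} _ → step z) ⟩
    ∑ (nbr x) (λ z → first z + ∑ (splits i) (rest z))
      ≡⟨ ∑-+ (nbr x) _ _ ⟩
    ∑ (nbr x) first + ∑ (nbr x) (λ z → ∑ (splits i) (rest z))
      ≡⟨ cong₂ _+_ (sym (∑-walks-zero x _)) (trans (∑-swap (nbr x) (splits i) rest)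
           (trans (∑-cong (splits i) λ {(e , _)} _ → sym (∑-walks-suc e x _)) (sym (∑-map _ (splits i) _)))) ⟩
    ∑ (splits (suc i)) (λ (e , e′) →
      ∑ (walks e x) λ w₁ → 𝟙 (proj₂ w₁ Fin.≟ v) * ∑ (walks e′ (proj₂ w₁)) λ w₂ → ψ (w₁ ⊕ w₂)) ∎
    where
    open ≤-Reasoning
    first : V → ℕ
    first z = 𝟙 (z Fin.≟ v) * ∑ (walks i z) λ w → ψ (cons z w)
    rest : V → ℕ × ℕ → ℕ
    rest z (e , e′) = ∑ (walks e z) λ w₁ → 𝟙 (proj₂ w₁ Fin.≟ v) * ∑ (walks e′ (proj₂ w₁)) λ w₂ → ψ (cons z w₁ ⊕ w₂)
    term : ∀ z (w : End) → 𝟙 (v ∈? (z ∷ proj₁ w)) * ψ (cons z w) ≤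
                   𝟙 (z Fin.≟ v) * ψ (cons z w) + 𝟙 (v ∈? proj₁ w) * ψ (cons z w)
    term z w = ≤-trans (*-monoˡ-≤ _ (𝟙-⊎ (v ∈? (z ∷ proj₁ w)) (z Fin.≟ v) (v ∈? proj₁ w)
                 λ { (here eq) → inj₁ (sym eq) ; (there v∈) → inj₂ v∈ }))
               (≤-reflexive (*-distribʳ-+ (ψ (cons z w)) (𝟙 (z Fin.≟ v)) _))
    step : ∀ z → ∑ (walks i z) (λ w → 𝟙 (v ∈? (z ∷ proj₁ w)) * ψ (cons z w)) ≤ first z + ∑ (splits i) (rest z)
    step z = begin
      ∑ (walks i z) (λ w → 𝟙 (v ∈? (z ∷ proj₁ w)) * ψ (cons z w))
        ≤⟨ ∑-mono (walks i z) (λ {w} _ → term z w) ⟩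
      ∑ (walks i z) (λ w → 𝟙 (z Fin.≟ v) * ψ (cons z w) + 𝟙 (v ∈? proj₁ w) * ψ (cons z w))
        ≡⟨ trans (∑-+ (walks i z) _ _) (cong (_+ ∑ (walks i z) (λ w → 𝟙 (v ∈? proj₁ w) * ψ (cons z w)))
             (∑-*ˡ (walks i z) (𝟙 (z Fin.≟ v)) _)) ⟩
      first z + ∑ (walks i z) (λ w → 𝟙 (v ∈? proj₁ w) * ψ (cons z w))
        ≤⟨ +-monoʳ-≤ (first z) (∑-through i z v (ψ ∘ cons z)) ⟩
      first z + ∑ (splits i) (rest z) ∎

  -- By `good-split` both pieces of a good walk are good, so the good walks cut at `v` correspond to
  -- pairs of good walks.
  mult-through : ∀ e e′ x v y →
    ∑ (walks e x) (λ w₁ → 𝟙 (proj₂ w₁ Fin.≟ v) * ∑ (walks e′ (proj₂ w₁)) λ w₂ → 𝟙 (goodTo? x y (w₁ ⊕ w₂))) ≤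
    mult e x v * mult e′ v y
  mult-through e e′ x v y = begin
    ∑ (walks e x) (λ w₁ → 𝟙 (proj₂ w₁ Fin.≟ v) * ∑ (walks e′ (proj₂ w₁)) λ w₂ → 𝟙 (goodTo? x y (w₁ ⊕ w₂)))
      ≤⟨ ∑-mono (walks e x) (λ {w} _ → step w) ⟩
    ∑ (walks e x) (λ w₁ → mult e′ v y * 𝟙 (goodTo? x v w₁))
      ≡⟨ ∑-*ˡ (walks e x) (mult e′ v y) _ ⟩
    mult e′ v y * mult e x v
      ≡⟨ *-comm (mult e′ v y) _ ⟩
    mult e x v * mult e′ v y ∎
    where
    open ≤-Reasoning
    step : ∀ w₁ → 𝟙 (proj₂ w₁ Fin.≟ v) * ∑ (walks e′ (proj₂ w₁)) (λ w₂ → 𝟙 (goodTo? x y (w₁ ⊕ w₂))) ≤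
                  mult e′ v y * 𝟙 (goodTo? x v w₁)
    step w₁@(ps , v′) with v′ Fin.≟ v
    ... | no _ = z≤n
    ... | yes refl with good? x ps v
    ...   | yes _ = begin
      1 * ∑ (walks e′ v) (λ w₂ → 𝟙 (goodTo? x y (w₁ ⊕ w₂)))
        ≡⟨ *-identityˡ _ ⟩
      ∑ (walks e′ v) (λ w₂ → 𝟙 (goodTo? x y (w₁ ⊕ w₂)))
        ≤⟨ ∑-mono (walks e′ v) (λ {w₂} _ → 𝟙-mono (goodTo? x y (w₁ ⊕ w₂)) (goodTo? v y w₂)
             λ (eq , good) → eq , proj₂ (good-split ps good)) ⟩
      mult e′ v y
        ≡⟨ *-identityʳ _ ⟨
      mult e′ v y * 1 ∎
    ...   | no ¬good = ≤-reflexive (trans (*-identityˡ _) (trans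
      (∑-zero (walks e′ v) λ {w₂} _ → 𝟙-no (goodTo? x y (w₁ ⊕ w₂)) λ (_ , good) → ¬good (proj₁ (good-split ps good)))
      (sym (*-zeroʳ (mult e′ v y)))))

  -- If a good walk from x to y with suc i interior vertices exists, then x
  -- and y are blocked, and every such walk passes through a blocking vertex.
  mult≤ : ∀ i {e} → e ≤ i → ∀ x y → mult e x y ≤ multBound N i
  mult≤ zero {zero} _ x y = begin
    mult 0 x y                                ≡⟨ ∑-walks-zero x _ ⟩
    ∑ (nbr x) (λ v → 𝟙 (goodTo? x y ([] , v))) ≤⟨ ∑-mono (nbr x) (λ {v} _ → 𝟙-mono (goodTo? x y ([] , v)) (v Fin.≟ y) proj₁) ⟩
    count (λ v → v Fin.≟ y) (nbr x)           ≤⟨ count-≡≤1 (nbr! x) y ⟩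
    1                                         ∎
    where open ≤-Reasoning
  mult≤ (suc i) {e} e≤ x y with m≤n⇒m<n∨m≡n e≤
  ... | inj₁ (s≤s e≤i) = ≤-trans (mult≤ i e≤i x y) (m≤n+m _ _)
  ... | inj₂ refl with blocked? (suc i) x y
  ...   | no ¬b = ≤-trans (≤-reflexive (count-none (goodTo? x y) (walks (suc i) x) none)) z≤n
    where
    none : ∀ {w} → w ∈ walks (suc i) x → ¬ (proj₂ w ≡ y × Good x (proj₁ w) (proj₂ w))
    none {ps , _} w∈ (refl , good) with ps | ∈-walks⁻ (suc i) w∈ | good
    ... | _ ∷ ps′ | _ , len | _ , _ , light =
      ¬b (subst (λ j → Blocked j x y) len (lightFrom-end 1 ps′ light))
  ...   | yes (F , meets) = ≤-trans (begin
    mult (suc i) x y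
      ≤⟨ ∑-mono (walks (suc i) x) (λ w∈ → cover w∈) ⟩
    ∑ (walks (suc i) x) (λ w → ∑ (Vec.toList F) λ v → 𝟙 (v ∈? proj₁ w) * 𝟙 (goodTo? x y w))
      ≡⟨ ∑-swap (walks (suc i) x) (Vec.toList F) _ ⟩
    ∑ (Vec.toList F) (λ v → ∑ (walks (suc i) x) λ w → 𝟙 (v ∈? proj₁ w) * 𝟙 (goodTo? x y w))
      ≤⟨ ∑-≤-const (Vec.toList F) _ (λ {v} _ → ≤-trans (∑-through (suc i) x v _) (≤-trans
           (∑-≤-const (splits (suc i)) _ (bound v)) (≤-reflexive (cong (_* (multBound N i * multBound N i)) (length-splits (suc i)))))) ⟩
    length (Vec.toList F) * (suc i * (multBound N i * multBound N i))
      ≡⟨ cong (_* (suc i * (multBound N i * multBound N i))) (Vec.length-toList F) ⟩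
    N (suc i) * (suc i * (multBound N i * multBound N i)) ∎) (m≤m+n _ _)
    where
    open ≤-Reasoning
    bound : ∀ v {s} → s ∈ splits (suc i) → _ ≤ multBound N i * multBound N i
    bound v {a , b} s∈ with eq ← ∈-splits (suc i) s∈ = ≤-trans (mult-through a b x v y)
      (*-mono-≤ (mult≤ i (≤-pred (≤-trans (m≤m+n (suc a) b) (≤-reflexive (trans (sym (+-suc a b)) eq)))) x v)
                (mult≤ i (≤-pred (≤-trans (m≤n+m (suc b) a) (≤-reflexive eq))) v y))
    cover : ∀ {w} → w ∈ walks (suc i) x →
            𝟙 (goodTo? x y w) ≤ ∑ (Vec.toList F) λ v → 𝟙 (v ∈? proj₁ w) * 𝟙 (goodTo? x y w)
    cover {w} w∈ = 𝟙-≤ (goodTo? x y w) λ (eq , good) →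
      let v , v∈w , v∈F = find (All.lookup meets w∈ eq (good-unique (proj₁ w) good)) in
      ≤-trans (≤-reflexive (sym (cong₂ _*_ (𝟙-yes (v ∈? proj₁ w) v∈w) (𝟙-yes (goodTo? x y w) (eq , good)))))
              (∑-member (λ v → 𝟙 (v ∈? proj₁ w) * 𝟙 (goodTo? x y w)) v∈F)

-- The proportion of walks that are not good

*-^ : ∀ a b i → (a * b) ^ i ≡ a ^ i * b ^ i
*-^ a b zero    = refl
*-^ a b (suc i) = trans (cong (a * b *_) (*-^ a b i)) (shuffle a b (a ^ i) (b ^ i))
  where
  shuffle : ∀ a b p q → a * b * (p * q) ≡ a * p * (b * q)
  shuffle = solve-∀

-- If at most a 1/T fraction of the walks of each length have unblocked ends, then at
-- most a lightConst i / T fraction (goodConst i / T) of the walks fail to be light (good).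
module _ (K : ℕ) where

  lightConst : ℕ → ℕ
  lightConst zero    = 0
  lightConst (suc i) = K * lightConst i + 1

  goodConst : ℕ → ℕ
  goodConst zero    = 0
  goodConst (suc i) = K * goodConst i + suc (suc i) * K ^ suc i + lightConst (suc i)

module Regular {n : ℕ} (G : Graph n) (W : List (Fin n)) (W! : Unique W) (N : ℕ → ℕ) (d K : ℕ)
               (deg≥ : ∀ {x} → x ∈ W → d ≤ length (filter (adj? G x) W))
               (deg≤ : ∀ {x} → x ∈ W → length (filter (adj? G x) W) ≤ K * d) where

  open Lightness G W W! N public
  open Degrees d (K * d) deg≥ deg≤ public

  m D : ℕ
  m = length W
  D = K * d

  goodEnd? : ∀ x → Decidable (λ w → Good x (proj₁ w) (proj₂ w))
  goodEnd? x w = good? x (proj₁ w) (proj₂ w)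

  rich nonLight nonGood closed : ℕ → ℕ
  rich     i = ∑ W λ x → count (λ w → ¬? (blocked? i x (proj₂ w))) (walks i x)
  nonLight i = ∑ W λ x → count (λ w → ¬? (light? x w)) (walks i x)
  nonGood  i = ∑ W λ x → count (λ w → ¬? (goodEnd? x w)) (walks i x)
  closed   i = ∑ W λ x → count (λ w → x ∈? verts w) (walks i x)

  nonLight-zero : nonLight 0 ≡ 0
  nonLight-zero = ∑-zero W λ {x} _ → trans (∑-walks-zero x _) (∑-zero (nbr x) λ _ → refl)

  nonGood-zero : nonGood 0 ≡ 0
  nonGood-zero = ∑-zero W λ {x} _ → trans (∑-walks-zero x _)
    (count-none (λ y → ¬? (goodEnd? x ([] , y))) (nbr x) λ y∈ bad → bad λ { refl → adj-irrefl G refl (proj₂ (∈-nbr⁻ y∈)) })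

  light-snoc : ∀ {i x} w {y} → length (proj₁ w) ≡ i → Light x w → Blocked (suc i) x y → Light x (snoc w y)
  light-snoc {x = x} ([]     , v) {y} refl _     b = b
  light-snoc {x = x} (p ∷ ps , v) {y} refl light b = lightFrom-snoc 1 ps light b

  -- Remove the last step: either the shorter walk already fails to be light, and it has at most `D`
  -- extensions, or the new pair of ends is unblocked.
  nonLight-suc : ∀ i → nonLight (suc i) ≤ D * nonLight i + rich (suc i)
  nonLight-suc i = begin
    nonLight (suc i)
      ≤⟨ ∑-mono W (λ {x} _ → step x) ⟩
    ∑ W (λ x → D * count (λ w → ¬? (light? x w)) (walks i x) +
               count (λ w → ¬? (blocked? (suc i) x (proj₂ w))) (walks (suc i) x))
      ≡⟨ trans (∑-+ W _ _) (cong (_+ rich (suc i)) (∑-*ˡ W D _)) ⟩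
    D * nonLight i + rich (suc i) ∎
    where
    open ≤-Reasoning
    step : ∀ x → count (λ w → ¬? (light? x w)) (walks (suc i) x) ≤
                 D * count (λ w → ¬? (light? x w)) (walks i x) +
                 count (λ w → ¬? (blocked? (suc i) x (proj₂ w))) (walks (suc i) x)
    step x = begin
      count (λ w → ¬? (light? x w)) (walks (suc i) x)
        ≡⟨ ∑-walks-snoc i x _ ⟩
      ∑ (walks i x) (λ w → ∑ (nbr (proj₂ w)) λ y → 𝟙 (¬? (light? x (snoc w y))))
        ≤⟨ ∑-mono (walks i x) (λ {w} w∈ → ∑-mono (nbr (proj₂ w)) λ {y} _ →
             𝟙-⊎ (¬? (light? x (snoc w y))) (¬? (light? x w)) (¬? (blocked? (suc i) x y)) (split w∈)) ⟩
      ∑ (walks i x) (λ w → ∑ (nbr (proj₂ w)) λ y → 𝟙 (¬? (light? x w)) + 𝟙 (¬? (blocked? (suc i) x y)))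
        ≤⟨ ∑-mono (walks i x) (λ {w} w∈ → ≤-trans (≤-reflexive (∑-+ (nbr (proj₂ w)) _ _)) (+-monoˡ-≤ _
             (≤-trans (≤-reflexive (∑-const (nbr (proj₂ w)) _))
                      (*-monoˡ-≤ _ (deg≤ (Walk-end (proj₁ (∈-walks⁻ i w∈)))))))) ⟩
      ∑ (walks i x) (λ w → D * 𝟙 (¬? (light? x w)) + ∑ (nbr (proj₂ w)) λ y → 𝟙 (¬? (blocked? (suc i) x y)))
        ≡⟨ trans (∑-+ (walks i x) _ _) (cong₂ _+_ (∑-*ˡ (walks i x) D _) (sym (∑-walks-snoc i x _))) ⟩
      D * count (λ w → ¬? (light? x w)) (walks i x) +
      count (λ w → ¬? (blocked? (suc i) x (proj₂ w))) (walks (suc i) x) ∎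
      where
      split : ∀ {w y} → w ∈ walks i x → ¬ Light x (snoc w y) → ¬ Light x w ⊎ ¬ Blocked (suc i) x y
      split {w} {y} w∈ ¬light with light? x w | blocked? (suc i) x y
      ... | no ¬l | _     = inj₁ ¬l
      ... | yes l | no ¬b = inj₂ ¬b
      ... | yes l | yes b = contradiction (light-snoc w (proj₂ (∈-walks⁻ i w∈)) l b) ¬light

  -- Remove the first step: the rest is not good, or the start recurs, or the walk is not light from
  -- its start. In the first case each rest arises from at most `D` starts.
  nonGood-suc : ∀ i → nonGood (suc i) ≤ D * nonGood i + closed (suc i) + nonLight (suc i)
  nonGood-suc i = begin
    nonGood (suc i)
      ≤⟨ ∑-mono W (λ {x} _ → ∑-mono (walks (suc i) x) λ {w} w∈ → ≤-trans
           (𝟙-⊎ (¬? (goodEnd? x w)) (¬? (tailGood? w) ⊎-dec (x ∈? verts w)) (¬? (light? x w)) (split w∈))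
           (+-monoˡ-≤ _ (𝟙-⊎ (¬? (tailGood? w) ⊎-dec (x ∈? verts w)) (¬? (tailGood? w)) (x ∈? verts w) id))) ⟩
    ∑ W (λ x → ∑ (walks (suc i) x) λ w → 𝟙 (¬? (tailGood? w)) + 𝟙 (x ∈? verts w) + 𝟙 (¬? (light? x w)))
      ≡⟨ ∑-cong W (λ {x} _ → trans (∑-+ (walks (suc i) x) _ _)
           (cong (_+ count (λ w → ¬? (light? x w)) (walks (suc i) x)) (∑-+ (walks (suc i) x) _ _))) ⟩
    ∑ W (λ x → count (λ w → ¬? (tailGood? w)) (walks (suc i) x) + count (λ w → x ∈? verts w) (walks (suc i) x) +
               count (λ w → ¬? (light? x w)) (walks (suc i) x))
      ≡⟨ trans (∑-+ W _ _) (cong (_+ nonLight (suc i)) (∑-+ W _ _)) ⟩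
    ∑ W (λ x → count (λ w → ¬? (tailGood? w)) (walks (suc i) x)) + closed (suc i) + nonLight (suc i)
      ≤⟨ +-monoˡ-≤ (nonLight (suc i)) (+-monoˡ-≤ (closed (suc i)) (≤-trans
           (≤-reflexive (∑-cong W λ {x} _ → ∑-walks-suc i x _)) (∑-column _))) ⟩
    D * nonGood i + closed (suc i) + nonLight (suc i) ∎
    where
    open ≤-Reasoning
    TailGood : End → Set
    TailGood ([]     , y) = ⊤
    TailGood (z ∷ ps , y) = Good z ps y
    tailGood? : ∀ w → Dec (TailGood w)
    tailGood? ([]     , y) = yes tt
    tailGood? (z ∷ ps , y) = good? z ps y
    split : ∀ {x w} → w ∈ walks (suc i) x → ¬ Good x (proj₁ w) (proj₂ w) →
            (¬ TailGood w ⊎ x ∈ verts w) ⊎ ¬ Light x w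
    split {x} {[] , y}     w∈ _ with () ← proj₂ (∈-walks⁻ (suc i) w∈)
    split {x} {z ∷ ps , y} _ ¬good with good? z ps y | x ∈? verts (z ∷ ps , y) | lightFrom? x 1 ps y
    ... | no ¬g | _      | _     = inj₁ (inj₁ ¬g)
    ... | yes g | yes x∈ | _     = inj₁ (inj₂ x∈)
    ... | yes g | no x∉  | no ¬l = inj₂ ¬l
    ... | yes g | no x∉  | yes l = contradiction (g , x∉ , l) ¬good

  closed≤ : ∀ i → closed i ≤ m * (suc i * D ^ i)
  closed≤ i = ∑-≤-const W _ λ {x} x∈ → hit i x x∈

  module _ (T : ℕ) where

    nonLight≤ : ∀ i → (∀ e → e < i → T * rich (suc e) ≤ m * d ^ suc (suc e)) →
                T * nonLight i ≤ lightConst K i * (m * d ^ suc i)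
    nonLight≤ zero    _      = ≤-reflexive (trans (cong (T *_) nonLight-zero) (*-zeroʳ T))
    nonLight≤ (suc i) sparse = begin
      T * nonLight (suc i)                         ≤⟨ *-monoʳ-≤ T (nonLight-suc i) ⟩
      T * (D * nonLight i + rich (suc i))          ≡⟨ shuffle T D (nonLight i) (rich (suc i)) ⟩
      D * (T * nonLight i) + T * rich (suc i)
        ≤⟨ +-mono-≤ (*-monoʳ-≤ D (nonLight≤ i λ e e<i → sparse e (m<n⇒m<1+n e<i))) (sparse i ≤-refl) ⟩
      D * (lightConst K i * (m * d ^ suc i)) + m * d ^ suc (suc i)
        ≡⟨ collect K d (lightConst K i) m (d ^ suc i) ⟩
      lightConst K (suc i) * (m * d ^ suc (suc i)) ∎
      where
      open ≤-Reasoning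
      shuffle : ∀ T D l r → T * (D * l + r) ≡ D * (T * l) + T * r
      shuffle = solve-∀
      collect : ∀ K d l m p → K * d * (l * (m * p)) + m * (d * p) ≡ (K * l + 1) * (m * (d * p))
      collect = solve-∀

    nonGood≤ : T ≤ d → ∀ i → (∀ e → e < i → T * rich (suc e) ≤ m * d ^ suc (suc e)) →
               T * nonGood i ≤ goodConst K i * (m * d ^ suc i)
    nonGood≤ T≤d zero    _      = ≤-reflexive (trans (cong (T *_) nonGood-zero) (*-zeroʳ T))
    nonGood≤ T≤d (suc i) sparse = begin
      T * nonGood (suc i)
        ≤⟨ *-monoʳ-≤ T (nonGood-suc i) ⟩
      T * (D * nonGood i + closed (suc i) + nonLight (suc i))
        ≡⟨ shuffle T D (nonGood i) (closed (suc i)) (nonLight (suc i)) ⟩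
      D * (T * nonGood i) + T * closed (suc i) + T * nonLight (suc i)
        ≤⟨ +-mono-≤ (+-mono-≤ (*-monoʳ-≤ D (nonGood≤ T≤d i λ e e<i → sparse e (m<n⇒m<1+n e<i)))
             -- Walks that revisit their start are a fraction of order at most `1 / d`, so `T ≤ d`
             -- makes them negligible at the scale `1 / T`.
             (*-mono-≤ T≤d (≤-trans (closed≤ (suc i))
               (≤-reflexive (cong (λ p → m * (suc (suc i) * p)) (*-^ K d (suc i)))))))
             (nonLight≤ (suc i) sparse) ⟩
      D * (goodConst K i * (m * d ^ suc i)) + d * (m * (suc (suc i) * (K ^ suc i * d ^ suc i))) +
      lightConst K (suc i) * (m * d ^ suc (suc i))
        ≡⟨ collect K d (goodConst K i) m (d ^ suc i) (suc (suc i)) (K ^ suc i) (lightConst K (suc i)) ⟩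
      goodConst K (suc i) * (m * d ^ suc (suc i)) ∎
      where
      open ≤-Reasoning
      shuffle : ∀ T D g c l → T * (D * g + c + l) ≡ D * (T * g) + T * c + T * l
      shuffle = solve-∀
      collect : ∀ K d g m p j k l →
        K * d * (g * (m * p)) + d * (m * (j * (k * p))) + l * (m * (d * p)) ≡ (K * g + j * k + l) * (m * (d * p))
      collect = solve-∀

-- The case of mostly good walks

Unique⊆⇒length≤ : ∀ {n} {xs ys : List (Fin n)} → Unique xs → (∀ {x} → x ∈ xs → x ∈ ys) → length xs ≤ length ys
Unique⊆⇒length≤ {xs = xs} {ys} xs! xs⊆ys = begin
  length xs                             ≡⟨ trans (sym (*-identityʳ _)) (sym (∑-const xs 1)) ⟩
  ∑ xs (λ _ → 1)                        ≤⟨ ∑-mono xs (λ {x} x∈ → ≤-trans (≤-reflexive (sym (𝟙-yes (x Fin.≟ x) refl)))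
                                             (∑-member (λ y → 𝟙 (x Fin.≟ y)) (xs⊆ys x∈))) ⟩
  ∑ xs (λ x → ∑ ys λ y → 𝟙 (x Fin.≟ y)) ≡⟨ ∑-swap xs ys _ ⟩
  ∑ ys (λ y → count (Fin._≟ y) xs)      ≤⟨ ∑-≤-const ys 1 (λ {y} _ → count-≡≤1 xs! y) ⟩
  length ys * 1                         ≡⟨ *-identityʳ _ ⟩
  length ys                             ∎
  where open ≤-Reasoning

module Stars {n : ℕ} (G : Graph n) (W : List (Fin n)) (W! : Unique W) where

  open Walks G W W!

  -- Walks from the root b to the vertices as, with i interior vertices each; the second list
  -- collects all interior vertices.
  data Star (i : ℕ) (b : V) : List V → List V → Set where
    []  : Star i b [] []
    _∷_ : ∀ {ps a as us} → Walk b ps a × length ps ≡ i → Star i b as us → Star i b (a ∷ as) (ps ++ us)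

  -- The common goal of both cases. The leaves `as` stay fixed and only the root and the interior
  -- avoid `F`, so stars chosen one after another, each against the earlier ones, fit together to a
  -- subdivision.
  Starry : ℕ → List V → ℕ → Set
  Starry i as M = ∀ F → length F ≤ M →
    ∃₂ λ b us → Star i b as us × Unique (b ∷ us) × (∀ {v} → v ∈ b ∷ us → v ∉ F)

  length-star : ∀ {i b as us} → Star i b as us → length us ≡ length as * i
  length-star []                                    = refl
  length-star (_∷_ {ps} {us = us} (_ , refl) star) = trans (length-++ ps) (cong (length ps +_) (length-star star))

  star-interior : ∀ {i b as us v} → Star i b as us → v ∈ us →
    ∃₂ λ ps₁ ps₂ → ∃ λ a → Walk b (ps₁ ++ v ∷ ps₂) a × length (ps₁ ++ v ∷ ps₂) ≡ i
  star-interior (_∷_ {ps} (walk , len) star) v∈ with ∈-++⁻ ps v∈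
  ... | inj₂ v∈us = star-interior star v∈us
  ... | inj₁ v∈ps with ps₁ , ps₂ , refl ← ∈-∃++ v∈ps = ps₁ , ps₂ , _ , walk , len

module LightCase {n : ℕ} (G : Graph n) (W : List (Fin n)) (W! : Unique W) (N : ℕ → ℕ) (d K : ℕ)
                 (deg≥ : ∀ {x} → x ∈ W → d ≤ length (filter (adj? G x) W))
                 (deg≤ : ∀ {x} → x ∈ W → length (filter (adj? G x) W) ≤ K * d)
                 (i s M : ℕ) {{d≢0 : NonZero d}} {{K≢0 : NonZero K}} where

  open Regular G W W! N d K deg≥ deg≤
  open Stars G W W!

  k f : ℕ
  k = suc i
  f = multBound N i

  goods : V → ℕ
  goods x = count (goodEnd? x) (walks i x)

  -- The state of one root while the common leaves are chosen: the star built so far, with leaves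
  -- shared by all surviving roots. `plenty` is the hypothesis of the averaging, which does not
  -- deteriorate as the star grows.
  record Rooted (as : List V) : Set where
    field
      root    : V
      inner   : List V
      root∈   : root ∈ W
      star    : Star i root as inner
      inner!  : Unique (root ∷ inner)
      ends!   : Unique as
      apart   : ∀ {v} → v ∈ root ∷ inner → v ∉ as
      plenty  : d ^ k ≤ 4 * goods root
  open Rooted

  used : ∀ {as} → Rooted as → List V
  used {as} r = inner r ++ as

  Reaches : ∀ {as} → V → Rooted as → Set
  Reaches a r = Any (λ w → (proj₂ w ≡ a × Good (root r) (proj₁ w) (proj₂ w)) × ¬ Any (_∈ used r) (verts w))
                    (walks i (root r))

  abstract
    fresh? : ∀ {as} (r : Rooted as) (a : V) →
             Decidable (λ w → (proj₂ w ≡ a × Good (root r) (proj₁ w) (proj₂ w)) × ¬ Any (_∈ used r) (verts w))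
    fresh? r a w = goodTo? (root r) a w ×-dec ¬? (meets? (used r) w)

  abstract
    reaches? : ∀ {as} (a : V) (r : Rooted as) → Dec (Reaches a r)
    reaches? a r = Any.any? (fresh? r a) (walks i (root r))

  extend : ∀ {as} a (r : Rooted as) → Reaches a r → ∃ λ (r′ : Rooted (a ∷ as)) → root r′ ≡ root r
  extend {as} a r some
    with (ps , _) , w∈ , (refl , good) , avoids ← find some
    with walk , len ← ∈-walks⁻ i w∈
    with ((b≢a ∷ b∉ps) ∷ (a∉ps ∷ ps!)) ← good-unique ps good
    with (b∉inner ∷ inner!′) ← inner! r
    = record
      { root   = root r
      ; inner  = ps ++ inner r
      ; root∈  = root∈ r
      ; star   = (walk , len) ∷ star r
      ; inner! = All.++⁺ b∉ps b∉inner ∷ Unique.++⁺ ps! inner!′ (λ (v∈ps , v∈inner) →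
                   avoids (lose (there v∈ps) (∈-++⁺ˡ v∈inner)))
      ; ends!  = All.¬Any⇒All¬ as (λ a∈as → avoids (here (∈-++⁺ʳ (inner r) a∈as))) ∷ ends! r
      ; apart  = separate
      ; plenty = plenty r
      } , refl
    where
    separate : ∀ {v} → v ∈ root r ∷ (ps ++ inner r) → v ∉ a ∷ as
    separate (here refl) (here eq)    = b≢a eq
    separate (here refl) (there v∈as) = apart r (here refl) v∈as
    separate (there v∈)  v∈a∷as with ∈-++⁻ ps v∈ | v∈a∷as
    ... | inj₁ v∈ps    | here refl  = All.lookup a∉ps v∈ps refl
    ... | inj₁ v∈ps    | there v∈as = avoids (lose (there v∈ps) (∈-++⁺ʳ (inner r) v∈as))
    ... | inj₂ v∈inner | here refl  = avoids (here (∈-++⁺ˡ v∈inner))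
    ... | inj₂ v∈inner | there v∈as = apart r (there v∈inner) v∈as

  -- Roots that cannot reach the new leaf are discarded; a surviving star keeps its root, so the
  -- roots remain distinct.
  extendAll : ∀ {as} a (B : List (Rooted as)) → Unique (map root B) →
    ∃ λ (B′ : List (Rooted (a ∷ as))) → length B′ ≡ count (reaches? a) B × Unique (map root B′) ×
      (∀ {v} → v ∈ map root B′ → v ∈ map root B)
  extendAll a []      _ = [] , refl , [] , λ ()
  extendAll a (r ∷ B) (r∉ ∷ B!) with B′ , len , B′! , sub ← extendAll a B B! | reaches? a r
  ... | no _  = B′ , len , B′! , there ∘ sub
  ... | yes p with r′ , refl ← extend a r p =
    r′ ∷ B′ , cong suc len , All.¬Any⇒All¬ _ (λ r∈ → All.lookup r∉ (sub r∈) refl) ∷ B′! ,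
    λ { (here eq) → here eq ; (there v∈) → there (sub v∈) }

  module Selection (d-large : 8 * (s * suc i * (suc i * K ^ i)) ≤ d) where

    -- Of at least `d ^ k / 4` good walks from the root, `d-large` lets at most `d ^ k / 8` meet
    -- used vertices, and at most `f` of the rest share an end.
    reach-many : ∀ {as} (r : Rooted as) → length as ≤ s → d ^ k ≤ 8 * f * count (λ a → reaches? a r) W
    reach-many {as} r as≤ = +-cancelʳ-≤ (d ^ k) _ _ (begin
      d ^ k + d ^ k
        ≡⟨ double (d ^ k) ⟩
      2 * d ^ k
        ≤⟨ *-monoʳ-≤ 2 (plenty r) ⟩
      2 * (4 * goods (root r))
        ≤⟨ *-monoʳ-≤ 2 (*-monoʳ-≤ 4 split) ⟩
      2 * (4 * (f * count (λ a → reaches? a r) W + s * suc i * (suc i * D ^ i)))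
        ≡⟨ distribute f (count (λ a → reaches? a r) W) (s * suc i * (suc i * D ^ i)) ⟩
      8 * f * count (λ a → reaches? a r) W + 8 * (s * suc i * (suc i * D ^ i))
        ≤⟨ +-monoʳ-≤ (8 * f * count (λ a → reaches? a r) W) small ⟩
      8 * f * count (λ a → reaches? a r) W + d ^ k ∎)
      where
      open ≤-Reasoning
      double : ∀ x → x + x ≡ 2 * x
      double = solve-∀
      distribute : ∀ f c u → 2 * (4 * (f * c + u)) ≡ 8 * f * c + 8 * u
      distribute = solve-∀
      regroup : ∀ a b p q → 8 * (a * (b * (p * q))) ≡ 8 * (a * (b * p)) * q
      regroup = solve-∀
      small : 8 * (s * suc i * (suc i * D ^ i)) ≤ d ^ k
      small = begin
        8 * (s * suc i * (suc i * D ^ i))           ≡⟨ cong (λ p → 8 * (s * suc i * (suc i * p))) (*-^ K d i) ⟩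
        8 * (s * suc i * (suc i * (K ^ i * d ^ i))) ≡⟨ regroup (s * suc i) (suc i) (K ^ i) (d ^ i) ⟩
        8 * (s * suc i * (suc i * K ^ i)) * d ^ i   ≤⟨ *-monoˡ-≤ (d ^ i) d-large ⟩
        d ^ k                                       ∎
      length-used : length (used r) ≤ s * suc i
      length-used = begin
        length (inner r ++ as)      ≡⟨ trans (length-++ (inner r)) (cong (_+ length as) (length-star (star r))) ⟩
        length as * i + length as   ≡⟨ trans (+-comm _ (length as)) (sym (*-suc (length as) i)) ⟩
        length as * suc i           ≤⟨ *-monoˡ-≤ (suc i) as≤ ⟩
        s * suc i                   ∎
      good-fresh? : Decidable (λ w → Good (root r) (proj₁ w) (proj₂ w) × ¬ Any (_∈ used r) (verts w))
      good-fresh? w = goodEnd? (root r) w ×-dec ¬? (meets? (used r) w)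
      case-split : ∀ w → Good (root r) (proj₁ w) (proj₂ w) →
        (Good (root r) (proj₁ w) (proj₂ w) × ¬ Any (_∈ used r) (verts w)) ⊎ Any (_∈ used r) (verts w)
      case-split w good with meets? (used r) w
      ... | yes hit = inj₂ hit
      ... | no ¬hit = inj₁ (good , ¬hit)
      by-end : ∀ a → count (fresh? r a) (walks i (root r)) ≤ f * 𝟙 (reaches? a r)
      by-end a with reaches? a r
      ... | yes _ = ≤-trans (≤-trans (∑-mono (walks i (root r)) λ {w} _ → 𝟙-mono (fresh? r a w) (goodTo? (root r) a w) proj₁)
                       (mult≤ i ≤-refl (root r) a)) (≤-reflexive (sym (*-identityʳ f)))
      ... | no ¬a = ≤-trans (≤-reflexive (count-none (fresh? r a) (walks i (root r)) λ w∈ p → ¬a (lose w∈ p))) z≤n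
      split : goods (root r) ≤ f * count (λ a → reaches? a r) W + s * suc i * (suc i * D ^ i)
      split = begin
        goods (root r)
          ≤⟨ ∑-mono (walks i (root r)) (λ {w} _ →
               𝟙-⊎ (goodEnd? (root r) w) (good-fresh? w) (meets? (used r) w) (case-split w)) ⟩
        ∑ (walks i (root r)) (λ w → 𝟙 (good-fresh? w) + 𝟙 (meets? (used r) w))
          ≡⟨ ∑-+ (walks i (root r)) _ _ ⟩
        count good-fresh? (walks i (root r)) + count (meets? (used r)) (walks i (root r))
          ≤⟨ +-mono-≤ (∑-mono (walks i (root r)) λ {w} w∈ → 𝟙-≤ (good-fresh? w) λ (good , ¬hit) →
               ≤-trans (≤-reflexive (sym (𝟙-yes (fresh? r (proj₂ w) w) ((refl , good) , ¬hit))))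
                       (∑-member (λ a → 𝟙 (fresh? r a w)) (Walk-end (proj₁ (∈-walks⁻ i w∈)))))
               (hits i (used r) (root∈ r)) ⟩
        ∑ (walks i (root r)) (λ w → ∑ W λ a → 𝟙 (fresh? r a w)) + length (used r) * (suc i * D ^ i)
          ≤⟨ +-mono-≤ (≤-trans (≤-reflexive (∑-swap (walks i (root r)) W _)) (∑-mono W λ {a} _ → by-end a))
                      (*-monoˡ-≤ (suc i * D ^ i) length-used) ⟩
        ∑ W (λ a → f * 𝟙 (reaches? a r)) + s * suc i * (suc i * D ^ i)
          ≡⟨ cong (_+ s * suc i * (suc i * D ^ i)) (∑-*ˡ W f _) ⟩
        f * count (λ a → reaches? a r) W + s * suc i * (suc i * D ^ i) ∎

    -- By `pick`, some vertex is reached from a fraction `d ^ k / (8 * f * m)` of the remaining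
    -- roots; the `j`-th powers record the accumulated loss.
    select : 0 < m → (B₀ : List (Rooted [])) → Unique (map root B₀) → ∀ j → j ≤ s →
      ∃ λ as → length as ≡ j × ∃ λ (B : List (Rooted as)) → Unique (map root B) ×
        (d ^ k) ^ j * length B₀ ≤ (8 * f * m) ^ j * length B
    select m>0 B₀ B₀! zero    _ = [] , refl , B₀ , B₀! , ≤-refl
    select m>0 B₀ B₀! (suc j) j<s =
      let as , len , B , B! , large = select m>0 B₀ B₀! j (≤-trans (n≤1+n j) j<s)
          a , _ , share = pick reaches? W B (8 * f) (d ^ k) m>0
            λ {r} _ → reach-many r (≤-trans (≤-reflexive len) (≤-trans (n≤1+n j) j<s))
          B′ , len′ , B′! , _ = extendAll a B B!
      in a ∷ as , cong suc len , B′ , B′! ,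
         combine-shares (length B₀) (length B) (length B′) j large
           (≤-trans share (≤-reflexive (cong (8 * f * m *_) (sym len′))))
      where
      combine-shares : ∀ b₀ b b′ j → (d ^ k) ^ j * b₀ ≤ (8 * f * m) ^ j * b → b * d ^ k ≤ 8 * f * m * b′ →
                       (d ^ k) ^ suc j * b₀ ≤ (8 * f * m) ^ suc j * b′
      combine-shares b₀ b b′ j large share = begin
        d ^ k * (d ^ k) ^ j * b₀            ≡⟨ *-assoc (d ^ k) _ _ ⟩
        d ^ k * ((d ^ k) ^ j * b₀)          ≤⟨ *-monoʳ-≤ (d ^ k) large ⟩
        d ^ k * ((8 * f * m) ^ j * b)       ≡⟨ rotate (d ^ k) ((8 * f * m) ^ j) b ⟩
        (8 * f * m) ^ j * (b * d ^ k)       ≤⟨ *-monoʳ-≤ ((8 * f * m) ^ j) share ⟩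
        (8 * f * m) ^ j * (8 * f * m * b′)  ≡⟨ assemble ((8 * f * m) ^ j) (8 * f * m) b′ ⟩
        (8 * f * m) ^ suc j * b′            ∎
        where
        open ≤-Reasoning
        rotate : ∀ p q b → p * (q * b) ≡ q * (b * p)
        rotate = solve-∀
        assemble : ∀ p q b → p * (q * b) ≡ q * p * b
        assemble = solve-∀

    -- Contains every root whose star meets `v`: an interior vertex is at most `i` steps away from
    -- the root.
    ball : V → List V
    ball v = v ∷ concatMap (λ e → map proj₂ (walks e v)) (upTo i)

    length-ball : ∀ {v} → v ∈ W → length (ball v) ≤ suc (i * D ^ i)
    length-ball {v} v∈ = s≤s (begin
      length (concatMap (λ e → map proj₂ (walks e v)) (upTo i))
        ≡⟨ length-concatMap _ (upTo i) ⟩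
      ∑ (upTo i) (λ e → length (map proj₂ (walks e v)))
        ≤⟨ ∑-≤-const (upTo i) (D ^ i) (λ {e} e∈ → ≤-trans (≤-reflexive (length-map proj₂ (walks e v)))
             (≤-trans (length-walks≤ e v∈) (^-monoʳ-≤ D {{m*n≢0 K d}} (∈-upTo⁻ e∈)))) ⟩
      length (upTo i) * D ^ i
        ≡⟨ cong (_* D ^ i) (length-upTo i) ⟩
      i * D ^ i ∎)
      where open ≤-Reasoning

    root∈ball : ∀ {as v} (r : Rooted as) → v ∈ root r ∷ inner r → root r ∈ ball v × v ∈ W
    root∈ball r (here refl) = here refl , root∈ r
    root∈ball r (there v∈)  =
      let ps₁ , ps₂ , _ , walk , len = star-interior (star r) v∈
          back = Walk-reverse (root∈ r) (proj₁ (Walk-split ps₁ walk))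
          short : length (reverse ps₁) < i
          short = ≤-trans (s≤s (≤-trans (≤-reflexive (length-reverse ps₁)) (m≤m+n _ (length ps₂))))
                    (≤-reflexive (trans (sym (+-suc (length ps₁) (length ps₂))) (trans (sym (length-++ ps₁)) len)))
      in there (∈-concat⁺′ (∈-map⁺ proj₂ (∈-walks⁺ back)) (∈-map⁺ (λ e → map proj₂ (walks e _)) (∈-upTo⁺ short))) ,
         Walk-end (proj₁ (Walk-split ps₁ walk))

    -- If every star met `F`, all roots would lie in the balls around `F`, which are too small
    -- together. Vertices of `F` outside `W` are dropped, since stars have no root or interior
    -- vertex there.
    escape : ∀ {as} (B : List (Rooted as)) → Unique (map root B) → M * suc (i * D ^ i) < length B → Starry i as M
    escape B B! many F F≤ with Any.any? (λ r → ¬? (Any.any? (_∈? F) (root r ∷ inner r))) B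
    ... | yes some = let r , _ , avoids = find some in
      root r , inner r , star r , inner! r , λ v∈ v∈F → avoids (lose v∈ v∈F)
    ... | no none = contradiction many (≤⇒≯ (begin
      length B                                          ≡⟨ length-map root B ⟨
      length (map root B)                               ≤⟨ Unique⊆⇒length≤ B! inside ⟩
      length (concatMap ball (filter (_∈? W) F))        ≡⟨ length-concatMap ball (filter (_∈? W) F) ⟩
      ∑ (filter (_∈? W) F) (λ v → length (ball v))
        ≤⟨ ∑-≤-const _ _ (λ v∈ → length-ball (proj₂ (∈-filter⁻ (_∈? W) {xs = F} v∈))) ⟩
      length (filter (_∈? W) F) * suc (i * D ^ i)
        ≤⟨ *-monoˡ-≤ (suc (i * D ^ i)) (≤-trans (length-filter (_∈? W) F) F≤) ⟩
      M * suc (i * D ^ i)                               ∎))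
      where
      open ≤-Reasoning
      inside : ∀ {x} → x ∈ map root B → x ∈ concatMap ball (filter (_∈? W) F)
      inside x∈ =
        let r , r∈ , x≡ = ∈-map⁻ root x∈
            v , v∈ , v∈F = find (decidable-stable (Any.any? (_∈? F) (root r ∷ inner r)) λ avoids → none (lose r∈ avoids))
            near , v∈W = root∈ball r v∈
        in ∈-concat⁺′ (subst (_∈ ball v) (sym x≡) near) (∈-map⁺ ball (∈-filter⁺ (_∈? W) v∈F v∈W))

    seeds : ∀ xs → (∀ {x} → x ∈ xs → x ∈ W × d ^ k ≤ 4 * goods x) → ∃ λ (B : List (Rooted [])) → map root B ≡ xs
    seeds []       _  = [] , refl
    seeds (x ∷ xs) ok =
      let B , eq = seeds xs (ok ∘ there) in
      record { root = x ; inner = [] ; root∈ = proj₁ (ok (here refl)) ; star = [] ; inner! = [] ∷ [] ; ends! = []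
             ; apart = λ _ () ; plenty = proj₂ (ok (here refl)) } ∷ B , cong (x ∷_) eq

    popularRoots : List V
    popularRoots = filter (λ x → d ^ k ≤? 4 * goods x) W

    -- At least `m * d ^ k / 2` walks are good. Roots below the threshold `d ^ k / 4` account for at
    -- most half of this, and a single root for at most `(K * d) ^ k`.
    popular-roots : 2 * nonGood i ≤ m * d ^ k → m ≤ 4 * K ^ k * length popularRoots
    popular-roots few = *-cancelʳ-≤ m _ (d ^ k) {{m^n≢0 d k}} (+-cancelʳ-≤ (m * d ^ k) _ _ (+-cancelʳ-≤ (2 * (m * d ^ k)) _ _ (begin
      m * d ^ k + m * d ^ k + 2 * (m * d ^ k)
        ≡⟨ quadruple (m * d ^ k) ⟩
      4 * (m * d ^ k)
        ≤⟨ *-monoʳ-≤ 4 total ⟩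
      4 * (∑ W goods + nonGood i)
        ≡⟨ halve (∑ W goods) (nonGood i) ⟩
      4 * ∑ W goods + 2 * (2 * nonGood i)
        ≤⟨ +-mono-≤ (popular W goods 4 (D ^ k) (d ^ k) λ {x} x∈ →
             ≤-trans (count≤length (goodEnd? x) (walks i x)) (length-walks≤ i x∈)) (*-monoʳ-≤ 2 few) ⟩
      length popularRoots * (4 * D ^ k) + m * d ^ k + 2 * (m * d ^ k)
        ≡⟨ cong (λ p → length popularRoots * (4 * p) + m * d ^ k + 2 * (m * d ^ k)) (*-^ K d k) ⟩
      length popularRoots * (4 * (K ^ k * d ^ k)) + m * d ^ k + 2 * (m * d ^ k)
        ≡⟨ cong (λ p → p + m * d ^ k + 2 * (m * d ^ k)) (regroup (length popularRoots) (K ^ k) (d ^ k)) ⟩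
      4 * K ^ k * length popularRoots * d ^ k + m * d ^ k + 2 * (m * d ^ k) ∎)))
      where
      open ≤-Reasoning
      quadruple : ∀ x → x + x + 2 * x ≡ 4 * x
      quadruple = solve-∀
      halve : ∀ g b → 4 * (g + b) ≡ 4 * g + 2 * (2 * b)
      halve = solve-∀
      regroup : ∀ l p q → l * (4 * (p * q)) ≡ 4 * p * l * q
      regroup = solve-∀
      total : m * d ^ k ≤ ∑ W goods + nonGood i
      total = ≤-trans (∑-≥-const W (d ^ k) λ {x} x∈ → ≤-trans (length-walks≥ i x∈)
        (≤-reflexive (sym (count-complement (goodEnd? x) (walks i x))))) (≤-reflexive (∑-+ W _ _))

    -- Collects the losses: `4 * K ^ k` in the choice of popular roots, `(8 * f) ^ s` in the
    -- averagings, and `8 * f` in the comparison of `d ^ k` with `m`.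
    lightFactor : ℕ
    lightFactor = 8 * f * (4 * K ^ k * (8 * f) ^ s)

    starry : 0 < m → 2 * nonGood i ≤ m * d ^ k →
             lightFactor * suc (M * suc (i * K ^ i)) * m ^ s ≤ d ^ suc (s * k) →
             ∃ λ as → length as ≡ s × Unique as × Starry i as M
    starry m>0 few dense =
      let B₀ , B₀≡ = seeds popularRoots λ {x} x∈ → ∈-filter⁻ (λ x → d ^ k ≤? 4 * goods x) {xs = W} x∈
          |B₀| : length B₀ ≡ length popularRoots
          |B₀| = trans (sym (length-map root B₀)) (cong length B₀≡)
          as , len , B , B! , large = select m>0 B₀
            (subst Unique (sym B₀≡) (Unique.filter⁺ (λ x → d ^ k ≤? 4 * goods x) W!)) s ≤-refl
          m≤ : m ≤ 4 * K ^ k * length B₀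
          m≤ = ≤-trans (popular-roots few) (≤-reflexive (cong (4 * K ^ k *_) (sym |B₀|)))
          B₀>0 : 0 < length B₀
          B₀>0 = n≢0⇒n>0 λ eq → <⇒≱ m>0 (≤-trans m≤ (≤-reflexive (trans (cong (4 * K ^ k *_) eq) (*-zeroʳ (4 * K ^ k)))))
          many = enough (length B₀) (length B) m≤ (first B₀ B₀>0) large
      in as , len , ends B B! (≤-trans z<s many) , escape B B! many
      where
      ends : ∀ {as} (B : List (Rooted as)) → Unique (map root B) → 0 < length B → Unique as
      ends (r ∷ _) _ _ = ends! r
      -- A single root reaches at least `d ^ k / (8 * f)` distinct vertices of `W`, so `m` is at
      -- least that large. In `enough` this bounds a factor `d ^ k` by the number of initial roots.
      first : (B : List (Rooted [])) → 0 < length B → d ^ k ≤ 8 * f * m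
      first (r ∷ _) _ = ≤-trans (reach-many r z≤n) (*-monoʳ-≤ (8 * f) (count≤length (λ a → reaches? a r) W))
      enough : ∀ b₀ b → m ≤ 4 * K ^ k * b₀ → d ^ k ≤ 8 * f * m → (d ^ k) ^ s * b₀ ≤ (8 * f * m) ^ s * b →
               M * suc (i * D ^ i) < b
      enough b₀ b m≤ d≤ large = ≤-trans X< (*-cancelʳ-≤ _ _ (d * m ^ s * lightFactor) {{nz}} (begin
        suc Y * d ^ i * (d * m ^ s * lightFactor)
          ≡⟨ gather (suc Y) (d ^ i) d (m ^ s) lightFactor ⟩
        lightFactor * suc Y * m ^ s * d ^ k
          ≤⟨ *-mono-≤ dense (≤-trans d≤ (*-monoʳ-≤ (8 * f) m≤)) ⟩
        d ^ suc (s * k) * (8 * f * (4 * K ^ k * b₀))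
          ≡⟨ cong (λ p → d * p * (8 * f * (4 * K ^ k * b₀))) (trans (cong (d ^_) (*-comm s k)) (sym (^-*-assoc d k s))) ⟩
        d * (d ^ k) ^ s * (8 * f * (4 * K ^ k * b₀))
          ≡⟨ isolate d ((d ^ k) ^ s) (8 * f) (4 * K ^ k) b₀ ⟩
        d * (8 * f) * (4 * K ^ k) * ((d ^ k) ^ s * b₀)
          ≤⟨ *-monoʳ-≤ (d * (8 * f) * (4 * K ^ k)) large ⟩
        d * (8 * f) * (4 * K ^ k) * ((8 * f * m) ^ s * b)
          ≡⟨ cong (λ p → d * (8 * f) * (4 * K ^ k) * (p * b)) (*-^ (8 * f) m s) ⟩
        d * (8 * f) * (4 * K ^ k) * ((8 * f) ^ s * m ^ s * b)
          ≡⟨ finish d (8 * f) (4 * K ^ k) ((8 * f) ^ s) (m ^ s) b ⟩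
        b * (d * m ^ s * lightFactor) ∎))
        where
        open ≤-Reasoning
        Y : ℕ
        Y = M * suc (i * K ^ i)
        instance
          m≢0 : NonZero m
          m≢0 = >-nonZero m>0
          8f≢0 : NonZero (8 * f)
          8f≢0 = m*n≢0 8 f {{_}} {{>-nonZero (multBound>0 N i)}}
          4K≢0 : NonZero (4 * K ^ k)
          4K≢0 = m*n≢0 4 (K ^ k) {{_}} {{m^n≢0 K k}}
        nz : NonZero (d * m ^ s * lightFactor)
        nz = m*n≢0 (d * m ^ s) lightFactor {{m*n≢0 d (m ^ s) {{d≢0}} {{m^n≢0 m s}}}}
          {{m*n≢0 (8 * f) (4 * K ^ k * (8 * f) ^ s) {{8f≢0}} {{m*n≢0 (4 * K ^ k) ((8 * f) ^ s) {{4K≢0}} {{m^n≢0 (8 * f) s}}}}}}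
        gather : ∀ y p d q l → y * p * (d * q * l) ≡ l * y * q * (d * p)
        gather = solve-∀
        isolate : ∀ d p a c b → d * p * (a * (c * b)) ≡ d * a * c * (p * b)
        isolate = solve-∀
        finish : ∀ d a c p q b → d * a * c * (p * q * b) ≡ b * (d * q * (a * (c * p)))
        finish = solve-∀
        expand : ∀ M i p q → M * suc (i * p) * q ≡ M * (q + i * (p * q))
        expand = solve-∀
        X< : M * suc (i * D ^ i) < suc Y * d ^ i
        X< = begin-strict
          M * suc (i * D ^ i)              ≡⟨ cong (λ p → M * suc (i * p)) (*-^ K d i) ⟩
          M * (1 + i * (K ^ i * d ^ i))    ≤⟨ *-monoʳ-≤ M (+-monoˡ-≤ _ (m^n>0 d i)) ⟩
          M * (d ^ i + i * (K ^ i * d ^ i)) ≡⟨ expand M i (K ^ i) (d ^ i) ⟨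
          Y * d ^ i                        <⟨ m<n+m (Y * d ^ i) (m^n>0 d i) ⟩
          suc Y * d ^ i                    ∎

-- The case of many unblocked walks

split-at : ∀ {A : Set} e {r} (xs : List A) → length xs ≡ e + suc r →
           ∃₂ λ ys x → ∃ λ zs → xs ≡ ys ++ x ∷ zs × length ys ≡ e × length zs ≡ r
split-at zero    (x ∷ xs) len = [] , x , xs , refl , refl , suc-injective len
split-at (suc e) (x ∷ xs) len =
  let ys , y , zs , eq , len₁ , len₂ = split-at e xs (suc-injective len) in
  x ∷ ys , y , zs , cong (x ∷_) eq , cong suc len₁ , len₂

unique-++⁻ : ∀ {A : Set} (xs : List A) {ys} → Unique (xs ++ ys) →
             Unique xs × Unique ys × (∀ {v} → v ∈ xs → v ∉ ys)
unique-++⁻ []       ys!         = [] , ys! , λ ()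
unique-++⁻ (x ∷ xs) (x∉ ∷ rest) =
  let xs! , ys! , apart = unique-++⁻ xs rest in
  All.++⁻ˡ xs x∉ ∷ xs! , ys! ,
  λ { (here refl) v∈ys → All.lookup (All.++⁻ʳ xs x∉) v∈ys refl ; (there v∈) v∈ys → apart v∈ v∈ys }

unique-suffix : ∀ {n} {x y u : Fin n} ps {qs} → Unique (x ∷ y ∷ ps ++ u ∷ qs) → Unique (u ∷ y ∷ qs)
unique-suffix ps (_ ∷ (y∉ ∷ ps!))
  with u∉ ∷ qs! ← proj₁ (proj₂ (unique-++⁻ ps ps!)) | y≢u ∷ y∉qs ← All.++⁻ʳ ps y∉ =
  ((y≢u ∘ sym) ∷ u∉) ∷ y∉qs ∷ qs!

module HeavyCase {n : ℕ} (G : Graph n) (W : List (Fin n)) (W! : Unique W) (N : ℕ → ℕ) (d K : ℕ)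
                 (deg≥ : ∀ {x} → x ∈ W → d ≤ length (filter (adj? G x) W))
                 (deg≤ : ∀ {x} → x ∈ W → length (filter (adj? G x) W) ≤ K * d)
                 (i c : ℕ) {{d≢0 : NonZero d}} {{K≢0 : NonZero K}} where

  open Regular G W W! N d K deg≥ deg≤

  -- For the centre found below, at most `K ^ j * d ^ j` good walks share at least
  -- `d ^ suc j / (2 * c)` rich pairs, so `d / a` is half of the average guaranteed per walk.
  j f a : ℕ
  j = suc i
  f = multBound N i
  a = 4 * c * K ^ j

  Rich : V → End → Set
  Rich x w = ¬ Blocked j x (proj₂ w)

  rich? : ∀ x w → Dec (Rich x w)
  rich? x w = ¬? (blocked? j x (proj₂ w))

  goodWalks : V → List End
  goodWalks z = filter (goodEnd? z) (walks i z)

  richDegree : V → End → ℕ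
  richDegree z w = count (λ x → rich? x w) (nbr z)

  richSum : V → V → ℕ
  richSum x z = ∑ (goodWalks z) λ w → 𝟙 (rich? x w)

  -- Cut off the first step and keep the walks whose rest is good; each other rest belongs to at
  -- most `D` starts. Good rests are needed because only they have ends of bounded multiplicity.
  rich≤ : rich j ≤ ∑ W (λ z → ∑ (nbr z) λ x → richSum x z) + D * nonGood i
  rich≤ = begin
    rich j
      ≡⟨ ∑-cong W (λ {x} _ → ∑-walks-suc i x _) ⟩
    ∑ W (λ x → ∑ (nbr x) λ z → ∑ (walks i z) λ w → 𝟙 (rich? x w))
      ≤⟨ ∑-mono W (λ {x} _ → ∑-mono (nbr x) λ {z} _ → split x z) ⟩
    ∑ W (λ x → ∑ (nbr x) λ z → richSum x z + bads z)
      ≡⟨ trans (∑-cong W λ {x} _ → ∑-+ (nbr x) _ _) (∑-+ W _ _) ⟩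
    ∑ W (λ x → ∑ (nbr x) λ z → richSum x z) + ∑ W (λ x → ∑ (nbr x) bads)
      ≤⟨ +-mono-≤ (≤-reflexive (∑-nbr-swap richSum)) (∑-column bads) ⟩
    ∑ W (λ z → ∑ (nbr z) λ x → richSum x z) + D * nonGood i ∎
    where
    open ≤-Reasoning
    bads : V → ℕ
    bads z = count (λ w → ¬? (goodEnd? z w)) (walks i z)
    term : ∀ x z w → 𝟙 (rich? x w) ≤ 𝟙 (goodEnd? z w) * 𝟙 (rich? x w) + 𝟙 (¬? (goodEnd? z w))
    term x z w with goodEnd? z w
    ... | yes _ = ≤-reflexive (sym (trans (+-identityʳ _) (*-identityˡ _)))
    ... | no _  = 𝟙≤1 (rich? x w)
    split : ∀ x z → ∑ (walks i z) (λ w → 𝟙 (rich? x w)) ≤ richSum x z + bads z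
    split x z = begin
      ∑ (walks i z) (λ w → 𝟙 (rich? x w))
        ≤⟨ ∑-mono (walks i z) (λ {w} _ → term x z w) ⟩
      ∑ (walks i z) (λ w → 𝟙 (goodEnd? z w) * 𝟙 (rich? x w) + 𝟙 (¬? (goodEnd? z w)))
        ≡⟨ trans (∑-+ (walks i z) _ _) (cong (_+ bads z) (sym (∑-filter (goodEnd? z) (walks i z) _))) ⟩
      richSum x z + bads z ∎

  -- By `few`, the rests that are not good cost at most half of the guaranteed rich walks; what
  -- remains is averaged over the second vertex.
  centre : 0 < m → m * d ^ suc j ≤ c * rich j → 2 * c * K * nonGood i ≤ m * d ^ j →
           ∃ λ z → z ∈ W × d ^ suc j ≤ 2 * c * ∑ (nbr z) (λ x → richSum x z)
  centre m>0 heavy few = ∑-average W _ (d ^ suc j) m>0 (+-cancelʳ-≤ (m * d ^ suc j) _ _ (begin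
    m * d ^ suc j + m * d ^ suc j
      ≤⟨ +-mono-≤ heavy heavy ⟩
    c * rich j + c * rich j
      ≤⟨ +-mono-≤ (*-monoʳ-≤ c rich≤) (*-monoʳ-≤ c rich≤) ⟩
    c * (E + D * nonGood i) + c * (E + D * nonGood i)
      ≡⟨ shuffle c E K d (nonGood i) ⟩
    2 * c * E + d * (2 * c * K * nonGood i)
      ≤⟨ +-monoʳ-≤ (2 * c * E) (*-monoʳ-≤ d few) ⟩
    2 * c * E + d * (m * d ^ j)
      ≡⟨ cong₂ _+_ (sym (∑-*ˡ W (2 * c) _)) (swap d m (d ^ j)) ⟩
    ∑ W (λ z → 2 * c * ∑ (nbr z) λ x → richSum x z) + m * d ^ suc j ∎))
    where
    open ≤-Reasoning
    E : ℕ
    E = ∑ W λ z → ∑ (nbr z) λ x → richSum x z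
    shuffle : ∀ c e k d g → c * (e + k * d * g) + c * (e + k * d * g) ≡ 2 * c * e + d * (2 * c * k * g)
    shuffle = solve-∀
    swap : ∀ d m p → d * (m * p) ≡ m * (d * p)
    swap = solve-∀

  module Centre (z : V) (z∈ : z ∈ W) where

    popularWalks : List End
    popularWalks = filter (λ w → d ≤? a * richDegree z w) (goodWalks z)

    length-goodWalks : length (goodWalks z) ≤ K ^ j * d ^ j
    length-goodWalks = ≤-trans (length-filter (goodEnd? z) (walks i z))
      (≤-trans (length-walks≤ i z∈) (≤-reflexive (*-^ K d j)))

    popular-walks : d ^ suc j ≤ 2 * c * ∑ (nbr z) (λ x → richSum x z) → d ^ j ≤ 4 * c * K * length popularWalks
    popular-walks large = *-cancelʳ-≤ _ _ (K ^ j * d) {{m*n≢0 (K ^ j) d {{m^n≢0 K j}}}}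
      (+-cancelʳ-≤ (K ^ j * d ^ j * d) _ _ (begin
        d ^ j * (K ^ j * d) + K ^ j * d ^ j * d
          ≡⟨ double d (d ^ j) (K ^ j) ⟩
        2 * K ^ j * d ^ suc j
          ≤⟨ *-monoʳ-≤ (2 * K ^ j) large ⟩
        2 * K ^ j * (2 * c * ∑ (nbr z) (λ x → richSum x z))
          ≡⟨ trans (regroup (K ^ j) c _) (cong (a *_) (∑-swap (nbr z) (goodWalks z) λ x w → 𝟙 (rich? x w))) ⟩
        a * ∑ (goodWalks z) (richDegree z)
          ≤⟨ popular (goodWalks z) (richDegree z) a D d (λ {w} _ → ≤-trans (count≤length (λ x → rich? x w) (nbr z)) (deg≤ z∈)) ⟩
        length popularWalks * (a * D) + length (goodWalks z) * d
          ≤⟨ +-monoʳ-≤ (length popularWalks * (a * D)) (*-monoˡ-≤ d length-goodWalks) ⟩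
        length popularWalks * (a * D) + K ^ j * d ^ j * d
          ≡⟨ cong (_+ K ^ j * d ^ j * d) (collect (length popularWalks) c (K ^ j) K d) ⟩
        4 * c * K * length popularWalks * (K ^ j * d) + K ^ j * d ^ j * d ∎))
      where
      open ≤-Reasoning
      double : ∀ d p q → p * (q * d) + q * p * d ≡ 2 * q * (d * p)
      double = solve-∀
      regroup : ∀ p c s → 2 * p * (2 * c * s) ≡ 4 * c * p * s
      regroup = solve-∀
      collect : ∀ l c p k d → l * (4 * c * p * (k * d)) ≡ 4 * c * k * l * (p * d)
      collect = solve-∀

    -- A complete bipartite piece of the unblocked relation, between neighbours `Ξ` of the centre
    -- and ends of walks. `∑-B′` says that `B′` is a part of `B` with multiplicities respected, in
    -- the form suited to counting.
    record Rectangle (p : ℕ) (X : List V) (B : List End) : Set where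
      field
        Ξ       : List V
        length-Ξ : length Ξ ≡ p
        Ξ!      : Unique Ξ
        Ξ⊆      : ∀ {ξ} → ξ ∈ Ξ → ξ ∈ X
        B′      : List End
        B′⊆     : ∀ {w} → w ∈ B′ → w ∈ B
        ∑-B′    : ∀ φ → ∑ B′ φ ≤ ∑ B φ
        linked  : ∀ {ξ w} → ξ ∈ Ξ → w ∈ B′ → Rich ξ w
        large   : length B ≤ (2 * a * K) ^ p * length B′

    pick-rich : ∀ X B g → 0 < length B → length X ≤ D →
      (∀ {w} → w ∈ B → d + g ≤ 2 * a * count (λ x → rich? x w) X) →
      ∃ λ x → x ∈ X × length B ≤ 2 * a * K * length (filter (rich? x) B)
    pick-rich X B g B>0 X≤ many = let x , x∈ , share = best in x , x∈ , shrink x share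
      where
      open ≤-Reasoning
      X>0 : ∀ B → 0 < length B → (∀ {w} → w ∈ B → d + g ≤ 2 * a * count (λ x → rich? x w) X) → 0 < length X
      X>0 (w ∷ B) _ many = n≢0⇒n>0 λ eq → <⇒≱ (>-nonZero⁻¹ d) (≤-trans (m≤m+n d _) (≤-trans (many (here refl))
        (≤-trans (*-monoʳ-≤ (2 * a) (≤-trans (count≤length (λ x → rich? x w) X) (≤-reflexive eq)))
                 (≤-reflexive (*-zeroʳ (2 * a))))))
      best : ∃ λ x → x ∈ X × length B * d ≤ 2 * a * length X * count (rich? x) B
      best = pick rich? X B (2 * a) d (X>0 B B>0 many) λ w∈ → ≤-trans (m≤m+n d _) (many w∈)
      shuffle : ∀ a k d l → a * (k * d) * l ≡ a * k * l * d
      shuffle = solve-∀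
      shrink : ∀ x → length B * d ≤ 2 * a * length X * count (rich? x) B →
               length B ≤ 2 * a * K * length (filter (rich? x) B)
      shrink x share = *-cancelʳ-≤ _ _ d (begin
        length B * d                                  ≤⟨ share ⟩
        2 * a * length X * count (rich? x) B          ≤⟨ *-monoˡ-≤ _ (*-monoʳ-≤ (2 * a) X≤) ⟩
        2 * a * (K * d) * count (rich? x) B           ≡⟨ cong (2 * a * (K * d) *_) (count-filter (rich? x) B) ⟨
        2 * a * (K * d) * length (filter (rich? x) B) ≡⟨ shuffle (2 * a) K d _ ⟩
        2 * a * K * length (filter (rich? x) B) * d   ∎)

    other? : ∀ (x : V) → Decidable (_≢ x)
    other? x y = ¬? (y Fin.≟ x)

    drop-one : ∀ {X} → Unique X → ∀ x w →
               count (λ y → rich? y w) X ≤ count (λ y → rich? y w) (filter (other? x) X) + 1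
    drop-one {X} X! x w = begin
      count (λ y → rich? y w) X
        ≤⟨ ∑-mono X (λ {y} _ → term y) ⟩
      ∑ X (λ y → 𝟙 (other? x y) * 𝟙 (rich? y w) + 𝟙 (y Fin.≟ x))
        ≡⟨ trans (∑-+ X _ _) (cong (_+ count (Fin._≟ x) X) (sym (∑-filter (other? x) X _))) ⟩
      count (λ y → rich? y w) (filter (other? x) X) + count (Fin._≟ x) X
        ≤⟨ +-monoʳ-≤ _ (count-≡≤1 X! x) ⟩
      count (λ y → rich? y w) (filter (other? x) X) + 1 ∎
      where
      open ≤-Reasoning
      term : ∀ (y : V) → 𝟙 (rich? y w) ≤ 𝟙 (other? x y) * 𝟙 (rich? y w) + 𝟙 (y Fin.≟ x)
      term y with y Fin.≟ x
      ... | yes _ = 𝟙≤1 (rich? y w)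
      ... | no _  = ≤-reflexive (sym (trans (+-identityʳ _) (*-identityˡ _)))

    still-many : ∀ {X} → Unique X → ∀ p x w → d + 2 * a * suc p ≤ 2 * a * count (λ y → rich? y w) X →
                 d + 2 * a * p ≤ 2 * a * count (λ y → rich? y w) (filter (other? x) X)
    still-many {X} X! p x w many = +-cancelʳ-≤ (2 * a) _ _ (begin
      d + 2 * a * p + 2 * a
        ≡⟨ next d (2 * a) p ⟩
      d + 2 * a * suc p
        ≤⟨ many ⟩
      2 * a * count (λ y → rich? y w) X
        ≤⟨ *-monoʳ-≤ (2 * a) (drop-one X! x w) ⟩
      2 * a * (count (λ y → rich? y w) (filter (other? x) X) + 1)
        ≡⟨ distribute (2 * a) _ ⟩
      2 * a * count (λ y → rich? y w) (filter (other? x) X) + 2 * a ∎)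
      where
      open ≤-Reasoning
      next : ∀ d a p → d + a * p + a ≡ d + a * suc p
      next = solve-∀
      distribute : ∀ a l → a * (l + 1) ≡ a * l + a
      distribute = solve-∀

    rectangle-suc : ∀ {p X B x} → x ∈ X → length B ≤ 2 * a * K * length (filter (rich? x) B) →
                    Rectangle p (filter (other? x) X) (filter (rich? x) B) → Rectangle (suc p) X B
    rectangle-suc {p} {X} {B} {x} x∈ shrink rect = record
      { Ξ        = x ∷ Ξ
      ; length-Ξ = cong suc length-Ξ
      ; Ξ!       = All.¬Any⇒All¬ Ξ (λ x∈Ξ → proj₂ (∈-filter⁻ (other? x) {xs = X} (Ξ⊆ x∈Ξ)) refl) ∷ Ξ!
      ; Ξ⊆       = λ { (here refl) → x∈ ; (there ξ∈) → proj₁ (∈-filter⁻ (other? x) (Ξ⊆ ξ∈)) }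
      ; B′       = B′
      ; B′⊆      = λ w∈ → proj₁ (∈-filter⁻ (rich? x) (B′⊆ w∈))
      ; ∑-B′     = λ φ → ≤-trans (∑-B′ φ) (∑-filter-≤ (rich? x) B φ)
      ; linked   = λ { (here refl) w∈ → proj₂ (∈-filter⁻ (rich? x) {xs = B} (B′⊆ w∈)) ; (there ξ∈) w∈ → linked ξ∈ w∈ }
      ; large    = ≤-trans shrink (≤-trans (*-monoʳ-≤ (2 * a * K) large) (≤-reflexive (sym (*-assoc (2 * a * K) _ _))))
      }
      where open Rectangle rect

    -- Each row keeps a fraction `1 / (2 * a * K)` of the walks and is then deleted from `X`, which
    -- costs every `w` at most one partner; the summand `2 * a * p` pays for `p` deletions.
    rectangle : ∀ p X B → Unique X → 0 < length B → length X ≤ D →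
      (∀ {w} → w ∈ B → d + 2 * a * p ≤ 2 * a * count (λ x → rich? x w) X) → Rectangle p X B
    rectangle zero X B X! B>0 X≤ many = record
      { Ξ = [] ; length-Ξ = refl ; Ξ! = [] ; Ξ⊆ = λ () ; B′ = B ; B′⊆ = id ; ∑-B′ = λ _ → ≤-refl
      ; linked = λ () ; large = ≤-reflexive (sym (*-identityˡ _)) }
    rectangle (suc p) X B X! B>0 X≤ many =
      let x , x∈ , shrink = pick-rich X B (2 * a * suc p) B>0 X≤ many in
      rectangle-suc x∈ shrink (rectangle p (filter (other? x) X) (filter (rich? x) B) (Unique.filter⁺ (other? x) X!)
        (n≢0⇒n>0 λ eq → <⇒≱ B>0 (≤-trans shrink (≤-reflexive (trans (cong (2 * a * K *_) eq) (*-zeroʳ (2 * a * K))))))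
        (≤-trans (length-filter (other? x) X) X≤)
        λ {w} w∈ → still-many X! p x w (many (proj₁ (∈-filter⁻ (rich? x) w∈))))

    module Ends (B : List End) (B⊆ : ∀ {w} → w ∈ B → w ∈ popularWalks)
                (∑-B : ∀ φ → ∑ B φ ≤ ∑ popularWalks φ) (Γ : ℕ) (large : d ^ j ≤ Γ * length B) where

      ∑-B≤ : ∀ φ → ∑ B φ ≤ ∑ (goodWalks z) φ
      ∑-B≤ φ = ≤-trans (∑-B φ) (∑-filter-≤ (λ w → d ≤? a * richDegree z w) (goodWalks z) φ)

      length-B : length B ≤ K ^ j * d ^ j
      length-B = begin
        length B                     ≡⟨ trans (sym (*-identityʳ _)) (sym (∑-const B 1)) ⟩
        ∑ B (λ _ → 1)                ≤⟨ ∑-B≤ _ ⟩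
        ∑ (goodWalks z) (λ _ → 1)    ≡⟨ trans (∑-const (goodWalks z) 1) (*-identityʳ _) ⟩
        length (goodWalks z)         ≤⟨ length-goodWalks ⟩
        K ^ j * d ^ j                ∎
        where open ≤-Reasoning

      ends : List V
      ends = map proj₂ B

      -- If `F` covered the ends, all of `B` would meet it, but by `hits` only `M * (j * D ^ i)`
      -- walks do, fewer than `d ^ j / Γ`.
      inexhaustible : ∀ M → Γ * (M * (j * K ^ i)) < d → ∀ F → length F ≤ M → ∃ λ y → y ∈ ends × y ∉ F
      inexhaustible M d-large F F≤ with Any.any? (λ y → ¬? (y ∈? F)) ends
      ... | yes some = let y , y∈ , y∉ = find some in y , y∈ , y∉
      ... | no none  = contradiction d-large (≤⇒≯ (*-cancelʳ-≤ d _ (d ^ i) {{m^n≢0 d i}} (begin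
        d ^ j                                   ≤⟨ large ⟩
        Γ * length B                            ≡⟨ cong (Γ *_) (trans (sym (*-identityʳ _)) (sym (∑-const B 1))) ⟩
        Γ * ∑ B (λ _ → 1)
          ≤⟨ *-monoʳ-≤ Γ (∑-mono B λ {w} w∈ → ≤-reflexive (sym (𝟙-yes (meets? F w) (here (inside w∈))))) ⟩
        Γ * ∑ B (λ w → 𝟙 (meets? F w))
          ≤⟨ *-monoʳ-≤ Γ (≤-trans (∑-B≤ _) (∑-filter-≤ (goodEnd? z) (walks i z) _)) ⟩
        Γ * count (meets? F) (walks i z)        ≤⟨ *-monoʳ-≤ Γ (≤-trans (hits i F z∈) (*-monoˡ-≤ (j * D ^ i) F≤)) ⟩
        Γ * (M * (j * D ^ i))                   ≡⟨ cong (λ p → Γ * (M * (j * p))) (*-^ K d i) ⟩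
        Γ * (M * (j * (K ^ i * d ^ i)))         ≡⟨ shuffle Γ M j (K ^ i) (d ^ i) ⟩
        Γ * (M * (j * K ^ i)) * d ^ i           ∎)))
        where
        open ≤-Reasoning
        shuffle : ∀ Γ M j p q → Γ * (M * (j * (p * q))) ≡ Γ * (M * (j * p)) * q
        shuffle = solve-∀
        inside : ∀ {w} → w ∈ B → proj₂ w ∈ F
        inside w∈ = decidable-stable (_ ∈? F) λ y∉ → none (lose (∈-map⁺ proj₂ w∈) y∉)

      -- The vertices u at distance r + 1 from the end y on paths of length j + 1
      -- from a neighbour x of z to y: as x and y are unblocked there are many for each
      -- pair, so if all u had few walks to the ends, the triples (x , u , y) would be too few.
      module Fans (e r M₁ M₂ : ℕ) (e+r≡i : e + r ≡ i) where

        toEnds? : ∀ u (F : Vec V M₂) → Decidable (λ w → Unique (u ∷ verts w) → proj₂ w ∈ ends → Any (_∈ Vec.toList F) (verts w))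
        toEnds? u F w = unique? (u ∷ verts w) →-dec ((proj₂ w ∈? ends) →-dec meets? (Vec.toList F) w)

        -- In contrast to `Blocked`, the end is among the vertices that may lie in `F`: when a fan
        -- is used, its end has to be new as well.
        FanBlocked : V → Set
        FanBlocked u = ∃ λ (F : Vec V M₂) →
          All (λ w → Unique (u ∷ verts w) → proj₂ w ∈ ends → Any (_∈ Vec.toList F) (verts w)) (walks r u)

        Fan : V → Set
        Fan u = ∀ F → length F ≤ M₂ → ∃₂ λ ps y → Walk u ps y × length ps ≡ r × y ∈ ends ×
          Unique (u ∷ y ∷ ps) × (∀ {v} → v ∈ y ∷ ps → v ∉ F)

        abstract
          fanBlocked? : Decidable FanBlocked
          fanBlocked? u = anyVec? M₂ λ F → All.all? (toEnds? u F) (walks r u)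

        fan : ∀ {u} → ¬ FanBlocked u → Fan u
        fan {u} ¬blocked F F≤ with Any.any? (λ w → unique? (u ∷ verts w) ×-dec ((proj₂ w ∈? ends) ×-dec
                                         ¬? (meets? (Vec.toList (pad M₂ u F)) w))) (walks r u)
        ... | no none = contradiction (pad M₂ u F , All.tabulate λ {w} w∈ uniq y∈ →
                decidable-stable (meets? _ w) λ avoids → none (lose w∈ (uniq , y∈ , avoids))) ¬blocked
        ... | yes some =
          let (ps , y) , w∈ , uniq , y∈ , avoids = find some
              walk , len = ∈-walks⁻ r w∈
          in ps , y , walk , len , y∈ , uniq , λ v∈ v∈F → avoids (lose v∈ (pad-⊇ F≤ v∈F))

        Before After : V → V → Set
        Before x u = u ∈ map proj₂ (walks e x)
        After u y = Any (λ w → proj₂ w ≡ y × Unique (u ∷ verts w)) (walks r u)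

        abstract
          before? : ∀ x u → Dec (Before x u)
          before? x u = u ∈? map proj₂ (walks e x)

          path? : ∀ u y → Decidable (λ w → proj₂ w ≡ y × Unique (u ∷ verts w))
          path? u y w = (proj₂ w Fin.≟ y) ×-dec unique? (u ∷ verts w)

          after? : ∀ u y → Dec (After u y)
          after? u y = Any.any? (path? u y) (walks r u)

        between? : ∀ x y → Decidable (λ u → Before x u × After u y)
        between? x y u = before? x u ×-dec after? u y

        -- Fewer than `N j` such vertices would form an admissible set to avoid, yet the interior
        -- vertex number `suc e` of the path from `unblocked` is one of them.
        between-many : ∀ {x w} → Rich x w → N j ≤ count (between? x (proj₂ w)) W
        between-many {x} {w} rich = ≮⇒≥ λ few →
          let F = filter (between? x (proj₂ w)) W
              ps , walk , len , uniq , avoids =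
                unblocked rich F (≤-trans (≤-reflexive (count-filter (between? x (proj₂ w)) W)) (<⇒≤ few))
              ps₁ , u , ps₂ , eq , len₁ , len₂ = split-at e ps (trans len (trans (cong suc (sym e+r≡i)) (sym (+-suc e r))))
              walk₁ , walk₂ = Walk-split ps₁ (subst (λ qs → Walk x qs (proj₂ w)) eq walk)
              in₁ = subst (λ l → (ps₁ , u) ∈ walks l x) len₁ (∈-walks⁺ walk₁)
              in₂ = subst (λ l → (ps₂ , proj₂ w) ∈ walks l u) len₂ (∈-walks⁺ walk₂)
              uniq₂ = unique-suffix ps₁ (subst (λ qs → Unique (x ∷ proj₂ w ∷ qs)) eq uniq)
          in avoids (subst (u ∈_) (sym eq) (∈-++⁺ʳ ps₁ (here refl)))
                    (∈-filter⁺ (between? x (proj₂ w)) (Walk-end walk₁) (∈-map⁺ proj₂ in₁ , lose in₂ (refl , uniq₂)))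

        triples : ℕ
        triples = ∑ B λ w → ∑ (nbr z) λ x → count (between? x (proj₂ w)) W

        triples≥ : length B * (d * N j) ≤ a * triples
        triples≥ = ≤-trans (∑-≥-const B (d * N j) each) (≤-reflexive (∑-*ˡ B a _))
          where
          open ≤-Reasoning
          each : ∀ {w} → w ∈ B → d * N j ≤ a * ∑ (nbr z) (λ x → count (between? x (proj₂ w)) W)
          each {w} w∈ = begin
            d * N j
              ≤⟨ *-monoˡ-≤ (N j) (proj₂ (∈-filter⁻ (λ w → d ≤? a * richDegree z w) {xs = goodWalks z} (B⊆ w∈))) ⟩
            a * richDegree z w * N j
              ≡⟨ trans (*-assoc a _ _) (cong (a *_) (trans (*-comm _ (N j)) (sym (∑-*ˡ (nbr z) (N j) _)))) ⟩
            a * ∑ (nbr z) (λ x → N j * 𝟙 (rich? x w))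
              ≤⟨ *-monoʳ-≤ a (∑-mono (nbr z) λ {x} _ → term x) ⟩
            a * ∑ (nbr z) (λ x → count (between? x (proj₂ w)) W) ∎
            where
            term : ∀ x → N j * 𝟙 (rich? x w) ≤ count (between? x (proj₂ w)) W
            term x with rich? x w
            ... | yes rich = ≤-trans (≤-reflexive (*-identityʳ (N j))) (between-many {w = w} rich)
            ... | no _     = ≤-trans (≤-reflexive (*-zeroʳ (N j))) z≤n

        arrivals : V → ℕ
        arrivals u = ∑ B λ w → 𝟙 (after? u (proj₂ w))

        same-end : ∀ y → ∑ B (λ w → 𝟙 (proj₂ w Fin.≟ y)) ≤ f
        same-end y = begin
          ∑ B (λ w → 𝟙 (proj₂ w Fin.≟ y))                                  ≤⟨ ∑-B≤ _ ⟩
          ∑ (goodWalks z) (λ w → 𝟙 (proj₂ w Fin.≟ y))                      ≡⟨ ∑-filter (goodEnd? z) (walks i z) _ ⟩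
          ∑ (walks i z) (λ w → 𝟙 (goodEnd? z w) * 𝟙 (proj₂ w Fin.≟ y))     ≤⟨ ∑-mono (walks i z) (λ {w} _ → term w) ⟩
          mult i z y                                                       ≤⟨ mult≤ i ≤-refl z y ⟩
          f                                                                ∎
          where
          open ≤-Reasoning
          term : ∀ w → 𝟙 (goodEnd? z w) * 𝟙 (proj₂ w Fin.≟ y) ≤ 𝟙 (goodTo? z y w)
          term w with goodEnd? z w | proj₂ w Fin.≟ y
          ... | no _  | no _  = z≤n
          ... | no _  | yes _ = z≤n
          ... | yes _ | no _  = z≤n
          ... | yes g | yes e = ≤-refl

        -- All paths from `u` to the ends are among the walks that meet `F`, and each end belongs to
        -- at most `f` walks of `B`.
        arrivals≤ : ∀ {u} → u ∈ W → FanBlocked u → arrivals u ≤ f * (M₂ * (suc r * D ^ r))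
        arrivals≤ {u} u∈ (F , meets) = begin
          arrivals u
            ≤⟨ ∑-mono B (λ {w} w∈ → ≤-trans (𝟙-mono (after? u (proj₂ w)) (Any.any? (path? u (proj₂ w)) (walks r u)) id)
                 (𝟙-any (path? u (proj₂ w)) (walks r u))) ⟩
          ∑ B (λ w → ∑ (walks r u) λ w′ → 𝟙 (path? u (proj₂ w) w′))
            ≤⟨ ∑-mono B (λ {w} w∈ → ∑-mono (walks r u) λ {w′} w′∈ → 𝟙-≤ (path? u (proj₂ w) w′) λ (eq , uniq) →
                 ≤-reflexive (sym (cong₂ _*_
                   (𝟙-yes (meets? (Vec.toList F) w′) (All.lookup meets w′∈ uniq (subst (_∈ ends) (sym eq) (∈-map⁺ proj₂ w∈))))
                   (𝟙-yes (proj₂ w Fin.≟ proj₂ w′) (sym eq))))) ⟩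
          ∑ B (λ w → ∑ (walks r u) λ w′ → 𝟙 (meets? (Vec.toList F) w′) * 𝟙 (proj₂ w Fin.≟ proj₂ w′))
            ≡⟨ ∑-swap B (walks r u) _ ⟩
          ∑ (walks r u) (λ w′ → ∑ B λ w → 𝟙 (meets? (Vec.toList F) w′) * 𝟙 (proj₂ w Fin.≟ proj₂ w′))
            ≤⟨ ∑-mono (walks r u) (λ {w′} _ → ≤-trans (≤-reflexive (trans (∑-*ˡ B (𝟙 (meets? (Vec.toList F) w′)) _)
                 (*-comm (𝟙 (meets? (Vec.toList F) w′)) _))) (*-monoˡ-≤ (𝟙 (meets? (Vec.toList F) w′)) (same-end (proj₂ w′)))) ⟩
          ∑ (walks r u) (λ w′ → f * 𝟙 (meets? (Vec.toList F) w′))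
            ≡⟨ ∑-*ˡ (walks r u) f _ ⟩
          f * count (meets? (Vec.toList F)) (walks r u)
            ≤⟨ *-monoʳ-≤ f (≤-trans (hits r (Vec.toList F) u∈)
                 (≤-reflexive (cong (_* (suc r * D ^ r)) (Vec.length-toList F)))) ⟩
          f * (M₂ * (suc r * D ^ r)) ∎
          where open ≤-Reasoning

        count-before : ∀ {x} → x ∈ W → count (before? x) W ≤ D ^ suc e
        count-before {x} x∈ = begin
          count (before? x) W              ≡⟨ count-filter (before? x) W ⟨
          length (filter (before? x) W)    ≤⟨ Unique⊆⇒length≤ (Unique.filter⁺ (before? x) W!)
                                                (λ u∈ → proj₂ (∈-filter⁻ (before? x) {xs = W} u∈)) ⟩
          length (map proj₂ (walks e x))   ≡⟨ length-map proj₂ (walks e x) ⟩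
          length (walks e x)               ≤⟨ length-walks≤ e x∈ ⟩
          D ^ suc e                        ∎
          where open ≤-Reasoning

        threshold : ℕ
        threshold = M₁ + f * (M₂ * suc r)

        -- A vertex of `F` may carry all of `B`, which is at most `D ^ j`. Any other `u` is blocked:
        -- at most `D ^ suc e` of these come after a given `x`, each with arrivals of order `D ^ r`,
        -- and `suc e + r` is `j`.
        triples≤ : ∀ F → length F ≤ M₁ → (∀ {u} → u ∈ W → u ∉ F → FanBlocked u) →
                   triples ≤ threshold * (K ^ suc j * d ^ suc j)
        triples≤ F F≤ all-blocked = begin
          triples
            ≡⟨ trans (∑-swap B (nbr z) _) (∑-cong (nbr z) λ {x} _ → ∑-swap B W _) ⟩
          ∑ (nbr z) (λ x → ∑ W λ u → ∑ B λ w → 𝟙 (between? x (proj₂ w) u))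
            ≤⟨ ∑-mono (nbr z) (λ {x} x∈ → each (proj₁ (∈-nbr⁻ x∈))) ⟩
          ∑ (nbr z) (λ _ → D ^ j * M₁ + Y * D ^ suc e)
            ≤⟨ ≤-trans (≤-reflexive (∑-const (nbr z) _)) (*-monoˡ-≤ _ (deg≤ z∈)) ⟩
          D * (D ^ j * M₁ + Y * D ^ suc e)
            ≡⟨ cong (λ p → D * (D ^ j * M₁ + p)) merge ⟩
          D * (D ^ j * M₁ + f * (M₂ * suc r) * D ^ j)
            ≡⟨ collect D (D ^ j) M₁ (f * (M₂ * suc r)) ⟩
          threshold * D ^ suc j
            ≡⟨ cong (threshold *_) (*-^ K d (suc j)) ⟩
          threshold * (K ^ suc j * d ^ suc j) ∎
          where
          open ≤-Reasoning
          Y : ℕ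
          Y = f * (M₂ * (suc r * D ^ r))
          collect : ∀ D p M q → D * (p * M + q * p) ≡ (M + q) * (D * p)
          collect = solve-∀
          gather : ∀ f M r p D q → f * (M * (r * p)) * (D * q) ≡ f * (M * r) * (D * (q * p))
          gather = solve-∀
          merge : Y * D ^ suc e ≡ f * (M₂ * suc r) * D ^ j
          merge = trans (gather f M₂ (suc r) (D ^ r) D (D ^ e))
            (cong (λ p → f * (M₂ * suc r) * (D * p)) (trans (sym (^-distribˡ-+-* D e r)) (cong (D ^_) e+r≡i)))
          inside : count (_∈? F) W ≤ M₁
          inside = ≤-trans (≤-reflexive (sym (count-filter (_∈? F) W)))
            (≤-trans (Unique⊆⇒length≤ (Unique.filter⁺ (_∈? F) W!) λ u∈ → proj₂ (∈-filter⁻ (_∈? F) {xs = W} u∈)) F≤)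
          term : ∀ x {u} → u ∈ W → ∑ B (λ w → 𝟙 (between? x (proj₂ w) u)) ≤ D ^ j * 𝟙 (u ∈? F) + Y * 𝟙 (before? x u)
          term x {u} u∈ with u ∈? F
          ... | yes _ = ≤-trans (≤-trans (∑-≤-const B 1 λ {w} _ → 𝟙≤1 (before? x u ×-dec after? u (proj₂ w)))
                  (≤-trans (≤-reflexive (*-identityʳ _)) (≤-trans length-B (≤-reflexive
                    (trans (sym (*-^ K d j)) (sym (*-identityʳ (D ^ j)))))))) (m≤m+n _ _)
          ... | no u∉ with before? x u
          ...   | no ¬b = ≤-trans (≤-reflexive (∑-zero B λ {w} _ → 𝟙-no (no ¬b ×-dec after? u (proj₂ w)) (¬b ∘ proj₁))) z≤n
          ...   | yes b = ≤-trans (∑-mono B λ {w} _ → 𝟙-mono (yes b ×-dec after? u (proj₂ w)) (after? u (proj₂ w)) proj₂)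
                  (≤-trans (arrivals≤ u∈ (all-blocked u∈ u∉)) (≤-trans (≤-reflexive (sym (*-identityʳ Y))) (m≤n+m _ _)))
          each : ∀ {x} → x ∈ W → ∑ W (λ u → ∑ B λ w → 𝟙 (between? x (proj₂ w) u)) ≤ D ^ j * M₁ + Y * D ^ suc e
          each {x} x∈ = begin
            ∑ W (λ u → ∑ B λ w → 𝟙 (between? x (proj₂ w) u))
              ≤⟨ ∑-mono W (term x) ⟩
            ∑ W (λ u → D ^ j * 𝟙 (u ∈? F) + Y * 𝟙 (before? x u))
              ≡⟨ trans (∑-+ W _ _) (cong₂ _+_ (∑-*ˡ W (D ^ j) _) (∑-*ˡ W Y _)) ⟩
            D ^ j * count (_∈? F) W + Y * count (before? x) W
              ≤⟨ +-mono-≤ (*-monoʳ-≤ (D ^ j) inside) (*-monoʳ-≤ Y (count-before x∈)) ⟩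
            D ^ j * M₁ + Y * D ^ suc e ∎

        -- Both bounds on `triples` carry the same power `d ^ suc j`, so the constant `N j` decides
        -- the comparison.
        fans : Γ * a * threshold * K ^ suc j < N j → ∀ F → length F ≤ M₁ → ∃ λ u → u ∉ F × Fan u
        fans N-large F F≤ with Any.any? (λ u → ¬? (u ∈? F) ×-dec ¬? (fanBlocked? u)) W
        ... | yes some = let u , _ , u∉ , free = find some in u , u∉ , fan free
        ... | no none  = contradiction N-large (≤⇒≯ (*-cancelʳ-≤ _ _ (d ^ suc j) {{m^n≢0 d (suc j)}} (begin
          N j * d ^ suc j
            ≡⟨ regroup (N j) d (d ^ j) ⟩
          d ^ j * (d * N j)
            ≤⟨ *-monoˡ-≤ (d * N j) large ⟩
          Γ * length B * (d * N j)
            ≡⟨ *-assoc Γ _ _ ⟩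
          Γ * (length B * (d * N j))
            ≤⟨ *-monoʳ-≤ Γ (≤-trans triples≥ (*-monoʳ-≤ a (triples≤ F F≤ λ {u} u∈ u∉ →
                 decidable-stable (fanBlocked? u) λ free → none (lose u∈ (u∉ , free))))) ⟩
          Γ * (a * (threshold * (K ^ suc j * d ^ suc j)))
            ≡⟨ flatten Γ a threshold (K ^ suc j) (d ^ suc j) ⟩
          Γ * a * threshold * K ^ suc j * d ^ suc j ∎)))
          where
          open ≤-Reasoning
          regroup : ∀ N d p → N * (d * p) ≡ p * (d * N)
          regroup = solve-∀
          flatten : ∀ Γ a t k p → Γ * (a * (t * (k * p))) ≡ Γ * a * t * k * p
          flatten = solve-∀

-- Paths that avoid bounded sets, and their concatenation

unique-reverse : ∀ {A : Set} (xs : List A) → Unique xs → Unique (reverse xs)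
unique-reverse []       _          = []
unique-reverse (x ∷ xs) (x∉ ∷ xs!) = subst Unique (sym (unfold-reverse x xs))
  (Unique.++⁺ (unique-reverse xs xs!) ([] ∷ []) λ { (v∈ , here refl) → All.lookup x∉ (Any.reverse⁻ v∈) refl })

module Linking {n : ℕ} (G : Graph n) (W : List (Fin n)) (W! : Unique W) where

  open Walks G W W!
  open Stars G W W!

  Link : ℕ → ℕ → V → V → Set
  Link M i x y = ∀ F → length F ≤ M →
    ∃ λ ps → Walk x ps y × length ps ≡ i × Unique (x ∷ y ∷ ps) × (∀ {v} → v ∈ ps → v ∉ F)

  link-weaken : ∀ {M M′ i x y} → M ≤ M′ → Link M′ i x y → Link M i x y
  link-weaken M≤ link F F≤ = link F (≤-trans F≤ M≤)

  link-reverse : ∀ {M i x y} → x ∈ W → Link M i x y → Link M i y x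
  link-reverse x∈ link F F≤ with link F F≤
  ... | ps , walk , len , (x≢y ∷ x∉) ∷ (y∉ ∷ ps!) , avoids =
    reverse ps , Walk-reverse x∈ walk , trans (length-reverse ps) len ,
    ((x≢y ∘ sym) ∷ All.tabulate λ v∈ → All.lookup y∉ (Any.reverse⁻ v∈)) ∷
    (All.tabulate λ v∈ → All.lookup x∉ (Any.reverse⁻ v∈)) ∷ unique-reverse ps ps! ,
    λ v∈ → avoids (Any.reverse⁻ v∈)

  -- The first half of a concatenation: its end is left open and chosen together with the path, both
  -- outside `F`.
  Spread : ℕ → ℕ → V → (V → Set) → Set
  Spread M i x P = ∀ F → length F ≤ M →
    ∃₂ λ ps w → Walk x ps w × length ps ≡ i × P w × Unique (x ∷ w ∷ ps) × (∀ {v} → v ∈ w ∷ ps → v ∉ F)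

  -- The first path avoids `F` and `y`, whence `suc M`; the second avoids `F`, `x` and the `i`
  -- interior vertices of the first, whence `suc (i + M)`.
  link-trans : ∀ {M i i′ x y} → x ≢ y → Spread (suc M) i x (λ w → w ≢ y → Link (suc (i + M)) i′ w y) →
               Link M (i + suc i′) x y
  link-trans {x = x} {y} x≢y spread F F≤
    with ps , w , walk₁ , len₁ , link , (x≢w ∷ x∉ps) ∷ (w∉ps ∷ ps!) , avoids₁ ← spread (y ∷ F) (s≤s F≤)
    with qs , walk₂ , len₂ , (w≢y ∷ w∉qs) ∷ (y∉qs ∷ qs!) , avoids₂ ←
      link (λ w≡y → avoids₁ (here refl) (here w≡y)) (x ∷ (ps ++ F))
        (s≤s (≤-trans (≤-reflexive (length-++ ps)) (+-mono-≤ (≤-reflexive len₁) F≤)))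
    = ps ++ w ∷ qs , Walk-++ walk₁ walk₂ ,
      trans (length-++ ps) (cong₂ (λ a b → a + suc b) len₁ len₂) ,
      (x≢y ∷ All.++⁺ x∉ps (x≢w ∷ All.tabulate λ {v} v∈ x≡v → avoids₂ (subst (_∈ qs) (sym x≡v) v∈) (here refl))) ∷
      All.++⁺ (All.tabulate λ {v} v∈ y≡v → avoids₁ (there v∈) (here (sym y≡v))) ((w≢y ∘ sym) ∷ y∉qs) ∷
      Unique.++⁺ ps! (w∉qs ∷ qs!) (λ { (v∈ps , here refl) → All.lookup w∉ps v∈ps refl
                                      ; (v∈ps , there v∈qs) → avoids₂ v∈qs (there (∈-++⁺ˡ v∈ps)) }) ,
      outside
    where
    outside : ∀ {v} → v ∈ ps ++ w ∷ qs → v ∉ F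
    outside v∈ v∈F with ∈-++⁻ ps v∈
    ... | inj₁ v∈ps         = avoids₁ (there v∈ps) (there v∈F)
    ... | inj₂ (here refl)  = avoids₁ (here refl) (there v∈F)
    ... | inj₂ (there v∈qs) = avoids₂ v∈qs (there (∈-++⁺ʳ ps v∈F))

  star-from-links : ∀ {M i b} as → (∀ {a} → a ∈ as → Link M i b a) →
    ∀ F → length as * i + length F ≤ M →
    ∃ λ us → Star i b as us × Unique (b ∷ us) × (∀ {v} → v ∈ us → v ∉ F)
  star-from-links []       links F F≤ = [] , [] , [] ∷ [] , λ ()
  star-from-links {M} {i} {b} (a ∷ as) links F F≤
    with us , star , b∉us ∷ us! , avoids ←
      star-from-links as (links ∘ there) F (≤-trans (+-monoˡ-≤ (length F) (m≤n+m (length as * i) i)) F≤)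
    with ps , walk , len , (_ ∷ b∉ps) ∷ (_ ∷ ps!) , avoids′ ← links (here refl) (us ++ F)
      (≤-trans (≤-reflexive (trans (length-++ us) (cong (_+ length F) (length-star star))))
               (≤-trans (+-monoˡ-≤ (length F) (m≤n+m (length as * i) i)) F≤))
    = ps ++ us , (walk , len) ∷ star ,
      All.++⁺ b∉ps b∉us ∷ Unique.++⁺ ps! us! (λ (v∈ps , v∈us) → avoids′ v∈ps (∈-++⁺ˡ v∈us)) ,
      λ v∈ → [ (λ v∈ps v∈F → avoids′ v∈ps (∈-++⁺ʳ us v∈F)) , avoids ]′ (∈-++⁻ ps v∈)

  starry-from-links : ∀ {M i} as →
    (∀ F → length F ≤ M → ∃ λ b → b ∉ F × ∀ {a} → a ∈ as → Link (length as * i + M) i b a) → Starry i as M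
  starry-from-links {M} {i} as roots F F≤ =
    let b , b∉F , links = roots F F≤
        us , star , uniq , avoids = star-from-links as links F (+-monoʳ-≤ (length as * i) F≤)
    in b , us , star , uniq , λ { (here refl) → b∉F ; (there v∈) → avoids v∈ }

  Inexhaustible : ℕ → List V → Set
  Inexhaustible X vs = ∀ F → length F ≤ X → ∃ λ v → v ∈ vs × v ∉ F

  long-inexhaustible : ∀ {X vs} → Unique vs → X < length vs → Inexhaustible X vs
  long-inexhaustible {X} {vs} vs! X< F F≤ with Any.any? (λ v → ¬? (v ∈? F)) vs
  ... | yes some = find some
  ... | no none  = contradiction X< (≤⇒≯ (≤-trans
    (Unique⊆⇒length≤ vs! λ {v} v∈ → decidable-stable (v ∈? F) λ v∉ → none (lose v∈ v∉)) F≤))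

  distinct-members : ∀ {X vs} → Inexhaustible X vs → ∀ s → s ≤ X →
    ∃ λ as → length as ≡ s × Unique as × (∀ {v} → v ∈ as → v ∈ vs)
  distinct-members inex zero    _   = [] , refl , [] , λ ()
  distinct-members inex (suc s) s<X =
    let as , len , as! , as⊆ = distinct-members inex s (≤-trans (n≤1+n s) s<X)
        a , a∈ , a∉ = inex as (≤-trans (≤-reflexive len) (≤-trans (n≤1+n s) s<X))
    in a ∷ as , cong suc len , All.¬Any⇒All¬ as a∉ ∷ as! , λ { (here refl) → a∈ ; (there v∈) → as⊆ v∈ }

  module Alternate (C Ξ : List V) (X j : ℕ) (C∞ : Inexhaustible X C) (Ξ∞ : Inexhaustible X Ξ)
                   (CΞ : ∀ {c ξ} → c ∈ C → ξ ∈ Ξ → Link X j c ξ)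
                   (ΞC : ∀ {c ξ} → c ∈ C → ξ ∈ Ξ → Link X j ξ c) where

    -- The side on which a chain of `suc q` links from `C` ends.
    target : ℕ → List V
    target zero          = Ξ
    target (suc zero)    = C
    target (suc (suc q)) = target q

    target∞ : ∀ q → Inexhaustible X (target q)
    target∞ zero          = Ξ∞
    target∞ (suc zero)    = C∞
    target∞ (suc (suc q)) = target∞ q

    target-link : ∀ q {x y} → x ∈ target q → y ∈ target (suc q) → Link X j x y
    target-link zero          x∈ y∈ = ΞC y∈ x∈
    target-link (suc zero)    x∈ y∈ = CΞ x∈ y∈
    target-link (suc (suc q)) x∈ y∈ = target-link q x∈ y∈

    span : ℕ → ℕ
    span zero    = j
    span (suc q) = span q + suc j

    suc-span : ∀ q → suc (span q) ≡ suc q * suc j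
    suc-span zero    = sym (+-identityʳ (suc j))
    suc-span (suc q) = trans (cong (_+ suc j) (suc-span q)) (+-comm (suc q * suc j) (suc j))

    -- A shorter chain leads to a fresh vertex of `target q`, and one more link completes it. Every
    -- recursion adds the end of the longer chain to the avoided set, hence `q`; the last link
    -- avoids all that precedes it, hence `span q`.
    chain : ∀ q M → suc (suc (span q + q + M)) ≤ X → ∀ {c y} → c ∈ C → y ∈ target q → c ≢ y → Link M (span q) c y
    chain zero    M M≤ c∈ y∈ c≢y = link-weaken (≤-trans (m≤n+m M (2 + (j + 0))) M≤) (CΞ c∈ y∈)
    chain (suc q) M M≤ {c} {y} c∈ y∈ c≢y = link-trans c≢y λ F F≤ →
      let w , w∈ , w∉ = target∞ q (c ∷ F) (≤-trans (s≤s F≤) (≤-trans (m≤n+m (2 + M) (span q + suc j + suc q)) (≤-trans (≤-reflexive (room (span q) j q M)) M≤)))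
          ps , walk , len , uniq , avoids =
            chain q (suc M) (≤-trans (≤-trans (m≤n+m _ (suc j)) (≤-reflexive (room′ (span q) j q M))) M≤) c∈ w∈ (λ c≡w → w∉ (here (sym c≡w))) F F≤
      in ps , w , walk , len ,
         (λ _ → link-weaken (≤-trans (≤-trans (m≤m+n (suc (span q + M)) (2 + j + suc q)) (≤-reflexive (room″ (span q) j q M))) M≤) (target-link q w∈ y∈)) ,
         uniq , λ { (here refl) w∈F → w∉ (there w∈F) ; (there v∈) → avoids v∈ }
      where
      room : ∀ a j q M → a + suc j + suc q + (2 + M) ≡ suc (suc (a + suc j + suc q + M))
      room = solve-∀
      room′ : ∀ a j q M → suc j + suc (suc (a + q + suc M)) ≡ suc (suc (a + suc j + suc q + M))
      room′ = solve-∀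
      room″ : ∀ a j q M → suc (a + M) + (2 + j + suc q) ≡ suc (suc (a + suc j + suc q + M))
      room″ = solve-∀

module HeavyStarry {n : ℕ} (G : Graph n) (W : List (Fin n)) (W! : Unique W) (N : ℕ → ℕ) (d K : ℕ)
                   (deg≥ : ∀ {x} → x ∈ W → d ≤ length (filter (adj? G x) W))
                   (deg≤ : ∀ {x} → x ∈ W → length (filter (adj? G x) W) ≤ K * d)
                   (i c κ s M : ℕ) {{d≢0 : NonZero d}} {{K≢0 : NonZero K}} where

  open Regular G W W! N d K deg≥ deg≤
  open Stars G W W!
  open Linking G W W!
  open HeavyCase G W W! N d K deg≥ deg≤ i c

  -- `X` covers what a chain may have to avoid: up to `κ` for each of `span q`, `q` and the fan
  -- path, `s * κ + M` for the other legs and the prescribed set, and `s` for the leaves. `Γ`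
  -- combines the loss of `popular-walks` with that of a rectangle with `suc X` rows; `avoided`
  -- bounds `threshold` uniformly in `r`.
  X Γ avoided : ℕ
  X = s + (3 + (κ + κ + κ + (s * κ + M)))
  Γ = 4 * c * K * (2 * a * K) ^ suc X
  avoided = s + M + f * (suc (s * κ + M) * suc κ)

  rich-link : ∀ {ξ y} → ¬ Blocked j ξ y → Link (N j) j ξ y
  rich-link = unblocked

  module FromCentre (j≤κ : j ≤ κ) (N-large : X + Γ * a * avoided * K ^ suc j < N j)
                    (d-large₁ : 2 * a * suc X ≤ d) (d-large₂ : Γ * (X * (j * K ^ i)) < d)
                    (z : V) (z∈ : z ∈ W) (large-z : d ^ suc j ≤ 2 * c * ∑ (nbr z) (λ x → richSum x z)) where

    open Centre z z∈

    many-popular : d ^ j ≤ 4 * c * K * length popularWalks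
    many-popular = popular-walks large-z

    popular>0 : 0 < length popularWalks
    popular>0 = n≢0⇒n>0 λ eq → <⇒≱ (m^n>0 d j)
      (≤-trans many-popular (≤-reflexive (trans (cong (4 * c * K *_) eq) (*-zeroʳ (4 * c * K)))))

    rect : Rectangle (suc X) (nbr z) popularWalks
    rect = rectangle (suc X) (nbr z) popularWalks (nbr! z) popular>0 (deg≤ z∈) λ {w} w∈ →
      -- Popularity gives `d ≤ a * richDegree z w`; doubling it makes room for the slack
      -- `2 * a * suc X`.
      ≤-trans (+-monoʳ-≤ d d-large₁)
        (≤-trans (≤-trans (≤-reflexive (double d))
          (*-monoʳ-≤ 2 (proj₂ (∈-filter⁻ (λ w → d ≤? a * richDegree z w) {xs = goodWalks z} w∈))))
        (≤-reflexive (sym (*-assoc 2 a _))))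
      where
      double : ∀ d → d + d ≡ 2 * d
      double = solve-∀

    open Rectangle rect

    open Ends B′ B′⊆ ∑-B′ Γ
      (≤-trans many-popular (≤-trans (*-monoʳ-≤ (4 * c * K) large) (≤-reflexive (sym (*-assoc (4 * c * K) _ _)))))

    N≥X : X ≤ N j
    N≥X = ≤-trans (m≤m+n X _) (<⇒≤ N-large)

    ΞC-link : ∀ {y ξ} → y ∈ ends → ξ ∈ Ξ → Link X j ξ y
    ΞC-link {y} {ξ} y∈ ξ∈ =
      let w , w∈ , y≡ = ∈-map⁻ proj₂ y∈ in
      subst (Link X j ξ) (sym y≡) (link-weaken N≥X (rich-link (linked ξ∈ w∈)))

    open Alternate ends Ξ X j (inexhaustible X d-large₂) (long-inexhaustible Ξ! (≤-reflexive (sym length-Ξ)))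
      (λ y∈ ξ∈ → link-reverse (proj₁ (∈-nbr⁻ (Ξ⊆ ξ∈))) (ΞC-link y∈ ξ∈)) ΞC-link

    s≤X : s ≤ X
    s≤X = m≤m+n s _

    s+M≤X : s + M ≤ X
    s+M≤X = +-monoʳ-≤ s (≤-trans (m≤n+m M (3 + (κ + κ + κ + s * κ))) (≤-reflexive (assoc κ (s * κ) M)))
      where
      assoc : ∀ κ p M → 3 + (κ + κ + κ + p) + M ≡ 3 + (κ + κ + κ + (p + M))
      assoc = solve-∀

    enough-room : ∀ q r → span q ≤ κ → r ≤ κ → suc (suc (span q + q + suc (r + (s * κ + M)))) ≤ X
    enough-room q r span≤ r≤ = begin
      suc (suc (span q + q + suc (r + (s * κ + M)))) ≡⟨ shuffle (span q) q r (s * κ + M) ⟩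
      3 + (span q + q + r + (s * κ + M))
        ≤⟨ +-monoʳ-≤ 3 (+-monoˡ-≤ (s * κ + M) (+-mono-≤ (+-mono-≤ span≤ (≤-trans (q≤span q) span≤)) r≤)) ⟩
      3 + (κ + κ + κ + (s * κ + M))                  ≤⟨ m≤n+m _ s ⟩
      X ∎
      where
      open ≤-Reasoning
      shuffle : ∀ a q r M → suc (suc (a + q + suc (r + M))) ≡ 3 + (a + q + r + M)
      shuffle = solve-∀
      q≤span : ∀ q → q ≤ span q
      q≤span zero    = z≤n
      q≤span (suc q) = ≤-trans (s≤s (q≤span q)) (≤-trans (≤-reflexive (+-comm 1 (span q))) (+-monoʳ-≤ (span q) (s≤s z≤n)))

    roots-at-end : ∀ q → κ ≡ span q → ∀ as → length as ≡ s → (∀ {a} → a ∈ as → a ∈ target q) → Starry κ as M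
    roots-at-end q κ≡ as len as⊆ = starry-from-links as λ F F≤ →
      let b , b∈ , b∉ = inexhaustible X d-large₂ (as ++ F)
            (≤-trans (≤-reflexive (length-++ as)) (≤-trans (+-mono-≤ (≤-reflexive len) F≤) s+M≤X))
      in b , (λ b∈F → b∉ (∈-++⁺ʳ as b∈F)) , λ {a′} a∈ →
           subst (λ l → Link (l * κ + M) κ b a′) (sym len) (subst (λ l → Link (s * κ + M) l b a′) (sym κ≡)
             (chain q (s * κ + M)
               (≤-trans (s≤s (s≤s (+-monoʳ-≤ (span q + q) (n≤1+n _)))) (enough-room q 0 (≤-reflexive (sym κ≡)) z≤n))
               b∈ (as⊆ a∈) λ { refl → b∉ (∈-++⁺ˡ a∈) }))

    -- The fan takes `suc r` steps from the root to an end, and the chain takes `suc (span q)` more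
    -- from there to the leaf.
    roots-inside : ∀ q r → κ ≡ r + suc (span q) → r ≤ i → ∀ as → length as ≡ s →
                   (∀ {a} → a ∈ as → a ∈ target q) → Starry κ as M
    roots-inside q r κ≡ r≤i as len as⊆ = starry-from-links as λ F F≤ →
      let b , b∉ , fan = fans (≤-trans (s≤s threshold≤) N-large) (as ++ F)
            (≤-trans (≤-reflexive (length-++ as)) (+-mono-≤ (≤-reflexive len) F≤))
      in b , (λ b∈F → b∉ (∈-++⁺ʳ as b∈F)) , λ {a′} a∈ →
           subst (λ l → Link (l * κ + M) κ b a′) (sym len) (subst (λ l → Link (s * κ + M) l b a′) (sym κ≡)
             (link-trans (λ { refl → b∉ (∈-++⁺ˡ a∈) }) λ F′ F′≤ →
               let ps , y , walk , len′ , y∈ , uniq , avoids = fan F′ F′≤ in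
               ps , y , walk , len′ ,
               (λ y≢a → chain q (suc (r + (s * κ + M))) (enough-room q r span≤κ r≤κ) y∈ (as⊆ a∈) y≢a) , uniq , avoids))
      where
      open Fans (i ∸ r) r (s + M) (suc (s * κ + M)) (m∸n+n≡m r≤i)
      span≤κ : span q ≤ κ
      span≤κ = ≤-trans (n≤1+n _) (≤-trans (m≤n+m (suc (span q)) r) (≤-reflexive (sym κ≡)))
      r≤κ : r ≤ κ
      r≤κ = ≤-trans (m≤m+n r _) (≤-reflexive (sym κ≡))
      threshold≤ : Γ * a * threshold * K ^ suc j ≤ X + Γ * a * avoided * K ^ suc j
      threshold≤ = ≤-trans (*-monoˡ-≤ (K ^ suc j) (*-monoʳ-≤ (Γ * a)
        (+-monoʳ-≤ (s + M) (*-monoʳ-≤ f (*-monoʳ-≤ (suc (s * κ + M)) (s≤s r≤κ)))))) (m≤n+m _ X)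

    ends-at : ∀ q → ∃ λ as → length as ≡ s × Unique as × (∀ {v} → v ∈ as → v ∈ target q)
    ends-at q = distinct-members (target∞ q) s s≤X

    result : ∃ λ as → length as ≡ s × Unique as × Starry κ as M
    result = cases (suc κ / suc j) (suc κ % suc j) (m≡m%n+[m/n]*n (suc κ) (suc j)) (m%n<n (suc κ) (suc j))
      where
      cases : ∀ q r → suc κ ≡ r + q * suc j → r < suc j → ∃ λ as → length as ≡ s × Unique as × Starry κ as M
      cases zero    r       eq r< = contradiction (≤-trans (s≤s (s≤s j≤κ)) (≤-trans (≤-reflexive (cong suc (trans eq (+-identityʳ r)))) r<)) 1+n≰n
      cases (suc q) zero    eq r< =
        let as , len , as! , as⊆ = ends-at q in
        as , len , as! , roots-at-end q (suc-injective (trans eq (sym (suc-span q)))) as len as⊆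
      -- A remainder of `suc r` steps means `r` interior vertices, and `suc r < suc j` gives
      -- `r ≤ i`.
      cases (suc q) (suc r) eq r< =
        let as , len , as! , as⊆ = ends-at q in
        as , len , as! , roots-inside q r (trans (suc-injective eq) (cong (r +_) (sym (suc-span q)))) (≤-pred (≤-pred r<)) as len as⊆

  heavy-starry : j ≤ κ → X + Γ * a * avoided * K ^ suc j < N j →
    2 * a * suc X ≤ d → Γ * (X * (j * K ^ i)) < d →
    0 < m → m * d ^ suc j ≤ c * rich j → 2 * c * K * nonGood i ≤ m * d ^ j →
    ∃ λ as → length as ≡ s × Unique as × Starry κ as M
  heavy-starry j≤κ N-large d-large₁ d-large₂ m>0 heavy few =
    let z , z∈ , large-z = centre m>0 heavy few in
    FromCentre.result j≤κ N-large d-large₁ d-large₂ z z∈ large-z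

-- The dichotomy

-- The lengths are treated in increasing order. The proportion 1 / c i of unblocked walks that is
-- tolerated increases fast enough for the walks containing shorter unblocked ones to be
-- negligible, and N i is large compared with the multiplicity bound f for shorter good paths.
module Constants (K s κ M : ℕ) where

  goodFactor base : ℕ
  goodFactor = suc (∑ (upTo (suc κ)) (goodConst K))
  base = 2 * K * goodFactor

  c : ℕ → ℕ
  c i = base ^ (κ ∸ i)

  a Γ : ℕ → ℕ
  a i = 4 * c i * K ^ suc i

  X : ℕ
  X = s + (3 + (κ + κ + κ + (s * κ + M)))

  Γ i = 4 * c i * K * (2 * a i * K) ^ suc X

  avoided : ℕ → ℕ
  avoided f = s + M + f * (suc (s * κ + M) * suc κ)

  -- `multBound N i` depends on `N` only up to `i` but takes all of `N` as argument; the parallel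
  -- recursion for `f` avoids this circularity.
  N f : ℕ → ℕ
  N zero    = 0
  N (suc i) = suc (X + Γ i * a i * avoided (f i) * K ^ suc (suc i))
  f zero    = 1
  f (suc i) = N (suc i) * (suc i * (f i * f i)) + f i

  f≡multBound : ∀ i → f i ≡ multBound N i
  f≡multBound zero    = refl
  f≡multBound (suc i) = cong (λ g → N (suc i) * (suc i * (g * g)) + g) (f≡multBound i)

  rectangleSize rootSize : ℕ → ℕ
  rectangleSize i = 2 * a i * suc X
  rootSize i = suc (Γ i * (X * (suc i * K ^ i)))

  -- Sums stand in for maxima, so one `minDegree` serves whichever index is the first dense one. The
  -- second summand of `denseFactor` makes density imply `minDegree ≤ d`.
  minDegree lightFactor denseFactor : ℕ
  minDegree = suc (base ^ suc κ + 8 * (s * suc κ * (suc κ * K ^ κ)) +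
                   ∑ (upTo κ) rectangleSize + ∑ (upTo κ) rootSize)
  lightFactor = 8 * multBound N κ * (4 * K ^ suc κ * (8 * multBound N κ) ^ s)
  denseFactor = lightFactor * suc (M * suc (κ * K ^ κ)) + minDegree ^ suc (s * suc κ)

module Dichotomy {n : ℕ} (G : Graph n) (W : List (Fin n)) (W! : Unique W) (d K : ℕ)
                 (deg≥ : ∀ {x} → x ∈ W → d ≤ length (filter (adj? G x) W))
                 (deg≤ : ∀ {x} → x ∈ W → length (filter (adj? G x) W) ≤ K * d)
                 (s κ M : ℕ) {{K≢0 : NonZero K}} (W>0 : 0 < length W)
                 (dense : Constants.denseFactor K s κ M * length W ^ s ≤ d ^ suc (s * suc κ)) where

  open Constants K s κ M
  open Regular G W W! N d K deg≥ deg≤ using (m; rich; nonGood; nonGood≤)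
  open Stars G W W!

  q : ℕ
  q = suc (s * suc κ)

  dense-≤ : ∀ C → C ≤ denseFactor → C * m ^ s ≤ d ^ q
  dense-≤ C C≤ = ≤-trans (*-monoˡ-≤ (m ^ s) C≤) dense

  minDegree≤d : minDegree ≤ d
  minDegree≤d = ≮⇒≥ λ d< → <⇒≱ (^-monoˡ-< q d<) (begin
    minDegree ^ q               ≤⟨ m≤m*n (minDegree ^ q) (m ^ s) {{m^n≢0 m s {{>-nonZero W>0}}}} ⟩
    minDegree ^ q * m ^ s       ≤⟨ dense-≤ (minDegree ^ q) (m≤n+m (minDegree ^ q) (lightFactor * suc (M * suc (κ * K ^ κ)))) ⟩
    d ^ q                       ∎)
    where open ≤-Reasoning

  instance
    d≢0 : NonZero d
    d≢0 = >-nonZero (≤-trans z<s minDegree≤d)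

    base≢0 : NonZero base
    base≢0 = m*n≢0 (2 * K) goodFactor {{m*n≢0 2 K}}

  inner≤d : base ^ suc κ + 8 * (s * suc κ * (suc κ * K ^ κ)) + ∑ (upTo κ) rectangleSize + ∑ (upTo κ) rootSize ≤ d
  inner≤d = ≤-trans (n≤1+n _) minDegree≤d

  base^≤d : base ^ suc κ ≤ d
  base^≤d = ≤-trans (m≤m+n _ _) (≤-trans (m≤m+n _ _) (≤-trans (m≤m+n _ _) inner≤d))

  light≤d : 8 * (s * suc κ * (suc κ * K ^ κ)) ≤ d
  light≤d = ≤-trans (m≤n+m _ (base ^ suc κ)) (≤-trans (m≤m+n _ _) (≤-trans (m≤m+n _ _) inner≤d))

  rectangleSize≤d : ∀ {i} → i < κ → rectangleSize i ≤ d
  rectangleSize≤d i<κ = ≤-trans (∑-member rectangleSize (∈-upTo⁺ i<κ))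
    (≤-trans (m≤n+m _ (base ^ suc κ + 8 * (s * suc κ * (suc κ * K ^ κ)))) (≤-trans (m≤m+n _ _) inner≤d))

  rootSize≤d : ∀ {i} → i < κ → rootSize i ≤ d
  rootSize≤d i<κ = ≤-trans (∑-member rootSize (∈-upTo⁺ i<κ)) (≤-trans (m≤n+m _ _) inner≤d)

  Sparse : ℕ → Set
  Sparse i = c i * rich (suc i) ≤ m * d ^ suc (suc i)

  -- Sparsity at the finer scale `T * goodFactor` compensates for the constant `goodConst K i` in
  -- `nonGood≤`.
  few-bad : ∀ i T → i ≤ κ → T * goodFactor ≤ d → (∀ e → e < i → Sparse e) →
            (∀ e → e < i → T * goodFactor ≤ c e) → T * nonGood i ≤ m * d ^ suc i
  few-bad i T i≤κ T≤d sparse T≤c = *-cancelˡ-≤ goodFactor (begin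
    goodFactor * (T * nonGood i)     ≡⟨ regroup goodFactor T (nonGood i) ⟩
    T * goodFactor * nonGood i
      ≤⟨ nonGood≤ (T * goodFactor) T≤d i (λ e e<i → ≤-trans (*-monoˡ-≤ (rich (suc e)) (T≤c e e<i)) (sparse e e<i)) ⟩
    goodConst K i * (m * d ^ suc i)
      ≤⟨ *-monoˡ-≤ (m * d ^ suc i) (≤-trans (∑-member (goodConst K) (∈-upTo⁺ (s≤s i≤κ))) (n≤1+n _)) ⟩
    goodFactor * (m * d ^ suc i)     ∎)
    where
    open ≤-Reasoning
    regroup : ∀ g T b → g * (T * b) ≡ T * g * b
    regroup = solve-∀

  first-dense : ∀ t → t ≤ κ →
    (∀ e → e < t → Sparse e) ⊎ ∃ λ i → i < κ × ¬ Sparse i × (∀ e → e < i → Sparse e)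
  first-dense zero    _ = inj₁ λ e ()
  first-dense (suc t) t< with first-dense t (≤-trans (n≤1+n t) t<)
  ... | inj₂ found  = inj₂ found
  ... | inj₁ sparse with c t * rich (suc t) ≤? m * d ^ suc (suc t)
  ...   | no ¬sparse = inj₂ (t , t< , ¬sparse , sparse)
  ...   | yes next   = inj₁ λ e e< → case m≤n⇒m<n∨m≡n (≤-pred e<) of λ
          { (inj₁ e<t) → sparse e e<t ; (inj₂ refl) → next }

  Result : Set
  Result = ∃ λ as → length as ≡ s × Unique as × Starry κ as M

  all-sparse : (∀ e → e < κ → Sparse e) → Result
  all-sparse sparse = LightCase.Selection.starry G W W! N d K deg≥ deg≤ κ s M light≤d W>0
    (few-bad κ 2 ≤-refl (≤-trans 2g≤base^ base^≤d) sparse λ e e<κ →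
      ≤-trans (≤-trans 2g≤base (≤-reflexive (sym (*-identityʳ base)))) (^-monoʳ-≤ base (m<n⇒0<n∸m e<κ)))
    (dense-≤ (lightFactor * suc (M * suc (κ * K ^ κ))) (m≤m+n _ (minDegree ^ q)))
    where
    2g≤base : 2 * goodFactor ≤ base
    2g≤base = *-monoˡ-≤ goodFactor (m≤m*n 2 K)
    2g≤base^ : 2 * goodFactor ≤ base ^ suc κ
    2g≤base^ = ≤-trans 2g≤base (m≤m*n base (base ^ κ) {{m^n≢0 base κ}})

  one-dense : ∀ i → i < κ → ¬ Sparse i → (∀ e → e < i → Sparse e) → Result
  one-dense i i<κ ¬sparse sparse = HeavyStarry.heavy-starry G W W! N d K deg≥ deg≤ i (c i) κ s M i<κ
    (≤-reflexive (cong (λ g → suc (X + Γ i * a i * avoided g * K ^ suc (suc i))) (sym (f≡multBound i))))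
    (rectangleSize≤d i<κ) (rootSize≤d i<κ) W>0 (<⇒≤ (≰⇒> ¬sparse))
    (few-bad i (2 * c i * K) (<⇒≤ i<κ)
      (≤-trans (≤-reflexive step) (≤-trans (^-monoʳ-≤ base (s≤s (m∸n≤m κ i))) base^≤d)) sparse
      λ e e<i → ≤-trans (≤-reflexive step) (^-monoʳ-≤ base (∸-monoʳ-< e<i (<⇒≤ i<κ))))
    where
    regroup : ∀ c K g → 2 * c * K * g ≡ 2 * K * g * c
    regroup = solve-∀
    -- The scale `2 * c i * K` that `heavy-starry` demands, times `goodFactor`, is `base * c i`;
    -- this is the origin of `base`, since `c e` is at least as large for every `e < i`.
    step : 2 * c i * K * goodFactor ≡ base ^ suc (κ ∸ i)
    step = regroup (c i) K goodFactor

  starry : Result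
  starry with first-dense κ ≤-refl
  ... | inj₁ sparse                    = all-sparse sparse
  ... | inj₂ (i , i<κ , ¬sparse , sparse) = one-dense i i<κ ¬sparse sparse

-- Copies of subdivisions

module _ {n : ℕ} (G : Graph n) where

  data Chain : Fin n → List (Fin n) → Fin n → Set where
    edge : ∀ {x y} → Adj G x y → Chain x [] y
    _∷_  : ∀ {x z ps y} → Adj G x z → Chain z ps y → Chain x (z ∷ ps) y

  chain-++ : ∀ {x ps z qs y} → Chain x ps z → Chain z qs y → Chain x (ps ++ z ∷ qs) y
  chain-++ (edge xz)   chain′ = xz ∷ chain′
  chain-++ (xp ∷ chain) chain′ = xp ∷ chain-++ chain chain′

  chain-reverse : ∀ {x ps y} → Chain x ps y → Chain y (reverse ps) x
  chain-reverse (edge xy) = edge (adj-sym G xy)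
  chain-reverse {x} {z ∷ ps} {y} (xz ∷ chain) = subst (λ qs → Chain y qs x) (sym (unfold-reverse z ps))
    (chain-++ (chain-reverse chain) (edge (adj-sym G xz)))

  chain-adj : ∀ {k x y} (v : Vec (Fin n) k) → Chain x (Vec.toList v) y → ∀ l →
    Adj G (Vec.lookup (x ∷ (v Vec.∷ʳ y)) (inject₁ l)) (Vec.lookup (x ∷ (v Vec.∷ʳ y)) (suc l))
  chain-adj []      (edge xy)    zero    = xy
  chain-adj (p ∷ v) (xp ∷ chain) zero    = xp
  chain-adj (p ∷ v) (xp ∷ chain) (suc l) = chain-adj v chain l

  -- A copy of the `k`-subdivision of `K s t` as it arises from stars, independent of how
  -- `subdivision` numbers its vertices.
  record Linkage (s t k : ℕ) : Set where
    field
      α         : Fin s → Fin n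
      β         : Fin t → Fin n
      leg       : Fin s → Fin t → List (Fin n)
      leg-chain : ∀ i j → Chain (β j) (leg i j) (α i)
      leg-length : ∀ i j → length (leg i j) ≡ k
      leg!      : ∀ i j → Unique (leg i j)
      α-inj     : ∀ {i i′} → α i ≡ α i′ → i ≡ i′
      β-inj     : ∀ {j j′} → β j ≡ β j′ → j ≡ j′
      α≢β       : ∀ {i j} → α i ≢ β j
      leg∌α     : ∀ {i j i′} → α i′ ∉ leg i j
      leg∌β     : ∀ {i j j′} → β j′ ∉ leg i j
      leg-apart : ∀ {v i j i′ j′} → v ∈ leg i j → v ∈ leg i′ j′ → i ≡ i′ × j ≡ j′

vec-of : ∀ {A : Set} {k} (xs : List A) → length xs ≡ k → ∃ λ (v : Vec A k) → Vec.toList v ≡ xs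
vec-of xs refl = Vec.fromList xs , Vec.toList∘fromList xs

lookup-∈-toList : ∀ {A : Set} {k} (v : Vec A k) l → Vec.lookup v l ∈ Vec.toList v
lookup-∈-toList (x ∷ v) zero    = here refl
lookup-∈-toList (x ∷ v) (suc l) = there (lookup-∈-toList v l)

lookup-injective : ∀ {A : Set} {k} (v : Vec A k) → Unique (Vec.toList v) → ∀ {l l′} → Vec.lookup v l ≡ Vec.lookup v l′ → l ≡ l′
lookup-injective (x ∷ v) _        {zero}  {zero}   eq = refl
lookup-injective (x ∷ v) (x∉ ∷ _) {zero}  {suc l′} eq = contradiction eq (All.lookup x∉ (lookup-∈-toList v l′))
lookup-injective (x ∷ v) (x∉ ∷ _) {suc l} {zero}   eq = contradiction (sym eq) (All.lookup x∉ (lookup-∈-toList v l))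
lookup-injective (x ∷ v) (_ ∷ v!) {suc l} {suc l′} eq = cong suc (lookup-injective v v! eq)

list-lookup-injective : ∀ {A : Set} {xs : List A} → Unique xs → ∀ {i j} → List.lookup xs i ≡ List.lookup xs j → i ≡ j
list-lookup-injective (_ ∷ _)   {zero}  {zero}  eq = refl
list-lookup-injective {xs = _ ∷ xs} (x∉ ∷ _)  {zero}  {suc j} eq = contradiction eq (All.lookup x∉ (∈-lookup j))
list-lookup-injective {xs = _ ∷ xs} (x∉ ∷ _)  {suc i} {zero}  eq = contradiction (sym eq) (All.lookup x∉ (∈-lookup i))
list-lookup-injective (_ ∷ xs!) {suc i} {suc j} eq = cong suc (list-lookup-injective xs! eq)

module Assembly {n : ℕ} (G : Graph n) (W : List (Fin n)) (W! : Unique W) where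

  open Walks G W W!
  open Stars G W W!

  walk-chain : ∀ {x ps y} → Walk x ps y → Chain G x ps y
  walk-chain (edge y∈)   = edge (proj₂ (∈-nbr⁻ y∈))
  walk-chain (z∈ ∷ walk) = proj₂ (∈-nbr⁻ z∈) ∷ walk-chain walk

  star-leg : ∀ {k b as us} → Star k b as us → Fin (length as) → List V
  star-leg (_∷_ {ps} _ star) zero    = ps
  star-leg (_ ∷ star)        (suc i) = star-leg star i

  star-leg-chain : ∀ {k b as us} (star : Star k b as us) i → Chain G b (star-leg star i) (List.lookup as i)
  star-leg-chain ((walk , _) ∷ _) zero    = walk-chain walk
  star-leg-chain (_ ∷ star)       (suc i) = star-leg-chain star i

  star-leg-length : ∀ {k b as us} (star : Star k b as us) i → length (star-leg star i) ≡ k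
  star-leg-length ((_ , len) ∷ _) zero    = len
  star-leg-length (_ ∷ star)      (suc i) = star-leg-length star i

  star-leg-⊆ : ∀ {k b as us v} (star : Star k b as us) i → v ∈ star-leg star i → v ∈ us
  star-leg-⊆ (_ ∷ _)           zero    v∈ = ∈-++⁺ˡ v∈
  star-leg-⊆ (_∷_ {ps} _ star) (suc i) v∈ = ∈-++⁺ʳ ps (star-leg-⊆ star i v∈)

  star-leg! : ∀ {k b as us} (star : Star k b as us) → Unique us → ∀ i → Unique (star-leg star i)
  star-leg! (_∷_ {ps} _ _)    us! zero    = proj₁ (unique-++⁻ ps us!)
  star-leg! (_∷_ {ps} _ star) us! (suc i) = star-leg! star (proj₁ (proj₂ (unique-++⁻ ps us!))) i

  star-leg-apart : ∀ {k b as us v} (star : Star k b as us) → Unique us → ∀ i i′ →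
                   v ∈ star-leg star i → v ∈ star-leg star i′ → i ≡ i′
  star-leg-apart (_ ∷ _)           us! zero    zero     v∈ v∈′ = refl
  star-leg-apart (_∷_ {ps} _ star) us! zero    (suc i′) v∈ v∈′ =
    contradiction (star-leg-⊆ star i′ v∈′) (proj₂ (proj₂ (unique-++⁻ ps us!)) v∈)
  star-leg-apart (_∷_ {ps} _ star) us! (suc i) zero     v∈ v∈′ =
    contradiction (star-leg-⊆ star i v∈) (proj₂ (proj₂ (unique-++⁻ ps us!)) v∈′)
  star-leg-apart (_∷_ {ps} _ star) us! (suc i) (suc i′) v∈ v∈′ =
    cong suc (star-leg-apart star (proj₁ (proj₂ (unique-++⁻ ps us!))) i i′ v∈ v∈′)

  record FreshStar (k : ℕ) (as : List V) (F : List V) : Set where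
    field
      root   : V
      inner  : List V
      star   : Star k root as inner
      inner! : Unique (root ∷ inner)
      fresh  : ∀ {v} → v ∈ root ∷ inner → v ∉ F

  -- The last index lists as and the vertices of the stars.
  data Bundle (k : ℕ) (as : List V) : ℕ → List V → Set where
    []  : Bundle k as 0 as
    _∷_ : ∀ {t F} (S : FreshStar k as F) → Bundle k as t F →
          Bundle k as (suc t) ((FreshStar.root S ∷ FreshStar.inner S) ++ F)

  -- Each star is chosen against all earlier ones. The leaves belong to `F` from the beginning,
  -- since `Starry` alone does not keep a star from passing through them.
  bundle : ∀ {k as M} → Starry k as M → ∀ t → t * suc (length as * k) + length as ≤ M →
           ∃ λ F → Bundle k as t F × length F ≡ t * suc (length as * k) + length as
  bundle starry zero    _  = _ , [] , refl
  bundle {k} {as} starry (suc t) ≤M =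
    let F , B , len = bundle starry t (≤-trans (m≤n+m _ (suc (length as * k))) (≤-trans (≤-reflexive (sym (+-assoc (suc (length as * k)) _ _))) ≤M))
        b , us , star , uniq , fresh = starry F (≤-trans (≤-reflexive len) (≤-trans (m≤n+m _ (suc (length as * k))) (≤-trans (≤-reflexive (sym (+-assoc (suc (length as * k)) _ _))) ≤M)))
    in _ , record { root = b ; inner = us ; star = star ; inner! = uniq ; fresh = fresh } ∷ B ,
       trans (length-++ (b ∷ us)) (trans (cong₂ (λ x y → suc x + y) (length-star star) len)
         (sym (+-assoc (suc (length as * k)) _ _)))

  record StarAt (k : ℕ) (as F : List V) : Set where
    field
      root   : V
      inner  : List V
      star   : Star k root as inner
      inner! : Unique (root ∷ inner)
      inside : ∀ {v} → v ∈ root ∷ inner → v ∈ F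
      fresh  : ∀ {v} → v ∈ root ∷ inner → v ∉ as

  as⊆ : ∀ {k as t F v} → Bundle k as t F → v ∈ as → v ∈ F
  as⊆ []      v∈ = v∈
  as⊆ (S ∷ B) v∈ = ∈-++⁺ʳ (FreshStar.root S ∷ FreshStar.inner S) (as⊆ B v∈)

  at : ∀ {k as t F} → Bundle k as t F → Fin t → StarAt k as F
  at (S ∷ B) zero    = record
    { root = root ; inner = inner ; star = star ; inner! = inner!
    ; inside = ∈-++⁺ˡ ; fresh = λ v∈ v∈as → fresh v∈ (as⊆ B v∈as) }
    where open FreshStar S
  at (S ∷ B) (suc j) = record
    { root = root ; inner = inner ; star = star ; inner! = inner!
    ; inside = ∈-++⁺ʳ (FreshStar.root S ∷ FreshStar.inner S) ∘ inside ; fresh = fresh }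
    where open StarAt (at B j)

  at-apart : ∀ {k as t F v} (B : Bundle k as t F) j j′ →
    v ∈ StarAt.root (at B j) ∷ StarAt.inner (at B j) → v ∈ StarAt.root (at B j′) ∷ StarAt.inner (at B j′) → j ≡ j′
  at-apart (S ∷ B) zero    zero     v∈ v∈′ = refl
  at-apart (S ∷ B) zero    (suc j′) v∈ v∈′ = contradiction (StarAt.inside (at B j′) v∈′) (FreshStar.fresh S v∈)
  at-apart (S ∷ B) (suc j) zero     v∈ v∈′ = contradiction (StarAt.inside (at B j) v∈) (FreshStar.fresh S v∈′)
  at-apart (S ∷ B) (suc j) (suc j′) v∈ v∈′ = cong suc (at-apart B j j′ v∈ v∈′)

  linkage : ∀ {k as M} → Unique as → Starry k as M → ∀ t → t * suc (length as * k) + length as ≤ M →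
            Linkage G (length as) t k
  linkage {k} {as} as! starry t ≤M = record
    { α          = List.lookup as
    ; β          = λ j → root (at B j)
    ; leg        = λ i j → star-leg (star (at B j)) i
    ; leg-chain  = λ i j → star-leg-chain (star (at B j)) i
    ; leg-length = λ i j → star-leg-length (star (at B j)) i
    ; leg!       = λ i j → star-leg! (star (at B j)) (us! j) i
    ; α-inj      = list-lookup-injective as!
    ; β-inj      = λ {j} {j′} eq → at-apart B j j′ (here refl) (here eq)
    ; α≢β        = λ {i} {j} eq → fresh (at B j) (here eq) (∈-lookup i)
    ; leg∌α      = λ {i} {j} {i′} α∈ → fresh (at B j) (there (star-leg-⊆ (star (at B j)) i α∈)) (∈-lookup i′)
    ; leg∌β      = λ {i} {j} {j′} β∈ → root∉ i j j′ β∈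
    ; leg-apart  = λ {v} {i} {j} {i′} {j′} v∈ v∈′ → apart i j i′ j′ v∈ v∈′
    }
    where
    open StarAt
    B : Bundle k as t _
    B = proj₁ (proj₂ (bundle starry t ≤M))
    us! : ∀ j → Unique (inner (at B j))
    us! j with inner! (at B j)
    ... | _ ∷ uniq = uniq
    root∉ : ∀ i j j′ → root (at B j′) ∉ star-leg (star (at B j)) i
    root∉ i j j′ β∈ with at-apart B j j′ (there (star-leg-⊆ (star (at B j)) i β∈)) (here refl) | inner! (at B j)
    ... | refl | b∉ ∷ _ = All.lookup b∉ (star-leg-⊆ (star (at B j)) i β∈) refl
    apart : ∀ i j i′ j′ {v} → v ∈ star-leg (star (at B j)) i → v ∈ star-leg (star (at B j′)) i′ → i ≡ i′ × j ≡ j′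
    apart i j i′ j′ v∈ v∈′
      with at-apart B j j′ (there (star-leg-⊆ (star (at B j)) i v∈)) (there (star-leg-⊆ (star (at B j′)) i′ v∈′))
    ... | refl = star-leg-apart (star (at B j)) (us! j) i i′ v∈ v∈′ , refl

-- Subdividing `H` along a placement in `K s t` serves `K s t` itself and all bipartite graphs at
-- once, without comparing two subdivisions.
module Embedding {n h : ℕ} (G : Graph n) (H : Graph h) {s t k : ℕ} (L : Linkage G s t k)
                 (σ : Fin h → Fin s ⊎ Fin t) (σ-inj : ∀ {u v} → σ u ≡ σ v → u ≡ v)
                 (σ-opp : ∀ {u v} → Adj H u v → Opposite (σ u) (σ v)) where

  open Linkage L

  place : Fin s ⊎ Fin t → Fin n
  place = [ α , β ]′

  place-inj : ∀ x y → place x ≡ place y → x ≡ y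
  place-inj (inj₁ i) (inj₁ i′) eq = cong inj₁ (α-inj eq)
  place-inj (inj₁ i) (inj₂ j)  eq = contradiction eq α≢β
  place-inj (inj₂ j) (inj₁ i)  eq = contradiction (sym eq) α≢β
  place-inj (inj₂ j) (inj₂ j′) eq = cong inj₂ (β-inj eq)

  -- Legs are stored from `β` to `α`, while an edge of `H` may point either way.
  edgePath : ∀ x y → Opposite x y → List (Fin n)
  edgePath (inj₁ i) (inj₂ j) _ = reverse (leg i j)
  edgePath (inj₂ j) (inj₁ i) _ = leg i j

  edgePath-length : ∀ x y opp → length (edgePath x y opp) ≡ k
  edgePath-length (inj₁ i) (inj₂ j) _ = trans (length-reverse (leg i j)) (leg-length i j)
  edgePath-length (inj₂ j) (inj₁ i) _ = leg-length i j

  edgePath-chain : ∀ x y opp → Chain G (place x) (edgePath x y opp) (place y)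
  edgePath-chain (inj₁ i) (inj₂ j) _ = chain-reverse G (leg-chain i j)
  edgePath-chain (inj₂ j) (inj₁ i) _ = leg-chain i j

  edgePath! : ∀ x y opp → Unique (edgePath x y opp)
  edgePath! (inj₁ i) (inj₂ j) _ = unique-reverse (leg i j) (leg! i j)
  edgePath! (inj₂ j) (inj₁ i) _ = leg! i j

  edgePath∌place : ∀ x y opp z → place z ∉ edgePath x y opp
  edgePath∌place (inj₁ i) (inj₂ j) _ (inj₁ i′) v∈ = leg∌α (Any.reverse⁻ v∈)
  edgePath∌place (inj₁ i) (inj₂ j) _ (inj₂ j′) v∈ = leg∌β (Any.reverse⁻ v∈)
  edgePath∌place (inj₂ j) (inj₁ i) _ (inj₁ i′) v∈ = leg∌α v∈
  edgePath∌place (inj₂ j) (inj₁ i) _ (inj₂ j′) v∈ = leg∌β v∈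

  edgePath-apart : ∀ x y opp x′ y′ opp′ {v} → v ∈ edgePath x y opp → v ∈ edgePath x′ y′ opp′ →
                   (x ≡ x′ × y ≡ y′) ⊎ (x ≡ y′ × y ≡ x′)
  edgePath-apart (inj₁ i) (inj₂ j) _ (inj₁ i′) (inj₂ j′) _ v∈ v∈′
    with refl , refl ← leg-apart (Any.reverse⁻ v∈) (Any.reverse⁻ v∈′) = inj₁ (refl , refl)
  edgePath-apart (inj₁ i) (inj₂ j) _ (inj₂ j′) (inj₁ i′) _ v∈ v∈′
    with refl , refl ← leg-apart (Any.reverse⁻ v∈) v∈′ = inj₂ (refl , refl)
  edgePath-apart (inj₂ j) (inj₁ i) _ (inj₁ i′) (inj₂ j′) _ v∈ v∈′
    with refl , refl ← leg-apart v∈ (Any.reverse⁻ v∈′) = inj₂ (refl , refl)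
  edgePath-apart (inj₂ j) (inj₁ i) _ (inj₂ j′) (inj₁ i′) _ v∈ v∈′
    with refl , refl ← leg-apart v∈ v∈′ = inj₁ (refl , refl)

  start end : Fin (#edges H) → Fin h
  start e = proj₁ (List.lookup (edges H) e)
  end   e = proj₂ (List.lookup (edges H) e)

  isEdge : ∀ e → IsEdge H (start e , end e)
  isEdge e = proj₂ (∈-filter⁻ (isEdge? H) {xs = cartesianProduct (allFin h) (allFin h)} (∈-lookup e))

  edges! : Unique (edges H)
  edges! = Unique.filter⁺ (isEdge? H) (Unique.cartesianProduct⁺ (Unique.allFin⁺ h) (Unique.allFin⁺ h))

  pathOf : Fin (#edges H) → List (Fin n)
  pathOf e = edgePath (σ (start e)) (σ (end e)) (σ-opp (proj₂ (isEdge e)))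

  abstract
    vecAt : ∀ e → ∃ λ (v : Vec (Fin n) k) → Vec.toList v ≡ pathOf e
    vecAt e = vec-of (pathOf e) (edgePath-length (σ (start e)) (σ (end e)) _)

  same-edge : ∀ {e e′ v} → v ∈ pathOf e → v ∈ pathOf e′ → e ≡ e′
  same-edge {e} {e′} v∈ v∈′
    with edgePath-apart (σ (start e)) (σ (end e)) _ (σ (start e′)) (σ (end e′)) _ v∈ v∈′
  ... | inj₁ (p , q) = list-lookup-injective edges! (cong₂ _,_ (σ-inj p) (σ-inj q))
  -- Every edge is listed with its smaller end first, so two listed edges cannot be reversals of
  -- each other.
  ... | inj₂ (p , q) = contradiction
    (subst₂ (λ x y → toℕ x < toℕ y) (σ-inj p) (σ-inj q) (proj₁ (isEdge e))) (<-asym (proj₁ (isEdge e′)))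

  inner : Fin (#edges H) × Fin k → Fin n
  inner (e , l) = Vec.lookup (proj₁ (vecAt e)) l

  inner-∈ : ∀ e l → inner (e , l) ∈ pathOf e
  inner-∈ e l = subst (inner (e , l) ∈_) (proj₂ (vecAt e)) (lookup-∈-toList (proj₁ (vecAt e)) l)

  inner-inj : ∀ e l e′ l′ → inner (e , l) ≡ inner (e′ , l′) → (e , l) ≡ (e′ , l′)
  inner-inj e l e′ l′ eq
    with refl ← same-edge {e} {e′} (inner-∈ e l) (subst (_∈ pathOf e′) (sym eq) (inner-∈ e′ l′)) =
    cong (e ,_) (lookup-injective (proj₁ (vecAt e))
      (subst Unique (sym (proj₂ (vecAt e))) (edgePath! (σ (start e)) (σ (end e)) _)) eq)

  locate : Fin h ⊎ Fin (#edges H * k) → Fin n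
  locate (inj₁ v) = place (σ v)
  locate (inj₂ p) = inner (remQuot k p)

  embed : Fin (h + #edges H * k) → Fin n
  embed x = locate (splitAt h x)

  embed-branch : ∀ v → embed (branch H k v) ≡ place (σ v)
  embed-branch v = cong locate (Fin.splitAt-↑ˡ h v (#edges H * k))

  embed-internal : ∀ e l → embed (internal H k e l) ≡ inner (e , l)
  embed-internal e l = trans (cong locate (Fin.splitAt-↑ʳ h _ (combine e l)))
    (cong inner (Fin.remQuot-combine e l))

  inner≢place : ∀ p v → inner (remQuot k p) ≢ place (σ v)
  inner≢place p v eq =
    let e , l = remQuot {#edges H} k p in
    edgePath∌place (σ (start e)) (σ (end e)) _ (σ v) (subst (_∈ pathOf e) eq (inner-∈ e l))

  embed-inj : Injective _≡_ _≡_ embed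
  embed-inj {x} {y} eq with splitAt h x in eqx | splitAt h y in eqy
  ... | inj₁ u | inj₁ v = trans (sym (Fin.splitAt⁻¹-↑ˡ eqx))
                            (trans (cong (λ w → w ↑ˡ (#edges H * k)) (σ-inj (place-inj (σ u) (σ v) eq))) (Fin.splitAt⁻¹-↑ˡ eqy))
  ... | inj₁ u | inj₂ p = contradiction (sym eq) (inner≢place p u)
  ... | inj₂ p | inj₁ v = contradiction eq (inner≢place p v)
  ... | inj₂ p | inj₂ q = trans (sym (Fin.splitAt⁻¹-↑ʳ eqx)) (trans (cong (h ↑ʳ_) p≡q) (Fin.splitAt⁻¹-↑ʳ eqy))
    where
    p≡q : p ≡ q
    p≡q = trans (sym (Fin.combine-remQuot {#edges H} k p))
      (trans (cong (uncurry combine) (inner-inj _ _ _ _ eq)) (Fin.combine-remQuot {#edges H} k q))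

  embed-path : ∀ e → Vec.map embed (path H k e) ≡ place (σ (start e)) ∷ (proj₁ (vecAt e) Vec.∷ʳ place (σ (end e)))
  embed-path e = cong₂ _∷_ (embed-branch (start e)) (trans (Vec.map-∷ʳ embed (branch H k (end e)) _)
    (cong₂ Vec._∷ʳ_ (trans (sym (Vec.tabulate-∘ embed (internal H k e)))
      (trans (Vec.tabulate-cong (embed-internal e)) (Vec.tabulate∘lookup (proj₁ (vecAt e))))) (embed-branch (end e))))

  embed-step : ∀ {x y} → Step H k x y → Adj G (embed x) (embed y)
  embed-step (e , l , refl , refl) = subst₂ (Adj G) (sym (position (inject₁ l))) (sym (position (suc l)))
    (chain-adj G (proj₁ (vecAt e)) (subst (λ ps → Chain G (place (σ (start e))) ps (place (σ (end e)))) (sym (proj₂ (vecAt e)))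
      (edgePath-chain (σ (start e)) (σ (end e)) _)) l)
    where
    position : ∀ l → embed (Vec.lookup (path H k e) l) ≡
                     Vec.lookup (place (σ (start e)) ∷ (proj₁ (vecAt e) Vec.∷ʳ place (σ (end e)))) l
    position l = trans (sym (Vec.lookup-map l embed (path H k e))) (cong (λ v → Vec.lookup v l) (embed-path e))

  contains : subdivision k H ⊑ G
  contains = embed , embed-inj , λ { x y (inj₁ step) → embed-step step ; x y (inj₂ step) → adj-sym G (embed-step step) }

-- Almost regular subgraphs

module Regularisation {n : ℕ} (G : Graph n) where

  V : Set
  V = Fin n

  between : List V → List V → ℕ
  between X Y = ∑ X λ x → count (adj? G x) Y

  degreeSum : List V → ℕ
  degreeSum U = between U U

  between-sym : ∀ X Y → between X Y ≡ between Y X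
  between-sym X Y = trans (∑-swap X Y _)
    (∑-cong Y λ {y} _ → ∑-cong X λ {x} _ → 𝟙-cong (adj? G x y) (adj? G y x) (adj-sym G) (adj-sym G))

  ∑-partition : {P : V → Set} (P? : Decidable P) → ∀ U (f : V → ℕ) →
                ∑ U f ≡ ∑ (filter P? U) f + ∑ (filter (¬? ∘ P?) U) f
  ∑-partition P? []      f = refl
  ∑-partition P? (x ∷ U) f with P? x
  ... | yes _ = trans (cong (f x +_) (∑-partition P? U f)) (sym (+-assoc (f x) _ _))
  ... | no _  = trans (cong (f x +_) (∑-partition P? U f)) (swap (f x) (∑ (filter P? U) f) (∑ (filter (¬? ∘ P?) U) f))
    where
    swap : ∀ a b c → a + (b + c) ≡ b + (a + c)
    swap = solve-∀

  -- Edges between the deleted part and the rest are seen from both sides, hence the factor 2.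
  deletion : {P : V → Set} (P? : Decidable P) → ∀ U →
             degreeSum U ≤ 2 * between (filter P? U) U + degreeSum (filter (¬? ∘ P?) U)
  deletion P? U = begin
    between U U
      ≡⟨ ∑-partition P? U _ ⟩
    between A U + between B U
      ≡⟨ cong (_+_ (between A U)) (trans (∑-cong B λ {x} _ → ∑-partition P? U _) (∑-+ B _ _)) ⟩
    between A U + (between B A + between B B)
      ≡⟨ cong (λ e → between A U + (e + between B B)) (between-sym B A) ⟩
    between A U + (between A B + between B B)
      ≤⟨ +-monoʳ-≤ (between A U) (+-monoˡ-≤ (between B B) (∑-mono A λ {x} _ → ∑-filter-≤ (¬? ∘ P?) U _)) ⟩
    between A U + (between A U + between B B)
      ≡⟨ double (between A U) (between B B) ⟩
    2 * between A U + between B B ∎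
    where
    open ≤-Reasoning
    A B : List V
    A = filter P? U
    B = filter (¬? ∘ P?) U
    double : ∀ a b → a + (a + b) ≡ 2 * a + b
    double = solve-∀

  MinDegree : ℕ → List V → Set
  MinDegree d W = ∀ {x} → x ∈ W → d ≤ count (adj? G x) W

  -- Deleting a vertex of degree below `d` lowers the degree sum by at most `2 * d`, so the density
  -- hypothesis persists; it fails for the empty list, so the process stops earlier. `l` is the
  -- recursion measure.
  prune : ∀ d l U → length U ≤ l → Unique U → 2 * d * length U < degreeSum U →
          ∃ λ W → Unique W × (∀ {x} → x ∈ W → x ∈ U) × 0 < length W × MinDegree d W
  prune d l       []      _  _  ()
  prune d (suc l) U@(_ ∷ _) U≤ U! dense with Any.any? (λ x → count (adj? G x) U <? d) U
  ... | no none  = U , U! , id , z<s , λ x∈ → ≮⇒≥ λ low → none (lose x∈ low)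
  ... | yes some =
    let x , x∈ , low = find some
        other = λ y → ¬? (y Fin.≟ x)
        U₁ = filter other U
        shorter : length U₁ < length U
        shorter = filter-notAll other U (lose x∈ λ ¬eq → ¬eq refl)
        W , W! , W⊆ , W>0 , deg = prune d l U₁ (≤-pred (≤-trans shorter U≤)) (Unique.filter⁺ other U!)
          (+-cancelˡ-< (2 * d) _ _ (<-≤-trans (≤-<-trans
             (≤-trans (≤-reflexive (sym (*-suc (2 * d) (length U₁)))) (*-monoʳ-≤ (2 * d) shorter)) dense)
             (≤-trans (deletion (λ y → y Fin.≟ x) U) (+-monoˡ-≤ (degreeSum U₁) (*-monoʳ-≤ 2 (≤-trans (one x) (<⇒≤ low)))))))
    in W , W! , (λ x∈ → proj₁ (∈-filter⁻ other (W⊆ x∈))) , W>0 , deg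
    where
    one : ∀ x → between (filter (λ y → y Fin.≟ x) U) U ≤ count (adj? G x) U
    one x = begin
      between (filter (λ y → y Fin.≟ x) U) U
        ≡⟨ ∑-filter (λ y → y Fin.≟ x) U _ ⟩
      ∑ U (λ y → 𝟙 (y Fin.≟ x) * count (adj? G y) U)
        ≤⟨ ∑-mono U (λ {y} _ → term y) ⟩
      ∑ U (λ y → count (adj? G x) U * 𝟙 (y Fin.≟ x))
        ≡⟨ ∑-*ˡ U (count (adj? G x) U) _ ⟩
      count (adj? G x) U * count (λ y → y Fin.≟ x) U
        ≤⟨ *-monoʳ-≤ (count (adj? G x) U) (count-≡≤1 U! x) ⟩
      count (adj? G x) U * 1
        ≡⟨ *-identityʳ _ ⟩
      count (adj? G x) U ∎
      where
      open ≤-Reasoning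
      term : ∀ y → 𝟙 (y Fin.≟ x) * count (adj? G y) U ≤ count (adj? G x) U * 𝟙 (y Fin.≟ x)
      term y with y Fin.≟ x
      ... | yes refl = ≤-reflexive (*-comm 1 (count (adj? G x) U))
      ... | no _     = z≤n

  -- Cut `L` into `suc j` consecutive chunks and keep the heaviest.
  heavy-chunk : ∀ (w : V → ℕ) b j L → Unique L → length L ≤ suc j * b →
    ∃ λ B → Unique B × (∀ {x} → x ∈ B → x ∈ L) × length B ≤ b × ∑ L w ≤ suc j * ∑ B w
  heavy-chunk w b zero    L L! L≤ = L , L! , id , ≤-trans L≤ (≤-reflexive (*-identityˡ b)) , ≤-reflexive (sym (*-identityˡ _))
  heavy-chunk w b (suc j) L L! L≤ = choose (heavy-chunk w b j (drop b L) (Unique.drop⁺ b L!) rest≤)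
    where
    rest≤ : length (drop b L) ≤ suc j * b
    rest≤ = ≤-trans (≤-reflexive (length-drop b L)) (≤-trans (∸-monoˡ-≤ b L≤) (≤-reflexive (m+n∸m≡n b (suc j * b))))
    ⊆take : ∀ {x} → x ∈ take b L → x ∈ L
    ⊆take x∈ = subst (_ ∈_) (take++drop≡id b L) (∈-++⁺ˡ x∈)
    ⊆drop : ∀ {x} → x ∈ drop b L → x ∈ L
    ⊆drop x∈ = subst (_ ∈_) (take++drop≡id b L) (∈-++⁺ʳ (take b L) x∈)
    total : ∑ L w ≡ ∑ (take b L) w + ∑ (drop b L) w
    total = trans (cong (λ l → ∑ l w) (sym (take++drop≡id b L))) (∑-++ (take b L) (drop b L) w)
    choose : (∃ λ B → Unique B × (∀ {x} → x ∈ B → x ∈ drop b L) × length B ≤ b × ∑ (drop b L) w ≤ suc j * ∑ B w) →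
             ∃ λ B → Unique B × (∀ {x} → x ∈ B → x ∈ L) × length B ≤ b × ∑ L w ≤ suc (suc j) * ∑ B w
    choose (B , B! , B⊆ , B≤ , share) with ≤-total (∑ (take b L) w) (∑ B w)
    ... | inj₁ le = B , B! , (λ x∈ → ⊆drop (B⊆ x∈)) , B≤ , ≤-trans (≤-reflexive total) (+-mono-≤ le share)
    ... | inj₂ ge = take b L , Unique.take⁺ b L! , ⊆take , ≤-trans (≤-reflexive (length-take b L)) (m⊓n≤m b _) ,
      ≤-trans (≤-reflexive total) (+-monoʳ-≤ _ (≤-trans share (*-monoʳ-≤ (suc j) ge)))

module RegularSubset (q s : ℕ) {{q≢0 : NonZero q}} {{s≢0 : NonZero s}} (C₁ : ℕ) where

  -- `K₀` is the product of the losses `4 ^ q` and `3 ^ p` in `high-share`. `R` arises from degrees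
  -- at most `K₀ * S / u` and `S ≤ 10 * u * d`. The summands of `C` serve, in this order, the
  -- conclusion `large`, the bound `5 * u ≤ S`, and `K₀ ≤ u`.
  p K₀ R C : ℕ
  p = q + s
  K₀ = 4 ^ q * 3 ^ p
  R = 10 * K₀
  C = 10 ^ q * C₁ + 5 ^ q + (K₀ * K₀) ^ q

  instance
    K₀≢0 : NonZero K₀
    K₀≢0 = m*n≢0 (4 ^ q) (3 ^ p) {{m^n≢0 4 q}} {{m^n≢0 3 p}}

  3<K₀ : 3 < K₀
  3<K₀ = ≤-trans (^-monoʳ-≤ 4 (>-nonZero⁻¹ q)) (m≤m*n (4 ^ q) (3 ^ p) {{m^n≢0 3 p}})

  C≥₁ : 10 ^ q * C₁ ≤ C
  C≥₁ = ≤-trans (m≤m+n _ _) (m≤m+n _ _)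

  C≥₅ : 5 ^ q ≤ C
  C≥₅ = ≤-trans (m≤n+m _ (10 ^ q * C₁)) (m≤m+n _ _)

  C≥₀ : (K₀ * K₀) ^ q ≤ C
  C≥₀ = m≤n+m _ _

  ^-cancelˡ-< : ∀ a b → a ^ q < b ^ q → a < b
  ^-cancelˡ-< a b lt = ≰⇒> λ b≤a → <⇒≱ lt (^-monoˡ-≤ q b≤a)

  module _ {n : ℕ} (G : Graph n) where

    open Regularisation G

    record AlmostRegular : Set where
      field
        W    : List V
        W!   : Unique W
        W>0  : 0 < length W
        d    : ℕ
        deg≥ : ∀ {x} → x ∈ W → d ≤ length (filter (adj? G x) W)
        deg≤ : ∀ {x} → x ∈ W → length (filter (adj? G x) W) ≤ R * d
        large : C₁ * length W ^ s ≤ d ^ q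

    Sparse : List V → Set
    Sparse U = degreeSum U ^ q ≤ C * length U ^ p

    module Minimal (U : List V) (U! : Unique U) (dense : C * length U ^ p < degreeSum U ^ q)
                   (smaller : ∀ U′ → Unique U′ → length U′ < length U → Sparse U′) where

      u S : ℕ
      u = length U
      S = degreeSum U

      S≤ : S ≤ u * u
      S≤ = ∑-≤-const U u λ {x} _ → count≤length (adj? G x) U

      u>0 : 0 < u
      u>0 = n≢0⇒n>0 λ eq → <⇒≱ dense (≤-trans (≤-reflexive (cong (_^ q)
        (n≤0⇒n≡0 (≤-trans S≤ (≤-reflexive (cong (λ l → l * l) eq)))))) (≤-trans (≤-reflexive (zero-pow q)) z≤n))
        where
        zero-pow : ∀ q {{_ : NonZero q}} → 0 ^ q ≡ 0
        zero-pow (suc q) = refl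

      instance
        u≢0 : NonZero u
        u≢0 = >-nonZero u>0

      u≥K₀ : K₀ ≤ u
      u≥K₀ = ≮⇒≥ λ u< → <⇒≱ dense (begin
        S ^ q             ≤⟨ ^-monoˡ-≤ q (≤-trans S≤ (*-mono-≤ (<⇒≤ u<) (<⇒≤ u<))) ⟩
        (K₀ * K₀) ^ q     ≤⟨ C≥₀ ⟩
        C                 ≤⟨ m≤m*n C (u ^ p) {{m^n≢0 u p}} ⟩
        C * u ^ p         ∎)
        where open ≤-Reasoning

      5u≤S : 5 * u ≤ S
      5u≤S = <⇒≤ (^-cancelˡ-< (5 * u) S (≤-<-trans (begin
        (5 * u) ^ q       ≡⟨ *-^ 5 u q ⟩
        5 ^ q * u ^ q     ≤⟨ *-mono-≤ C≥₅ (^-monoʳ-≤ u (m≤m+n q s)) ⟩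
        C * u ^ p         ∎) dense))
        where open ≤-Reasoning

      S>0 : 0 < S
      S>0 = ≤-trans u>0 (≤-trans (m≤n*m u 5) 5u≤S)

      high? : Decidable (λ x → K₀ * S < count (adj? G x) U * u)
      high? x = K₀ * S <? count (adj? G x) U * u

      A L : List V
      A = filter high? U
      L = filter (¬? ∘ high?) U

      -- Markov's inequality for the degrees.
      few-high : length A * K₀ ≤ u
      few-high = *-cancelʳ-≤ _ _ S {{>-nonZero S>0}} (begin
        length A * K₀ * S                         ≡⟨ *-assoc (length A) K₀ S ⟩
        length A * (K₀ * S)                       ≤⟨ ∑-≥-const A (K₀ * S) (λ x∈ → <⇒≤ (proj₂ (∈-filter⁻ high? {xs = U} x∈))) ⟩
        ∑ A (λ x → count (adj? G x) U * u)        ≤⟨ ∑-filter-≤ high? U _ ⟩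
        ∑ U (λ x → count (adj? G x) U * u)        ≡⟨ trans (∑-cong U λ _ → *-comm _ u) (∑-*ˡ U u _) ⟩
        u * S                                     ∎)
        where open ≤-Reasoning

      -- Otherwise the few vertices of high degree together with a suitable small part of
      -- the rest would be denser than U.
      high-share : 4 * between A U < S
      high-share = ≰⇒> λ S≤4 →
        -- With `K₀` chunks of about `u / K₀` vertices, a size comparable to the bound on `A`, the
        -- heaviest receives at least a `1 / K₀` share of the edges from `A` to `L`.
        let b = suc (u / K₀)
            B , B! , B⊆ , B≤ , share = heavy-chunk (λ y → count (adj? G y) A) b (pred K₀) L (Unique.filter⁺ (¬? ∘ high?) U!)
              (≤-trans (length-filter (¬? ∘ high?) U) (≤-trans (<⇒≤ u<) (≤-reflexive (cong (_* b) (sym (suc-pred K₀))))))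
        in impossible B (Unique.++⁺ (Unique.filter⁺ high? U!) B! (λ (x∈A , x∈B) →
             proj₂ (∈-filter⁻ (¬? ∘ high?) {xs = U} (B⊆ x∈B)) (proj₂ (∈-filter⁻ high? {xs = U} x∈A)))) B≤
             (≤-trans share (≤-reflexive (cong₂ _*_ (suc-pred K₀) (between-sym B A)))) S≤4
        where
        open ≤-Reasoning
        u< : u < K₀ * suc (u / K₀)
        u< = begin-strict
          u                        ≡⟨ m≡m%n+[m/n]*n u K₀ ⟩
          u % K₀ + u / K₀ * K₀     <⟨ +-monoˡ-< (u / K₀ * K₀) (m%n<n u K₀) ⟩
          K₀ + u / K₀ * K₀         ≡⟨ *-comm (suc (u / K₀)) K₀ ⟩
          K₀ * suc (u / K₀)        ∎
        impossible : ∀ B → Unique (A ++ B) → length B ≤ suc (u / K₀) → ∑ L (λ y → count (adj? G y) A) ≤ K₀ * between A B →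
                     ¬ S ≤ 4 * between A U
        impossible B AB! B≤ share S≤4 = <⇒≱ power (begin
          K₀ ^ p * S ^ q
            ≤⟨ *-monoʳ-≤ (K₀ ^ p) (^-monoˡ-≤ q S≤AB) ⟩
          K₀ ^ p * (4 * K₀ * degreeSum (A ++ B)) ^ q
            ≡⟨ cong (K₀ ^ p *_) (*-^ (4 * K₀) _ q) ⟩
          K₀ ^ p * ((4 * K₀) ^ q * degreeSum (A ++ B) ^ q)
            ≤⟨ *-monoʳ-≤ (K₀ ^ p) (*-monoʳ-≤ ((4 * K₀) ^ q) (smaller (A ++ B) AB! AB<)) ⟩
          K₀ ^ p * ((4 * K₀) ^ q * (C * length (A ++ B) ^ p))
            ≡⟨ trans (shuffle (K₀ ^ p) ((4 * K₀) ^ q) C (length (A ++ B) ^ p)) (cong ((4 * K₀) ^ q * C *_) (sym (*-^ K₀ _ p))) ⟩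
          (4 * K₀) ^ q * C * (K₀ * length (A ++ B)) ^ p
            ≤⟨ *-monoʳ-≤ ((4 * K₀) ^ q * C) (^-monoˡ-≤ p AB≤) ⟩
          (4 * K₀) ^ q * C * (3 * u) ^ p
            ≡⟨ cong₂ (λ x y → x * C * y) (*-^ 4 K₀ q) (*-^ 3 u p) ⟩
          4 ^ q * K₀ ^ q * C * (3 ^ p * u ^ p)
            ≡⟨ gather (4 ^ q) (K₀ ^ q) C (3 ^ p) (u ^ p) ⟩
          K₀ * K₀ ^ q * (C * u ^ p) ∎)
          where
          shuffle : ∀ k f C l → k * (f * (C * l)) ≡ f * C * (k * l)
          shuffle = solve-∀
          gather : ∀ f k C t v → f * k * C * (t * v) ≡ f * t * k * (C * v)
          gather = solve-∀
          power : K₀ * K₀ ^ q * (C * u ^ p) < K₀ ^ p * S ^ q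
          power = begin-strict
            K₀ * K₀ ^ q * (C * u ^ p)  <⟨ *-monoʳ-< (K₀ * K₀ ^ q) {{m*n≢0 K₀ (K₀ ^ q) {{K₀≢0}} {{m^n≢0 K₀ q}}}} dense ⟩
            -- Here `s` is positive, so `p` exceeds `q`; the factor `K₀` gained absorbs
            -- `4 ^ q * 3 ^ p`.
            K₀ * K₀ ^ q * S ^ q        ≤⟨ *-monoˡ-≤ (S ^ q) (^-monoʳ-≤ K₀ (≤-trans (≤-reflexive (+-comm 1 q)) (+-monoʳ-≤ q (>-nonZero⁻¹ s)))) ⟩
            K₀ ^ p * S ^ q             ∎
          AB≤ : K₀ * length (A ++ B) ≤ 3 * u
          AB≤ = begin
            K₀ * length (A ++ B)               ≡⟨ cong (K₀ *_) (length-++ A) ⟩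
            K₀ * (length A + length B)         ≡⟨ *-distribˡ-+ K₀ (length A) _ ⟩
            K₀ * length A + K₀ * length B
              ≤⟨ +-mono-≤ (≤-trans (≤-reflexive (*-comm K₀ _)) few-high) (*-monoʳ-≤ K₀ B≤) ⟩
            u + K₀ * suc (u / K₀)              ≡⟨ cong (_+_ u) (*-suc K₀ (u / K₀)) ⟩
            u + (K₀ + K₀ * (u / K₀))           ≤⟨ +-monoʳ-≤ u (+-mono-≤ u≥K₀ (≤-trans (≤-reflexive (*-comm K₀ _)) (m/n*n≤m u K₀))) ⟩
            u + (u + u)                        ≡⟨ triple u ⟩
            3 * u                              ∎
            where
            triple : ∀ u → u + (u + u) ≡ 3 * u
            triple = solve-∀
          AB< : length (A ++ B) < u
          AB< = *-cancelˡ-< K₀ _ _ (≤-<-trans AB≤ (*-monoˡ-< u 3<K₀))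
          S≤AB : S ≤ 4 * K₀ * degreeSum (A ++ B)
          S≤AB = begin
            S                                    ≤⟨ S≤4 ⟩
            4 * between A U                      ≡⟨ cong (4 *_) (trans (∑-cong A λ _ → ∑-partition high? U _) (∑-+ A _ _)) ⟩
            4 * (between A A + between A L)
              ≤⟨ *-monoʳ-≤ 4 (+-mono-≤ (m≤n*m (between A A) K₀) (≤-trans (≤-reflexive (between-sym A L)) share)) ⟩
            4 * (K₀ * between A A + K₀ * between A B)
              ≡⟨ trans (cong (4 *_) (sym (*-distribˡ-+ K₀ (between A A) _))) (sym (*-assoc 4 K₀ _)) ⟩
            4 * K₀ * (between A A + between A B)
              ≡⟨ cong (4 * K₀ *_) (trans (sym (∑-+ A _ _)) (∑-cong A λ _ → sym (∑-++ A B _))) ⟩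
            4 * K₀ * between A (A ++ B)
              ≤⟨ *-monoʳ-≤ (4 * K₀) (≤-trans (m≤m+n _ _) (≤-reflexive (sym (∑-++ A B _)))) ⟩
            4 * K₀ * degreeSum (A ++ B)          ∎

      -- By `high-share`, `L` keeps more than half of `S`; the divisor `5 * u` makes
      -- `2 * d * length L` at most `2 * S / 5`, as `prune` requires.
      d : ℕ
      d = _/_ S (5 * u) {{m*n≢0 5 u}}

      S≥ : d * (5 * u) ≤ S
      S≥ = m/n*n≤m S (5 * u) {{m*n≢0 5 u}}

      S< : S < suc d * (5 * u)
      S< = begin-strict
        S                                         ≡⟨ m≡m%n+[m/n]*n S (5 * u) {{m*n≢0 5 u}} ⟩
        _%_ S (5 * u) {{m*n≢0 5 u}} + d * (5 * u) <⟨ +-monoˡ-< (d * (5 * u)) (m%n<n S (5 * u) {{m*n≢0 5 u}}) ⟩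
        suc d * (5 * u)                           ∎
        where open ≤-Reasoning

      d>0 : 0 < d
      d>0 = n≢0⇒n>0 λ eq → <⇒≱ S< (≤-trans (≤-reflexive (trans (cong (λ e → suc e * (5 * u)) eq) (*-identityˡ (5 * u)))) 5u≤S)

      S≤10 : S ≤ 10 * u * d
      S≤10 = begin
        S                      ≤⟨ <⇒≤ S< ⟩
        suc d * (5 * u)        ≤⟨ *-monoˡ-≤ (5 * u) (+-monoˡ-≤ d d>0) ⟩
        (d + d) * (5 * u)      ≡⟨ double d u ⟩
        10 * u * d             ∎
        where
        open ≤-Reasoning
        double : ∀ d u → (d + d) * (5 * u) ≡ 10 * u * d
        double = solve-∀

      L-dense : 2 * d * length L < degreeSum L
      L-dense = *-cancelˡ-< 2 _ _ (≤-<-trans (begin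
        2 * (2 * d * length L)   ≤⟨ *-monoʳ-≤ 2 (*-monoʳ-≤ (2 * d) (length-filter (¬? ∘ high?) U)) ⟩
        2 * (2 * d * u)          ≤⟨ ≤-trans (m≤m+n _ (d * u)) (≤-reflexive (five d u)) ⟩
        d * (5 * u)              ≤⟨ S≥ ⟩
        S                        ∎) (+-cancelˡ-< S _ _ (begin-strict
        S + S                                        ≡⟨ two S ⟩
        2 * S                                        ≤⟨ *-monoʳ-≤ 2 (deletion high? U) ⟩
        2 * (2 * between A U + degreeSum L)          ≡⟨ four (between A U) (degreeSum L) ⟩
        4 * between A U + 2 * degreeSum L            <⟨ +-monoˡ-< (2 * degreeSum L) high-share ⟩
        S + 2 * degreeSum L                          ∎)))
        where
        open ≤-Reasoning
        five : ∀ d u → 2 * (2 * d * u) + d * u ≡ d * (5 * u)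
        five = solve-∀
        two : ∀ S → S + S ≡ 2 * S
        two = solve-∀
        four : ∀ a l → 2 * (2 * a + l) ≡ 4 * a + 2 * l
        four = solve-∀

      almostRegular : AlmostRegular
      almostRegular =
        let W , W! , W⊆L , W>0 , deg≥ = prune d (length L) L ≤-refl (Unique.filter⁺ (¬? ∘ high?) U!) L-dense in
        record
        { W = W ; W! = W! ; W>0 = W>0 ; d = d
        ; deg≥ = λ {x} x∈ → ≤-trans (deg≥ x∈) (≤-reflexive (sym (count-filter (adj? G x) W)))
        ; deg≤ = λ x∈ → degree≤ W W! (λ y∈ → proj₁ (∈-filter⁻ (¬? ∘ high?) {xs = U} (W⊆L y∈))) (proj₂ (∈-filter⁻ (¬? ∘ high?) {xs = U} (W⊆L x∈)))
        ; large = ≤-trans (*-monoʳ-≤ C₁ (^-monoˡ-≤ s (Unique⊆⇒length≤ W! λ y∈ → proj₁ (∈-filter⁻ (¬? ∘ high?) {xs = U} (W⊆L y∈))))) large′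
        }
        where
        open ≤-Reasoning
        degree≤ : ∀ W → Unique W → (∀ {y} → y ∈ W → y ∈ U) → ∀ {x} → ¬ K₀ * S < count (adj? G x) U * u →
                  length (filter (adj? G x) W) ≤ R * d
        degree≤ W W! W⊆ {x} low = *-cancelʳ-≤ _ _ u (begin
          length (filter (adj? G x) W) * u
            ≤⟨ *-monoˡ-≤ u (Unique⊆⇒length≤ (Unique.filter⁺ (adj? G x) W!) λ y∈ →
                 let y∈W , xy = ∈-filter⁻ (adj? G x) y∈ in ∈-filter⁺ (adj? G x) (W⊆ y∈W) xy) ⟩
          length (filter (adj? G x) U) * u  ≡⟨ cong (_* u) (count-filter (adj? G x) U) ⟩
          count (adj? G x) U * u            ≤⟨ ≮⇒≥ low ⟩
          K₀ * S                            ≤⟨ *-monoʳ-≤ K₀ S≤10 ⟩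
          K₀ * (10 * u * d)                 ≡⟨ shuffle K₀ u d ⟩
          R * d * u                         ∎)
          where
          shuffle : ∀ k u d → k * (10 * u * d) ≡ 10 * k * d * u
          shuffle = solve-∀
        -- Divide `C * u ^ p < S ^ q` by `(10 * u) ^ q`; as `p` is `q + s`, a factor `u ^ s`
        -- remains.
        large′ : C₁ * u ^ s ≤ d ^ q
        large′ = *-cancelˡ-≤ (10 ^ q * u ^ q) {{m*n≢0 (10 ^ q) (u ^ q) {{m^n≢0 10 q}} {{m^n≢0 u q}}}} (begin
          10 ^ q * u ^ q * (C₁ * u ^ s)     ≡⟨ regroup (10 ^ q) (u ^ q) C₁ (u ^ s) ⟩
          10 ^ q * C₁ * (u ^ q * u ^ s)     ≤⟨ *-mono-≤ C≥₁ (≤-reflexive (sym (^-distribˡ-+-* u q s))) ⟩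
          C * u ^ p                         ≤⟨ <⇒≤ dense ⟩
          S ^ q                             ≤⟨ ^-monoˡ-≤ q S≤10 ⟩
          (10 * u * d) ^ q                  ≡⟨ trans (*-^ (10 * u) d q) (cong (_* d ^ q) (*-^ 10 u q)) ⟩
          10 ^ q * u ^ q * d ^ q            ∎)
          where
          regroup : ∀ t u C v → t * u * (C * v) ≡ t * C * (u * v)
          regroup = solve-∀

    -- Strong induction on the size of `U`: its hypothesis is exactly the minimality that
    -- `almostRegular` assumes.
    sparse : ¬ AlmostRegular → ∀ U → Unique U → Sparse U
    sparse none U U! = go (suc (length U)) U U! ≤-refl
      where
      go : ∀ l U → Unique U → length U < l → Sparse U
      go (suc l) U U! U< = ≮⇒≥ λ dense → none (Minimal.almostRegular U U! dense λ U′ U′! U′< →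
        go l U′ U′! (≤-trans U′< (≤-pred U<)))

-- Extremal numbers

module _ {n : ℕ} (G : Graph n) where

  open Regularisation G

  edges≤degreeSum : #edges G ≤ degreeSum (allFin n)
  edges≤degreeSum = begin
    #edges G
      ≡⟨ count-filter (isEdge? G) (cartesianProduct (allFin n) (allFin n)) ⟩
    count (isEdge? G) (cartesianProduct (allFin n) (allFin n))
      ≤⟨ ∑-mono (cartesianProduct (allFin n) (allFin n)) (λ {uv} _ →
           𝟙-mono (isEdge? G uv) (adj? G (proj₁ uv) (proj₂ uv)) proj₂) ⟩
    ∑ (cartesianProduct (allFin n) (allFin n)) (λ uv → 𝟙 (adj? G (proj₁ uv) (proj₂ uv)))
      ≡⟨ ∑-product (allFin n) ⟩
    degreeSum (allFin n) ∎
    where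
    open ≤-Reasoning
    ∑-product : ∀ xs → ∑ (cartesianProduct xs (allFin n)) (λ uv → 𝟙 (adj? G (proj₁ uv) (proj₂ uv))) ≡ between xs (allFin n)
    ∑-product []       = refl
    ∑-product (x ∷ xs) = trans (∑-++ (map (x ,_) (allFin n)) _ _) (cong₂ _+_ (∑-map (x ,_) (allFin n) _) (∑-product xs))

Placement : ∀ {h} → Graph h → ℕ → ℕ → Set
Placement {h} H s t = Σ (Fin h → Fin s ⊎ Fin t) λ σ →
  (∀ {u v} → σ u ≡ σ v → u ≡ v) × (∀ {u v} → Adj H u v → Opposite (σ u) (σ v))

module Bound {h : ℕ} (H : Graph h) (s t κ : ℕ) {{s≢0 : NonZero s}} (placement : Placement H s t) where

  -- `M` is the size of the whole copy: `s` leaves and `t` stars of `suc (s * κ)` vertices. The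
  -- first argument of `denseFactor` is `R`, spelled out because `RegularSubset` takes `C₁` as a
  -- parameter.
  q M C₁ : ℕ
  q = suc (s * suc κ)
  M = t * suc (s * κ) + s
  C₁ = Constants.denseFactor (10 * (4 ^ q * 3 ^ (q + s))) s κ M

  open RegularSubset q s C₁

  free-sparse : ∀ {n} (G : Graph n) → Free (subdivision κ H) G → #edges G ^ q ≤ C * n ^ (q + s)
  free-sparse {n} G free = begin
    #edges G ^ q                                     ≤⟨ ^-monoˡ-≤ q (edges≤degreeSum G) ⟩
    Regularisation.degreeSum G (allFin n) ^ q        ≤⟨ sparse G none (allFin n) (Unique.allFin⁺ n) ⟩
    C * length (allFin n) ^ (q + s)                  ≡⟨ cong (λ l → C * l ^ (q + s)) (length-tabulate {n = n} id) ⟩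
    C * n ^ (q + s)                                  ∎
    where
    open ≤-Reasoning
    none : ¬ AlmostRegular G
    none regular = finish (Dichotomy.starry G W W! d R deg≥ deg≤ s κ M {{m*n≢0 10 K₀}} W>0 large)
      where
      open AlmostRegular regular
      finish : ¬ Dichotomy.Result G W W! d R deg≥ deg≤ s κ M {{m*n≢0 10 K₀}} W>0 large
      finish (as , len , as! , starry) =
        let σ , σ-inj , σ-opp = placement
            link = Assembly.linkage G W W! as! starry t (≤-reflexive (cong (λ l → t * suc (l * κ) + l) len))
        in free (Embedding.contains G H (subst (λ l → Linkage G l t κ) len link) σ σ-inj σ-opp)

ex-bound : ∀ {h} (H : Graph h) q C p {{_ : NonZero q}} →
           (∀ {n} (G : Graph n) → Free H G → #edges G ^ q ≤ C * n ^ p) → ∀ n → ex n H ^ q ≤ C * n ^ p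
ex-bound H q C p bound n with argmax-sel id 0 (map #edges (filter (free? H) (allGraphs n)))
-- The default value of `ex`; a positive `q` keeps its power zero.
... | inj₁ ex≡0 = ≤-trans (≤-reflexive (trans (cong (_^ q) ex≡0) (zero-pow q))) z≤n
  where
  zero-pow : ∀ q {{_ : NonZero q}} → 0 ^ q ≡ 0
  zero-pow (suc q) = refl
... | inj₂ ex∈ with ∈-map⁻ #edges ex∈
...   | G , G∈ , ex≡ = subst (λ e → e ^ q ≤ C * n ^ p) (sym ex≡)
        (bound G (proj₂ (∈-filter⁻ (free? H) {xs = allGraphs n} G∈)))

K-placement : ∀ s t → Placement (K s t) s t
K-placement s t = splitAt s ,
  (λ {u} {v} eq → trans (sym (Fin.join-splitAt s t u)) (trans (cong (Data.Fin.join s t) eq) (Fin.join-splitAt s t v))) , id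

-- Sides of size `suc h` rather than `h` remain nonempty for the graph without vertices.
bipartite-placement : ∀ {h} (H : Graph h) → Bipartite H → Placement H (suc h) (suc h)
bipartite-placement {h} H (c , proper) = (λ v → side (c v) v) , (λ {u} {v} → side-inj (c u) (c v)) ,
  λ {u} {v} uv → side-opp (c u) (c v) (proper u v uv)
  where
  side : Bool → Fin h → Fin (suc h) ⊎ Fin (suc h)
  side true  v = inj₁ (inject₁ v)
  side false v = inj₂ (inject₁ v)
  side-inj : ∀ b b′ {u v} → side b u ≡ side b′ v → u ≡ v
  side-inj true  true  eq = Fin.inject₁-injective (inj₁-injective eq)
  side-inj false false eq = Fin.inject₁-injective (inj₂-injective eq)
  side-opp : ∀ b b′ {u v} → b ≢ b′ → Opposite (side b u) (side b′ v)
  side-opp true  true  b≢b = ⊥-elim (b≢b refl)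
  side-opp true  false _   = tt
  side-opp false true  _   = tt
  side-opp false false b≢b = ⊥-elim (b≢b refl)

=O-intro : ∀ f α p q → ℚ.↥ α ≡ ℤ.+ p → ℚ.↧ₙ α ≡ q → PowerBound f (ℤ.+ p) q → f =O[n^ α ]
=O-intro f α p q p≡ q≡ bound = subst₂ (PowerBound f) (sym p≡) (sym q≡) bound

-- Unnormalised arithmetic leaves `1 + 1 / k - δ` with a common factor `k * k` in numerator and
-- denominator, so the bound is raised to this power.
PowerBound-scale : ∀ f p q r → PowerBound f (ℤ.+ p) q → PowerBound f (ℤ.+ (r * p)) (r * q)
PowerBound-scale f p q r (C , N , bound) = C ^ r , N , λ n n≥N → begin
  f n ^ (r * q)          ≡⟨ trans (cong (f n ^_) (*-comm r q)) (sym (^-*-assoc (f n) q r)) ⟩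
  (f n ^ q) ^ r          ≤⟨ ^-monoˡ-≤ r (bound n n≥N) ⟩
  (C * n ^ p) ^ r        ≡⟨ *-^ C (n ^ p) r ⟩
  C ^ r * (n ^ p) ^ r    ≡⟨ cong (C ^ r *_) (trans (^-*-assoc n p r) (cong (n ^_) (*-comm p r))) ⟩
  C ^ r * n ^ (r * p)    ∎
  where open ≤-Reasoning

subdivision-bound : ∀ {h} (H : Graph h) s t k {{_ : NonZero s}} .{{_ : NonZero k}} → Placement H s t →
  PowerBound (λ n → ex n (subdivision (k ∸ 1) H)) (ℤ.+ (suc (s * k) + s)) (suc (s * k))
subdivision-bound H s t k placement = subst (λ l → PowerBound (λ n → ex n (subdivision (k ∸ 1) H)) (ℤ.+ (suc (s * l) + s)) (suc (s * l)))
  (suc-pred k) (RegularSubset.C q s C₁ , 0 , λ n _ →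
    ex-bound (subdivision (k ∸ 1) H) q (RegularSubset.C q s C₁) (q + s) free-sparse n)
  where open Bound H s t (k ∸ 1) placement

-- The difference 1 / k - s / (s k + 1) = 1 / (k (s k + 1)), at suc k.
gap : ℕ → ℕ → ℚᵘ
gap s k = ℚ.mkℚᵘ (ℤ.+ 1) (s * suc k + k * suc (s * suc k))

gap-numerator : ∀ s k → ℚ.↥ (1ℚᵘ ℚ.+ (ℤ.+ 1) ℚ./ suc k ℚ.- gap s k) ≡ ℤ.+ (suc k * suc k * (suc (s * suc k) + s))
gap-numerator s k = trans (cong (ℤ._⊖ suc (k + 0 + 0)) (expand s k)) (cancel (suc k * suc k * (suc (s * suc k) + s)) (suc (k + 0 + 0)))
  where
  expand : ∀ s k → suc (s * suc k + k * suc (s * suc k) + (k + 0 + 1) * suc (s * suc k + k * suc (s * suc k))) ≡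
                   suc k * suc k * (suc (s * suc k) + s) + suc (k + 0 + 0)
  expand = solve-∀
  cancel : ∀ a b → (a + b) ℤ.⊖ b ≡ ℤ.+ a
  cancel a b = trans (ℤ.⊖-≥ (m≤n+m b a)) (cong ℤ.+_ (m+n∸n≡m a b))

gap-denominator : ∀ s k → ℚ.↧ₙ (1ℚᵘ ℚ.+ (ℤ.+ 1) ℚ./ suc k ℚ.- gap s k) ≡ suc k * suc k * suc (s * suc k)
gap-denominator = expand
  where
  expand : ∀ s k → suc (s * suc k + k * suc (s * suc k) + (k + 0) * suc (s * suc k + k * suc (s * suc k))) ≡
                   suc k * suc k * suc (s * suc k)
  expand = solve-∀

theorem1p16 :
    (∀ (s t k : ℕ) .{{_ : NonZero s}} .{{_ : NonZero t}} .{{_ : NonZero k}} →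
       (λ n → ex n (subdivision (k ∸ 1) (K s t))) =O[n^ 1ℚᵘ ℚ.+ (ℤ.+ s) ℚ./ suc (s * k) ])
    ×
    (∀ {h : ℕ} (H : Graph h) → Bipartite H → ∀ (k : ℕ) .{{_ : NonZero k}} →
       ∃ λ (δ : ℚᵘ) → 0ℚᵘ ℚ.< δ ×
         (λ n → ex n (subdivision (k ∸ 1) H)) =O[n^ 1ℚᵘ ℚ.+ (ℤ.+ 1) ℚ./ k ℚ.- δ ])
theorem1p16 = complete , bipartite
  where
  complete : ∀ (s t k : ℕ) .{{_ : NonZero s}} .{{_ : NonZero t}} .{{_ : NonZero k}} →
    (λ n → ex n (subdivision (k ∸ 1) (K s t))) =O[n^ 1ℚᵘ ℚ.+ (ℤ.+ s) ℚ./ suc (s * k) ]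
  complete s t k = =O-intro (λ n → ex n (subdivision (k ∸ 1) (K s t))) (1ℚᵘ ℚ.+ (ℤ.+ s) ℚ./ suc (s * k))
    (suc (s * k) + s) (suc (s * k))
    (cong₂ ℤ._+_ (ℤ.*-identityˡ (ℤ.+ suc (s * k))) (ℤ.*-identityʳ (ℤ.+ s))) (*-identityˡ (suc (s * k)))
    (subdivision-bound (K s t) s t k {{>-nonZero (>-nonZero⁻¹ s)}} (K-placement s t))

  bipartite : ∀ {h : ℕ} (H : Graph h) → Bipartite H → ∀ (k : ℕ) .{{_ : NonZero k}} →
    ∃ λ (δ : ℚᵘ) → 0ℚᵘ ℚ.< δ × (λ n → ex n (subdivision (k ∸ 1) H)) =O[n^ 1ℚᵘ ℚ.+ (ℤ.+ 1) ℚ./ k ℚ.- δ ]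
  bipartite {h} H bip (suc k) = gap (suc h) k , ℚ.*<* (ℤ.+<+ z<s) ,
    =O-intro f (1ℚᵘ ℚ.+ (ℤ.+ 1) ℚ./ suc k ℚ.- gap (suc h) k)
      (suc k * suc k * (suc (suc h * suc k) + suc h)) (suc k * suc k * suc (suc h * suc k))
      (gap-numerator (suc h) k) (gap-denominator (suc h) k)
      (PowerBound-scale f (suc (suc h * suc k) + suc h) (suc (suc h * suc k)) (suc k * suc k)
        (subdivision-bound H (suc h) (suc h) (suc k) (bipartite-placement H bip)))
    where
    f : ℕ → ℕ
    f n = ex n (subdivision (suc k ∸ 1) H)
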